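{- Let $k,m$ be positive integers, let $G$ be a graph and let $Q\subseteq V(G)$ with $|Q|$ even. Then $G$ has an $m$-tree-connected spanning subgraph $H$ such that for each vertex $v$, $$d_H(v)\ge d_G(v)-\begin{cases}\big\lceil\frac{d_G(v)-m}{k}\big\rceil, & \text{if } G \text{ is } (k+m)\text{ -tree-connected},\\ \big\lceil\frac{d_G(v)}{2k}\big\rceil+1, & \text{if } G \text{ is } (2k+2m)\text{ -edge-connected},\end{cases}$$ and also $d_H(v)$ is odd if and only if $v\in Q$.
   Context: All graphs are finite, without loops, multiple edges allowed. A graph is $m$-tree-connected if it has $m$ edge-disjoint spanning trees.
   Formalization: In the first case d_G(v) − m is read as max(d_G(v) − m, 0); this differs only for the one-vertex graph with m ≥ k, where the bound as written would demand positive degree at an isolated vertex and is false. -}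

module Defs where

open import Data.Nat using (ℕ; zero; suc; _+_; _*_; _∸_; _<_; _≤_; NonZero)
open import Data.Nat.DivMod using (_/_; _%_)
open import Data.Fin using (Fin)
open import Data.Fin.Properties using (_≟_)
open import Data.Fin.Subset using (Subset; _∈_; _⊆_; _∩_; _-_; ∁; ∣_∣; ⊤)
open import Data.Vec using (tabulate)
open import Data.Bool using (_∨_)
open import Data.Product using (_×_; _,_; proj₁; proj₂; Σ)
open import Relation.Nullary using (¬_)
open import Relation.Nullary.Decidable using (⌊_⌋)
open import Relation.Binary.PropositionalEquality using (_≡_; _≢_)

-- A finite loopless multigraph: vertices Fin n, edges Fin e,
-- each edge i has endpoints ends i = (a , b) with a ≢ b.
-- Parallel edges are allowed (ends need not be injective).
record Graph : Set where
  field
    n    : ℕ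
    e    : ℕ
    ends : Fin e → Fin n × Fin n
    loopless : ∀ i → proj₁ (ends i) ≢ proj₂ (ends i)
open Graph public

-- Spanning subgraphs of G are identified with their edge sets (Subset (e G)).

incident : (G : Graph) → Fin (n G) → Subset (e G)
incident G v = tabulate (λ i → ⌊ v ≟ proj₁ (ends G i) ⌋ ∨ ⌊ v ≟ proj₂ (ends G i) ⌋)

deg : (G : Graph) → Subset (e G) → Fin (n G) → ℕ
deg G S v = ∣ S ∩ incident G v ∣

data Reach (G : Graph) (S : Subset (e G)) : Fin (n G) → Fin (n G) → Set where
  here : ∀ {u} → Reach G S u u
  fwd  : ∀ {u} i → i ∈ S → Reach G S u (proj₁ (ends G i)) → Reach G S u (proj₂ (ends G i))
  bwd  : ∀ {u} i → i ∈ S → Reach G S u (proj₂ (ends G i)) → Reach G S u (proj₁ (ends G i))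

Connected : (G : Graph) → Subset (e G) → Set
Connected G S = ∀ u v → Reach G S u v

-- The spanning subgraph with edge set T is acyclic (a forest):
-- no edge of T lies on a cycle, i.e. its endpoints are not joined in T - i.
Acyclic : (G : Graph) → Subset (e G) → Set
Acyclic G T = ∀ i → i ∈ T → ¬ Reach G (T - i) (proj₁ (ends G i)) (proj₂ (ends G i))

SpanningTreeOf : (G : Graph) → Subset (e G) → Subset (e G) → Set
SpanningTreeOf G S T = T ⊆ S × Connected G T × Acyclic G T

TreeConnected : (G : Graph) → Subset (e G) → ℕ → Set
TreeConnected G S m =
  Σ (Fin m → Subset (e G)) λ T →
    (∀ j → SpanningTreeOf G S (T j)) ×
    (∀ j j' → j ≢ j' → ∀ i → i ∈ T j → i ∈ T j' → ⊥')
  where open import Data.Empty renaming (⊥ to ⊥')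

EdgeConnected : (G : Graph) → ℕ → Set
EdgeConnected G l = ∀ (F : Subset (e G)) → ∣ F ∣ < l → Connected G (∁ F)

allEdges : (G : Graph) → Subset (e G)
allEdges G = ⊤

-- Ceiling division ⌈ a / b ⌉ for b > 0 (the b = 0 clause is a dummy,
-- never used in the statement since there b ≥ 1).
⌈_/_⌉ : ℕ → ℕ → ℕ
⌈ a / zero ⌉ = 0
⌈ a / suc b ⌉ = (a + b) / suc b

Odd : ℕ → Set
Odd x = x % 2 ≡ 1

Even : ℕ → Set
Even x = x % 2 ≡ 0

{-# OPTIONS --safe #-}
module Submission where

-- H is obtained by deleting from G an edge set F of prescribed degree parity, contained in the union of k connected
-- spanning subgraphs T₁, …, T_k that are edge-disjoint from m spanning trees; so it suffices to find such an F with
-- deg F v ≤ ⌈Σ_j deg T_j v / k⌉.  Let f v be the largest number of the right parity below this bound.  A Tutte-type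
-- theorem gives F as soon as every vertex set S leaves at most f(S) components of odd demand.  If S leaves q of them, every T_j
-- has at least q + |S| - 1 edges touching S, hence f(S) ≥ q - 1, and parity excludes f(S) = q - 1.
--
-- If G is (k+m)-tree-connected, k of the trees serve as the T_j, and the m others use m edges at every vertex.
-- If G is (2k+2m)-edge-connected, orient it with in-degrees at least ⌊deg/2⌋ so that k + m arcs enter every vertex set
-- avoiding a root.  By Edmonds' theorem there are k + m disjoint arborescences, and k of them have
-- total degree at most ⌈deg/2⌉ + k.

open import Defs
open import Data.Bool using (Bool; true; false; _∧_; _∨_; _xor_; not; if_then_else_)
open import Data.Bool.Properties using (¬-not; ∨-identityʳ; ∧-identityʳ) renaming (_≟_ to _≟ᵇ_)
open import Data.Empty using (⊥-elim) renaming (⊥ to Empty)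
open import Data.Fin using (Fin; zero; suc; _↑ˡ_; _↑ʳ_; splitAt)
open import Data.Fin.Properties using (_≟_; suc-injective; all?; any?; ↑ˡ-injective; ↑ʳ-injective; splitAt-↑ˡ; splitAt-↑ʳ)
open import Data.Fin.Subset using (Subset; _∈_; _∉_; _⊆_; _∩_; _∪_; ∁; ⁅_⁆; ⊤; ⊥; ∣_∣) renaming (_-_ to _∖_)
open import Data.Fin.Subset.Properties using (_∈?_; _⊆?_; anySubset?; x∈p∪q⁺; x∈p∪q⁻; x∈p∩q⁺; x∈p∩q⁻; x∈⁅x⁆; x∈⁅y⁆⇒x≡y; ∉⊥; ∈⊤; x∉p⇒x∈∁p; x∈∁p⇒x∉p; nonempty?; ∪-assoc; p∪∁p≡⊤; x∈p⇒∣p-x∣<∣p∣; x∈p∧x≢y⇒x∈p-y; p⊂q⇒∣p∣<∣q∣; p∩q⊆p; p⊆p∪q; ∣p∣≤n)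
open import Data.Nat using (ℕ; zero; suc; NonZero; _+_; _*_; _∸_; _≥_; _≤_; _<_; z≤n; s≤s; _≤?_; _<?_; >-nonZero⁻¹) renaming (_≟_ to _≟ℕ_)
open import Data.Nat.DivMod using (_/_; _%_; m%n<n; m≡m%n+[m/n]*n; %-distribˡ-+; [m+kn]%n≡m%n; m%n≤m; m<n*o⇒m/o<n)
open import Data.Nat.Properties hiding (_≟_; suc-injective)
open import Data.Nat.Tactic.RingSolver using (solve-∀)
open import Data.Product using (_×_; Σ; ∃; _,_; proj₁; proj₂)
open import Data.Sum using (_⊎_; inj₁; inj₂; [_,_]′)
open import Data.Vec using ([]; _∷_; lookup; tabulate)
open import Data.Vec.Properties using (lookup∘tabulate; lookup-zipWith; lookup⇒[]=; []=⇒lookup; lookup-map)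
open import Function.Base using (_∘_; id)
open import Function.Bundles using (_⇔_; mk⇔)
open import Relation.Nullary using (¬_; Dec; yes; no; contradiction)
open import Relation.Nullary.Decidable using (⌊_⌋; _×-dec_; _⊎-dec_; _→-dec_; ¬?; decidable-stable)
open import Relation.Binary.PropositionalEquality using (_≡_; _≢_; refl; sym; trans; cong; cong₂; subst; subst₂; module ≡-Reasoning)
open import Algebra.Properties.Semiring.Sum +-*-semiring using (sum; sum-cong-≗; ∑-distrib-+; ∑-comm; *-distribˡ-sum)

-- The Tutte-type theorem is proved by induction on the total demand, and only under double
-- negation: the barrier it relies on is a minimum over colourings with arbitrarily many colours,
-- which is not computed. Since `F` is one of finitely many edge sets, it is recovered afterwards by
-- search. The induction adds up demands and lets edges repeat; at the very end the edges of odd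
-- multiplicity are kept, which lowers degrees by even amounts only.
--
-- The classes outside a barrier are arbitrary unions of components. Merging components never
-- increases the number of odd ones, so the condition is no stronger than the one for components.
--
-- Rounding down to the right parity may cost one unit at every vertex of S. This is affordable
-- because the count q + |S| - 1 contains |S|: with the ceiling at most f + 1, the two occurrences
-- of |S| cancel.
--
-- The extra 1 in the second bound is the price of arcs entering a vertex: at most one for each of
-- the k arborescences, and k divided by k is 1.

transfer-≤ : ∀ {L R a b} → L ≤ R → a + R ≡ b + L → a ≤ b
transfer-≤ {L} {R} {a} {b} L≤R eq = +-cancelʳ-≤ R a b (≤-trans (≤-reflexive eq) (+-monoʳ-≤ b L≤R))

≡0∨≡1 : ∀ {a} → a ≤ 1 → a ≡ 0 ⊎ a ≡ 1
≡0∨≡1 z≤n       = inj₁ refl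
≡0∨≡1 (s≤s z≤n) = inj₂ refl

%2-cases : ∀ a → a % 2 ≡ 0 ⊎ a % 2 ≡ 1
%2-cases a = ≡0∨≡1 (≤-pred (m%n<n a 2))

half : ∀ a → a ≡ a % 2 + (a / 2 + a / 2)
half a = trans (m≡m%n+[m/n]*n a 2) (cong (a % 2 +_) (double (a / 2)))
  where
  double : ∀ x → x * 2 ≡ x + x
  double = solve-∀

%2-+double : ∀ a b → (a + (b + b)) % 2 ≡ a % 2
%2-+double a b = trans (cong (λ x → (a + x) % 2) (double b)) ([m+kn]%n≡m%n a b 2)
  where
  double : ∀ x → x + x ≡ x * 2
  double = solve-∀

double-%2 : ∀ b → (b + b) % 2 ≡ 0
double-%2 = %2-+double 0

%2-cong-+ : ∀ a b a' b' → a % 2 ≡ a' % 2 → b % 2 ≡ b' % 2 → (a + b) % 2 ≡ (a' + b') % 2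
%2-cong-+ a b a' b' p q =
  trans (%-distribˡ-+ a b 2) (trans (cong₂ (λ x y → (x + y) % 2) p q) (sym (%-distribˡ-+ a' b' 2)))

%2-idem : ∀ a → a % 2 % 2 ≡ a % 2
%2-idem a with %2-cases a
... | inj₁ p rewrite p = refl
... | inj₂ p rewrite p = refl

even+⇒≡ : ∀ a b → (a + b) % 2 ≡ 0 → a % 2 ≡ b % 2
even+⇒≡ a b p =
  trans (sym (%2-+double a b)) (trans (cong (_% 2) (sym (+-assoc a b b))) (%2-cong-+ (a + b) b 0 b p refl))

≡⇒even+ : ∀ a b → a % 2 ≡ b % 2 → (a + b) % 2 ≡ 0
≡⇒even+ a b p = trans (%2-cong-+ a b b b p refl) (double-%2 b)

suc-%2-0 : ∀ a → a % 2 ≡ 0 → suc a % 2 ≡ 1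
suc-%2-0 a p = %2-cong-+ 1 a 1 0 refl p

suc-%2-1 : ∀ a → a % 2 ≡ 1 → suc a % 2 ≡ 0
suc-%2-1 a p = %2-cong-+ 1 a 1 1 refl p

suc-%2-≢ : ∀ a → suc a % 2 ≢ a % 2
suc-%2-≢ a p with %2-cases a
... | inj₁ q = 1+n≢0 (trans (sym (suc-%2-0 a q)) (trans p q))
... | inj₂ q = 1+n≢0 (sym (trans (sym (suc-%2-1 a q)) (trans p q)))

≤1+∧≡%2⇒≤ : ∀ {a b} → a ≤ suc b → a % 2 ≡ b % 2 → a ≤ b
≤1+∧≡%2⇒≤ {a} {b} a≤ p with m≤n⇒m<n∨m≡n a≤
... | inj₁ a< = ≤-pred a<
... | inj₂ refl = ⊥-elim (suc-%2-≢ b p)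

-- Indicators and finite sums

⟦_⟧ : Bool → ℕ
⟦ true ⟧  = 1
⟦ false ⟧ = 0

⟦⟧≤1 : ∀ b → ⟦ b ⟧ ≤ 1
⟦⟧≤1 true  = ≤-refl
⟦⟧≤1 false = z≤n

⟦not⟧ : ∀ b → ⟦ b ⟧ + ⟦ not b ⟧ ≡ 1
⟦not⟧ true  = refl
⟦not⟧ false = refl

⟦∧⟧ : ∀ a b → ⟦ a ∧ b ⟧ ≡ ⟦ a ⟧ * ⟦ b ⟧
⟦∧⟧ true  b = sym (+-identityʳ ⟦ b ⟧)
⟦∧⟧ false b = refl

⟦∧⟧+⟦∨⟧ : ∀ a b → ⟦ a ∧ b ⟧ + ⟦ a ∨ b ⟧ ≡ ⟦ a ⟧ + ⟦ b ⟧
⟦∧⟧+⟦∨⟧ true  b = +-comm ⟦ b ⟧ 1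
⟦∧⟧+⟦∨⟧ false b = refl

δ : ∀ {n} → Fin n → Fin n → ℕ
δ u v = ⟦ ⌊ u ≟ v ⌋ ⟧

δ-refl : ∀ {n} (u : Fin n) → δ u u ≡ 1
δ-refl u with u ≟ u
... | yes _ = refl
... | no ¬p = ⊥-elim (¬p refl)

δ-≡ : ∀ {n} {u v : Fin n} → u ≡ v → δ u v ≡ 1
δ-≡ {u = u} refl = δ-refl u

δ-≢ : ∀ {n} {u v : Fin n} → u ≢ v → δ u v ≡ 0
δ-≢ {u = u} {v} ¬p with u ≟ v
... | yes p = ⊥-elim (¬p p)
... | no _  = refl

δ-cases : ∀ {n} (u v : Fin n) → (u ≡ v × δ u v ≡ 1) ⊎ (u ≢ v × δ u v ≡ 0)
δ-cases u v with u ≟ v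
... | yes p = inj₁ (p , refl)
... | no ¬p = inj₂ (¬p , refl)

δ-sym : ∀ {n} (u v : Fin n) → δ u v ≡ δ v u
δ-sym u v with δ-cases u v
... | inj₁ (refl , _) = refl
... | inj₂ (u≢v , p)  = trans p (sym (δ-≢ (u≢v ∘ sym)))

δ≤1 : ∀ {n} (u v : Fin n) → δ u v ≤ 1
δ≤1 u v = ⟦⟧≤1 ⌊ u ≟ v ⌋

↑ˡ≢↑ʳ : ∀ {N M} (j : Fin N) (k : Fin M) → j ↑ˡ M ≢ N ↑ʳ k
↑ˡ≢↑ʳ {N} {M} j k eq with trans (sym (splitAt-↑ˡ N j M)) (trans (cong (splitAt N) eq) (splitAt-↑ʳ N M k))
... | ()

opaque
  -- Opaque, so that the summand can be inferred from the sum.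
  ∑ : ∀ {n} → (Fin n → ℕ) → ℕ
  ∑ = sum

  ∑-suc : ∀ {n} (f : Fin (suc n) → ℕ) → ∑ f ≡ f zero + ∑ (f ∘ suc)
  ∑-suc f = refl

  ∑-cong : ∀ {n} {f g : Fin n → ℕ} → (∀ i → f i ≡ g i) → ∑ f ≡ ∑ g
  ∑-cong = sum-cong-≗

  ∑-+ : ∀ {n} (f g : Fin n → ℕ) → ∑ (λ i → f i + g i) ≡ ∑ f + ∑ g
  ∑-+ = ∑-distrib-+

  ∑-swap : ∀ {m n} (f : Fin m → Fin n → ℕ) → ∑ (λ i → ∑ (f i)) ≡ ∑ (λ j → ∑ (λ i → f i j))
  ∑-swap = ∑-comm

  ∑-*ˡ : ∀ {n} c (f : Fin n → ℕ) → ∑ (λ i → c * f i) ≡ c * ∑ f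
  ∑-*ˡ c f = sym (*-distribˡ-sum c f)

  ∑-mono : ∀ {n} {f g : Fin n → ℕ} → (∀ i → f i ≤ g i) → ∑ f ≤ ∑ g
  ∑-mono {zero}  h = z≤n
  ∑-mono {suc n} h = +-mono-≤ (h zero) (∑-mono (h ∘ suc))

  ∑-0 : ∀ {n} {f : Fin n → ℕ} → (∀ i → f i ≡ 0) → ∑ f ≡ 0
  ∑-0 {zero}  h = refl
  ∑-0 {suc n} h = cong₂ _+_ (h zero) (∑-0 (h ∘ suc))

  ∑-const : ∀ n c → ∑ {n} (λ _ → c) ≡ n * c
  ∑-const zero    c = refl
  ∑-const (suc n) c = cong (c +_) (∑-const n c)

  ∑-term : ∀ {n} (f : Fin n → ℕ) i → f i ≤ ∑ f
  ∑-term f zero    = m≤m+n (f zero) _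
  ∑-term f (suc i) = ≤-trans (∑-term (f ∘ suc) i) (m≤n+m _ (f zero))

  ∑-pos : ∀ {n} (f : Fin n → ℕ) → 1 ≤ ∑ f → ∃ λ i → 1 ≤ f i
  ∑-pos {suc n} f p with f zero in eq
  ... | suc a = zero , subst (1 ≤_) (sym eq) (s≤s z≤n)
  ... | zero  with i , q ← ∑-pos (f ∘ suc) p = suc i , q

  ∑-↑ : ∀ N M (g : Fin (N + M) → ℕ) → ∑ g ≡ ∑ (λ i → g (i ↑ˡ M)) + ∑ (λ i → g (N ↑ʳ i))
  ∑-↑ zero    M g = refl
  ∑-↑ (suc N) M g = trans (cong (g zero +_) (∑-↑ N M (g ∘ suc))) (sym (+-assoc (g zero) _ _))

  ∑-%2 : ∀ {n} (f : Fin n → ℕ) → ∑ (λ j → f j % 2) % 2 ≡ ∑ f % 2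
  ∑-%2 {zero}  f = refl
  ∑-%2 {suc n} f =
    %2-cong-+ (f zero % 2) (∑ (λ j → f (suc j) % 2)) (f zero) (∑ (f ∘ suc)) (%2-idem (f zero)) (∑-%2 (f ∘ suc))

  ∣∣≡∑ : ∀ {n} (X : Subset n) → ∣ X ∣ ≡ ∑ (λ v → ⟦ lookup X v ⟧)
  ∣∣≡∑ []          = refl
  ∣∣≡∑ (true ∷ X)  = cong suc (∣∣≡∑ X)
  ∣∣≡∑ (false ∷ X) = ∣∣≡∑ X

δ-suc : ∀ {n} (u v : Fin n) → δ (suc u) (suc v) ≡ δ u v
δ-suc u v with δ-cases u v
... | inj₁ (p , q)  = trans (δ-≡ (cong suc p)) (sym q)
... | inj₂ (¬p , q) = trans (δ-≢ (¬p ∘ suc-injective)) (sym q)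

∑-δ : ∀ {n} (j : Fin n) (g : Fin n → ℕ) → ∑ (λ i → δ j i * g i) ≡ g j
∑-δ {suc n} zero g = trans (∑-suc _) (trans (cong₂ _+_ (+-identityʳ (g zero)) (∑-0 (λ i → refl))) (+-identityʳ (g zero)))
∑-δ {suc n} (suc j) g =
  trans (∑-suc _) (trans (∑-cong (λ i → cong (_* g (suc i)) (δ-suc j i))) (∑-δ j (g ∘ suc)))

∑-δ1 : ∀ {n} (j : Fin n) → ∑ (δ j) ≡ 1
∑-δ1 j = trans (∑-cong (λ i → sym (*-identityʳ (δ j i)))) (∑-δ j (λ _ → 1))

-- Truncated subtraction is hidden behind an additive equation, so that sums of the lowered function
-- follow from additivity of `∑`.
minus-δ : ∀ {n} (f : Fin n → ℕ) v → 1 ≤ f v → ∃ λ g → ∀ u → f u ≡ δ v u + g u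
minus-δ f v p = (λ u → f u ∸ δ v u) , λ u → sym (m+[n∸m]≡n (below u))
  where
  below : ∀ u → δ v u ≤ f u
  below u with δ-cases v u
  ... | inj₁ (refl , q) = ≤-trans (≤-reflexive q) p
  ... | inj₂ (_ , q)    = ≤-trans (≤-reflexive q) z≤n

-- Subsets and modular set functions

∈⇒lookup : ∀ {n} {X : Subset n} {v} → v ∈ X → lookup X v ≡ true
∈⇒lookup = []=⇒lookup

lookup⇒∈ : ∀ {n} {X : Subset n} {v} → lookup X v ≡ true → v ∈ X
lookup⇒∈ {X = X} {v} = lookup⇒[]= v X

∉⇒lookup : ∀ {n} {X : Subset n} {v} → v ∉ X → lookup X v ≡ false
∉⇒lookup {X = X} {v} v∉X with lookup X v in eq
... | true  = ⊥-elim (v∉X (lookup⇒∈ eq))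
... | false = refl

lookup-∩ : ∀ {n} (X Y : Subset n) v → lookup (X ∩ Y) v ≡ lookup X v ∧ lookup Y v
lookup-∩ X Y v = lookup-zipWith _∧_ v X Y

lookup-∪ : ∀ {n} (X Y : Subset n) v → lookup (X ∪ Y) v ≡ lookup X v ∨ lookup Y v
lookup-∪ X Y v = lookup-zipWith _∨_ v X Y

infix 20 _⟨_⟩

_⟨_⟩ : ∀ {n} → (Fin n → ℕ) → Subset n → ℕ
f ⟨ X ⟩ = ∑ (λ v → ⟦ lookup X v ⟧ * f v)

⟨⟩-+ : ∀ {n} (f g : Fin n → ℕ) X → (λ v → f v + g v) ⟨ X ⟩ ≡ f ⟨ X ⟩ + g ⟨ X ⟩
⟨⟩-+ f g X = trans (∑-cong (λ v → *-distribˡ-+ ⟦ lookup X v ⟧ (f v) (g v))) (∑-+ _ _)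

⟨⟩-cong : ∀ {n} {f g : Fin n → ℕ} X → (∀ v → f v ≡ g v) → f ⟨ X ⟩ ≡ g ⟨ X ⟩
⟨⟩-cong X h = ∑-cong (λ v → cong (⟦ lookup X v ⟧ *_) (h v))

⟨⟩-δ : ∀ {n} (v : Fin n) X → δ v ⟨ X ⟩ ≡ ⟦ lookup X v ⟧
⟨⟩-δ v X = trans (∑-cong (λ u → *-comm ⟦ lookup X u ⟧ (δ v u))) (∑-δ v (λ u → ⟦ lookup X u ⟧))

⟨⟩-∩∪ : ∀ {n} (f : Fin n → ℕ) X Y → f ⟨ X ∩ Y ⟩ + f ⟨ X ∪ Y ⟩ ≡ f ⟨ X ⟩ + f ⟨ Y ⟩
⟨⟩-∩∪ f X Y = trans (sym (∑-+ _ _)) (trans (∑-cong pointwise) (∑-+ _ _))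
  where
  pointwise : ∀ v → ⟦ lookup (X ∩ Y) v ⟧ * f v + ⟦ lookup (X ∪ Y) v ⟧ * f v ≡ ⟦ lookup X v ⟧ * f v + ⟦ lookup Y v ⟧ * f v
  pointwise v rewrite lookup-∩ X Y v | lookup-∪ X Y v =
    trans (sym (*-distribʳ-+ (f v) ⟦ lookup X v ∧ lookup Y v ⟧ _))
      (trans (cong (_* f v) (⟦∧⟧+⟦∨⟧ (lookup X v) (lookup Y v))) (*-distribʳ-+ (f v) ⟦ lookup X v ⟧ _))

⟨⊤⟩ : ∀ {n} (f : Fin n → ℕ) → f ⟨ ⊤ ⟩ ≡ ∑ f
⟨⊤⟩ f = ∑-cong (λ v → trans (cong (λ b → ⟦ b ⟧ * f v) (∈⇒lookup (∈⊤ {x = v}))) (*-identityˡ (f v)))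

⟨⊥⟩ : ∀ {n} (f : Fin n → ℕ) → f ⟨ ⊥ ⟩ ≡ 0
⟨⊥⟩ f = ∑-0 (λ v → cong (λ b → ⟦ b ⟧ * f v) (∉⇒lookup (∉⊥ {x = v})))

subset : ∀ {n} {P : Fin n → Set} → (∀ v → Dec (P v)) → Subset n
subset P? = tabulate (λ v → ⌊ P? v ⌋)

subset-intro : ∀ {n} {P : Fin n → Set} (P? : ∀ v → Dec (P v)) {v} → P v → v ∈ subset P?
subset-intro P? {v} p = lookup⇒∈ (trans (lookup∘tabulate (λ v → ⌊ P? v ⌋) v) holds)
  where
  holds : ⌊ P? v ⌋ ≡ true
  holds with P? v
  ... | yes _ = refl
  ... | no ¬p = ⊥-elim (¬p p)

subset-elim : ∀ {n} {P : Fin n → Set} (P? : ∀ v → Dec (P v)) {v} → v ∈ subset P? → P v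
subset-elim P? {v} v∈ with P? v | trans (sym (lookup∘tabulate (λ v → ⌊ P? v ⌋) v)) (∈⇒lookup v∈)
... | yes p | _ = p

opaque
  -- Each step may replace `Z` by any larger set with `P`, not just by a union. One loop thus serves
  -- both for merging tight sets in Hall's theorem and for rearranging disjoint packings of
  -- saturated sets in the orientation.
  cover : ∀ {n} (P : Subset n → Set) (A : Subset n) → P ⊥ →
          (∀ Z v → P Z → v ∈ A → ∃ λ Z' → P Z' × Z ⊆ Z' × v ∈ Z') →
          ∃ λ Z → P Z × A ⊆ Z
  cover {n} P A p⊥ step = let Z , pZ , h = go n id in Z , pZ , λ {v} → h v
    where
    go : ∀ k (ι : Fin k → Fin n) → ∃ λ Z → P Z × (∀ i → ι i ∈ A → ι i ∈ Z)
    go zero    ι = ⊥ , p⊥ , λ ()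
    go (suc k) ι with Z , pZ , h ← go k (ι ∘ suc) | ι zero ∈? A
    ... | no  v∉A = Z , pZ , λ { zero v∈A → ⊥-elim (v∉A v∈A) ; (suc i) → h i }
    ... | yes v∈A with Z' , pZ' , Z⊆Z' , v∈Z' ← step Z (ι zero) pZ v∈A =
      Z' , pZ' , λ { zero _ → v∈Z' ; (suc i) q → Z⊆Z' (h i q) }

-- Hall's theorem with capacities

within : ∀ {n} → Subset n → Subset n → ℕ
within A X = ⟦ ⌊ A ⊆? X ⌋ ⟧

within-⊆ : ∀ {n} {A X : Subset n} → A ⊆ X → within A X ≡ 1
within-⊆ {A = A} {X} A⊆X with A ⊆? X
... | yes _ = refl
... | no ¬p = ⊥-elim (¬p A⊆X)

within-cases : ∀ {n} (A X : Subset n) → (A ⊆ X × within A X ≡ 1) ⊎ (within A X ≡ 0)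
within-cases A X with A ⊆? X
... | yes p = inj₁ (p , refl)
... | no _  = inj₂ refl

within-supermodular : ∀ {n} (A X Y : Subset n) → within A X + within A Y ≤ within A (X ∩ Y) + within A (X ∪ Y)
within-supermodular A X Y with within-cases A X | within-cases A Y
... | inj₁ (p , a) | inj₁ (q , b)
  rewrite a | b | within-⊆ {A = A} {X ∩ Y} (λ z → x∈p∩q⁺ (p z , q z)) | within-⊆ {A = A} {X ∪ Y} (λ z → x∈p∪q⁺ (inj₁ (p z))) = ≤-refl
... | inj₁ (p , a) | inj₂ b
  rewrite a | b | within-⊆ {A = A} {X ∪ Y} (λ z → x∈p∪q⁺ (inj₁ (p z))) = m≤n+m 1 _
... | inj₂ a | inj₁ (q , b)
  rewrite a | b | within-⊆ {A = A} {X ∪ Y} (λ z → x∈p∪q⁺ (inj₂ (q z))) = m≤n+m 1 _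
... | inj₂ a | inj₂ b rewrite a | b = z≤n

module _ {n q : ℕ} (A : Fin q → Subset n) (sel : Fin q → Bool) where

  confined : Subset n → ℕ
  confined X = ∑ (λ i → ⟦ sel i ⟧ * within (A i) X)

  confined-supermodular : ∀ X Y → confined X + confined Y ≤ confined (X ∩ Y) + confined (X ∪ Y)
  confined-supermodular X Y = begin
    confined X + confined Y
      ≡⟨ ∑-+ _ _ ⟨
    ∑ (λ i → ⟦ sel i ⟧ * within (A i) X + ⟦ sel i ⟧ * within (A i) Y)
      ≤⟨ ∑-mono pointwise ⟩
    ∑ (λ i → ⟦ sel i ⟧ * within (A i) (X ∩ Y) + ⟦ sel i ⟧ * within (A i) (X ∪ Y))
      ≡⟨ ∑-+ _ _ ⟩
    confined (X ∩ Y) + confined (X ∪ Y) ∎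
    where
    open ≤-Reasoning
    pointwise : ∀ i → _
    pointwise i = subst₂ _≤_ (*-distribˡ-+ ⟦ sel i ⟧ _ _) (*-distribˡ-+ ⟦ sel i ⟧ _ _)
      (*-monoʳ-≤ ⟦ sel i ⟧ (within-supermodular (A i) X Y))

  -- The converse of Hall's inequality; where Hall's condition holds, the two give equality.
  Tight : (Fin n → ℕ) → Subset n → Set
  Tight m X = m ⟨ X ⟩ ≤ confined X

  -- Uncrossing: `m` is modular and `confined` supermodular, so Hall's inequality at the
  -- intersection leaves no slack for the union.
  Tight-∪ : ∀ {m} → (∀ X → confined X ≤ m ⟨ X ⟩) → ∀ X Y → Tight m X → Tight m Y → Tight m (X ∪ Y)
  Tight-∪ {m} cond X Y tX tY = +-cancelˡ-≤ (confined (X ∩ Y)) _ _ (begin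
    confined (X ∩ Y) + m ⟨ X ∪ Y ⟩  ≤⟨ +-monoˡ-≤ _ (cond (X ∩ Y)) ⟩
    m ⟨ X ∩ Y ⟩ + m ⟨ X ∪ Y ⟩       ≡⟨ ⟨⟩-∩∪ m X Y ⟩
    m ⟨ X ⟩ + m ⟨ Y ⟩               ≤⟨ +-mono-≤ tX tY ⟩
    confined X + confined Y         ≤⟨ confined-supermodular X Y ⟩
    confined (X ∩ Y) + confined (X ∪ Y) ∎)
    where open ≤-Reasoning

  -- Otherwise the union of tight sets covering A₀ would be overfull.
  untight-vertex : ∀ A₀ {m} → (∀ X → within A₀ X + confined X ≤ m ⟨ X ⟩) →
                   ∃ λ v → v ∈ A₀ × (∀ X → v ∈ X → confined X < m ⟨ X ⟩)
  untight-vertex A₀ {m} cond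
    with any? (λ v → (v ∈? A₀) ×-dec ¬? (anySubset? (λ X → (v ∈? X) ×-dec (m ⟨ X ⟩ ≤? confined X))))
  ... | yes (v , v∈A₀ , untight) = v , v∈A₀ , λ X v∈X → ≰⇒> (λ t → untight (X , v∈X , t))
  ... | no none = ⊥-elim (<-irrefl refl (begin-strict
    confined Z                <⟨ n<1+n _ ⟩
    1 + confined Z            ≡⟨ cong (_+ confined Z) (within-⊆ A₀⊆Z) ⟨
    within A₀ Z + confined Z  ≤⟨ cond Z ⟩
    m ⟨ Z ⟩                   ≤⟨ tZ ⟩
    confined Z                ∎))
    where
    open ≤-Reasoning
    covered : ∀ v → v ∈ A₀ → ∃ λ X → v ∈ X × Tight m X
    covered v v∈A₀ = decidable-stable (anySubset? (λ X → (v ∈? X) ×-dec (m ⟨ X ⟩ ≤? confined X)))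
      (λ ¬p → none (v , v∈A₀ , ¬p))
    union = cover (Tight m) A₀ (≤-trans (≤-reflexive (⟨⊥⟩ m)) z≤n)
      (λ Z v tZ v∈A₀ → let X , v∈X , tX = covered v v∈A₀ in
        Z ∪ X , Tight-∪ (λ Y → ≤-trans (m≤n+m _ _) (cond Y)) Z X tZ tX , (λ z → x∈p∪q⁺ (inj₁ z)) , x∈p∪q⁺ (inj₂ v∈X))
    Z = proj₁ union
    tZ = proj₁ (proj₂ union)
    A₀⊆Z : A₀ ⊆ Z
    A₀⊆Z = proj₂ (proj₂ union)

-- The representative is recorded as a vector `y`, zero or a unit vector, so that the load of a
-- vertex is a plain sum over the sets.
data Served {n} (A : Subset n) : Bool → (Fin n → ℕ) → Set where
  skip  : ∀ {y} → (∀ v → y v ≡ 0) → Served A false y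
  serve : ∀ {y} v → v ∈ A → (∀ u → y u ≡ δ v u) → Served A true y

cons : ∀ {n q} → (Fin n → ℕ) → (Fin q → Fin n → ℕ) → Fin (suc q) → Fin n → ℕ
cons y₀ y zero    = y₀
cons y₀ y (suc i) = y i

-- Induction on the number of sets. Serving the first selected set at `v` uses one unit of the
-- capacity of `v`; the remaining sets keep Hall's condition because `v` is chosen outside all their
-- tight sets. Equality of the totals makes every capacity used up exactly.
hall : ∀ {n} q (A : Fin q → Subset n) (sel : Fin q → Bool) (m : Fin n → ℕ) →
       (∀ X → confined A sel X ≤ m ⟨ X ⟩) → ∑ (λ i → ⟦ sel i ⟧) ≡ ∑ m →
       ∃ λ (y : Fin q → Fin n → ℕ) → (∀ i → Served (A i) (sel i) (y i)) × (∀ v → ∑ (λ i → y i v) ≡ m v)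
hall zero A sel m cond total = (λ ()) , (λ ()) , λ v → trans (∑-0 (λ ())) (sym (n≤0⇒n≡0 (begin
  m v  ≤⟨ ∑-term m v ⟩
  ∑ m  ≡⟨ total ⟨
  _    ≡⟨ ∑-0 (λ ()) ⟩
  0    ∎)))
  where open ≤-Reasoning
hall {n} (suc q) A sel m cond total with sel zero in eq
... | false = cons (λ _ → 0) y , (λ { zero → subst (λ b → Served _ b _) (sym eq) (skip (λ _ → refl)) ; (suc i) → served i })
    , λ v → trans (∑-suc _) (sums v)
  where
  first : ∀ X → confined A sel X ≡ confined (A ∘ suc) (sel ∘ suc) X
  first X = trans (∑-suc _) (cong (λ b → ⟦ b ⟧ * within (A zero) X + confined (A ∘ suc) (sel ∘ suc) X) eq)
  rec = hall q (A ∘ suc) (sel ∘ suc) m (λ X → subst (_≤ m ⟨ X ⟩) (first X) (cond X))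
          (trans (sym (trans (∑-suc _) (cong (λ b → ⟦ b ⟧ + ∑ (λ i → ⟦ sel (suc i) ⟧)) eq))) total)
  y = proj₁ rec
  served = proj₁ (proj₂ rec)
  sums = proj₂ (proj₂ rec)
... | true = cons (δ v) y
    , (λ { zero → subst (λ b → Served (A zero) b (δ v)) (sym eq) (serve v v∈A (λ _ → refl)) ; (suc i) → served i })
    , λ u → trans (∑-suc _) (trans (cong (δ v u +_) (sums u)) (sym (m-δ u)))
  where
  open ≤-Reasoning
  A' = A ∘ suc
  sel' = sel ∘ suc
  first : ∀ X → confined A sel X ≡ within (A zero) X + confined A' sel' X
  first X = trans (∑-suc _) (cong (_+ confined A' sel' X)
    (trans (cong (λ b → ⟦ b ⟧ * within (A zero) X) eq) (*-identityˡ _)))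
  cond' : ∀ X → confined A' sel' X ≤ m ⟨ X ⟩
  cond' X = ≤-trans (m≤n+m _ _) (≤-trans (≤-reflexive (sym (first X))) (cond X))
  served-at = untight-vertex A' sel' (A zero) (λ X → ≤-trans (≤-reflexive (sym (first X))) (cond X))
  v = proj₁ served-at
  v∈A = proj₁ (proj₂ served-at)
  slack : ∀ X → v ∈ X → confined A' sel' X < m ⟨ X ⟩
  slack = proj₂ (proj₂ served-at)
  -- The singleton of `v` contains `v`, so it is not tight and leaves capacity at `v`.
  mv>0 : 1 ≤ m v
  mv>0 = begin
    1                     ≤⟨ s≤s z≤n ⟩
    suc (confined A' sel' ⁅ v ⁆) ≤⟨ slack ⁅ v ⁆ (x∈⁅x⁆ v) ⟩
    m ⟨ ⁅ v ⁆ ⟩           ≡⟨ ∑-cong (λ u → cong (_* m u) (indicator u)) ⟩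
    ∑ (λ u → δ v u * m u) ≡⟨ ∑-δ v m ⟩
    m v                   ∎
    where
    indicator : ∀ u → ⟦ lookup ⁅ v ⁆ u ⟧ ≡ δ v u
    indicator u with δ-cases v u
    ... | inj₁ (refl , p) = trans (cong ⟦_⟧ (∈⇒lookup (x∈⁅x⁆ v))) (sym p)
    ... | inj₂ (v≢u , p)  = trans (cong ⟦_⟧ (∉⇒lookup (λ u∈ → v≢u (sym (x∈⁅y⁆⇒x≡y v u∈))))) (sym p)
  m' = proj₁ (minus-δ m v mv>0)
  m-δ : ∀ u → m u ≡ δ v u + m' u
  m-δ = proj₂ (minus-δ m v mv>0)
  m'⟨⟩ : ∀ X → m ⟨ X ⟩ ≡ ⟦ lookup X v ⟧ + m' ⟨ X ⟩
  m'⟨⟩ X = trans (⟨⟩-cong X m-δ) (trans (⟨⟩-+ (δ v) m' X) (cong (_+ m' ⟨ X ⟩) (⟨⟩-δ v X)))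
  cond'' : ∀ X → confined A' sel' X ≤ m' ⟨ X ⟩
  cond'' X with v ∈? X
  ... | yes v∈X = ≤-pred (≤-trans (slack X v∈X) (≤-reflexive (trans (m'⟨⟩ X) (cong (λ b → ⟦ b ⟧ + m' ⟨ X ⟩) (∈⇒lookup v∈X)))))
  ... | no v∉X  = ≤-trans (cond' X) (≤-reflexive (trans (m'⟨⟩ X) (cong (λ b → ⟦ b ⟧ + m' ⟨ X ⟩) (∉⇒lookup v∉X))))
  rec = hall q A' sel' m' cond'' (+-cancelˡ-≡ 1 _ _ (begin-equality
    1 + ∑ (λ i → ⟦ sel' i ⟧)  ≡⟨ cong (λ b → ⟦ b ⟧ + ∑ (λ i → ⟦ sel' i ⟧)) eq ⟨
    ⟦ sel zero ⟧ + ∑ (λ i → ⟦ sel' i ⟧) ≡⟨ ∑-suc _ ⟨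
    ∑ (λ i → ⟦ sel i ⟧)       ≡⟨ total ⟩
    ∑ m                       ≡⟨ ∑-cong m-δ ⟩
    ∑ (λ u → δ v u + m' u)    ≡⟨ ∑-+ _ _ ⟩
    ∑ (δ v) + ∑ m'            ≡⟨ cong (_+ ∑ m') (∑-δ1 v) ⟩
    1 + ∑ m'                  ∎))
  y = proj₁ rec
  served = proj₁ (proj₂ rec)
  sums = proj₂ (proj₂ rec)

-- Parity factors

¬¬-∀Fin : ∀ {n} {P : Fin n → Set} → (∀ i → ¬ ¬ P i) → ¬ ¬ (∀ i → P i)
¬¬-∀Fin {zero}  h k = k λ ()
¬¬-∀Fin {suc n} h k = h zero λ p → ¬¬-∀Fin (h ∘ suc) λ ps → k λ { zero → p ; (suc i) → ps i }

-- Stated for an arbitrary type with no decidability, since it is applied to colourings with any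
-- number of colours; hence the double negation.
¬¬-minimum : ∀ {A : Set} (P : A → Set) (μ : A → ℕ) a → P a → ¬ ¬ (∃ λ a → P a × (∀ b → P b → μ a ≤ μ b))
¬¬-minimum P μ a pa = below (suc (μ a)) a pa ≤-refl
  where
  below : ∀ B a → P a → μ a < B → ¬ ¬ (∃ λ a → P a × (∀ b → P b → μ a ≤ μ b))
  below (suc B) a pa μa<B none = none (a , pa , λ b pb → ≮⇒≥ λ μb<μa →
    below B b pb (<-≤-trans μb<μa (≤-pred μa<B)) none)

-- A colouring c : Fin n → Fin (suc N) encodes a barrier, the vertices of colour 0,
-- together with a grouping of the remaining vertices that no edge may leave.
module Factor {n : ℕ} (R : Fin n → Fin n → Set) where

  -- The demands f for which some set F of R-edges satisfies deg F ≤ f and deg F ≡ f mod 2.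
  data Good : (Fin n → ℕ) → Set where
    none : Good (λ _ → 0)
    edge : ∀ {u w} → R u w → Good (λ x → δ u x + δ w x)
    plus : ∀ {f g} → Good f → Good g → Good (λ x → f x + g x)
    lift : ∀ {f g} → Good f → (∀ x → ∃ λ c → g x ≡ f x + (c + c)) → Good g

  Good-cong : ∀ {f g} → Good f → (∀ x → g x ≡ f x) → Good g
  Good-cong good h = lift good λ x → 0 , trans (h x) (sym (+-identityʳ _))

  Good-∑ : ∀ {q} (g : Fin q → Fin n → ℕ) → (∀ j → Good (g j)) → Good (λ x → ∑ (λ j → g j x))
  Good-∑ {zero}  g h = Good-cong none (λ x → ∑-0 (λ ()))
  Good-∑ {suc q} g h = Good-cong (plus (h zero) (Good-∑ (g ∘ suc) (h ∘ suc))) (λ x → ∑-suc _)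

  cls : (Fin n → ℕ) → ∀ {N} → (Fin n → Fin N) → Fin N → ℕ
  cls f c j = ∑ (λ u → δ (c u) j * f u)

  -- `φ` is `_% 2` to count odd classes and `weigh` to measure the demand they carry. Colour 0 is
  -- left out, being the barrier.
  score : (ℕ → ℕ) → (Fin n → ℕ) → ∀ {N} → (Fin n → Fin (suc N)) → ℕ
  score φ f c = ∑ (λ j → φ (cls f c (suc j)))

  odd : (Fin n → ℕ) → ∀ {N} → (Fin n → Fin (suc N)) → ℕ
  odd = score (_% 2)

  Valid : ∀ {N} → (Fin n → Fin (suc N)) → Set
  Valid c = ∀ u w → R u w → c u ≡ zero ⊎ c w ≡ zero ⊎ c u ≡ c w

  -- Tutte's condition, tested on all groupings. An odd union of components contains an odd
  -- component, so the finest grouping is the hardest test.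
  Feasible : (Fin n → ℕ) → Set
  Feasible f = ∀ {N} (c : Fin n → Fin (suc N)) → Valid c → odd f c ≤ cls f c zero

  ∑-cls : ∀ f {N} (c : Fin n → Fin N) → ∑ (cls f c) ≡ ∑ f
  ∑-cls f c = trans (∑-swap _) (∑-cong (λ u → ∑-δ (c u) (λ _ → f u)))

  ∑-cls-suc : ∀ f {N} (c : Fin n → Fin (suc N)) → cls f c zero + ∑ (λ j → cls f c (suc j)) ≡ ∑ f
  ∑-cls-suc f c = trans (sym (∑-suc _)) (∑-cls f c)

  cls-+ : ∀ f g h {N} (c : Fin n → Fin N) → (∀ u → f u ≡ g u + h u) → ∀ j → cls f c j ≡ cls g c j + cls h c j
  cls-+ f g h c eq j =
    trans (∑-cong (λ u → trans (cong (δ (c u) j *_) (eq u)) (*-distribˡ-+ (δ (c u) j) (g u) (h u)))) (∑-+ _ _)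

  cls-δ : ∀ v {N} (c : Fin n → Fin N) j → cls (δ v) c j ≡ δ (c v) j
  cls-δ v c j = trans (∑-cong (λ u → *-comm (δ (c u) j) (δ v u))) (∑-δ v (λ u → δ (c u) j))

  -- Source of the parity gap: with an even total, a strict inequality between these two numbers is
  -- off by at least two.
  odd-parity : ∀ f → ∑ f % 2 ≡ 0 → ∀ {N} (c : Fin n → Fin (suc N)) → odd f c % 2 ≡ cls f c zero % 2
  odd-parity f even c = trans (∑-%2 (λ j → cls f c (suc j)))
    (sym (even+⇒≡ (cls f c zero) _ (trans (cong (_% 2) (∑-cls-suc f c)) even)))

  -- The condition is tested on the empty barrier with all vertices in a single class.
  Feasible⇒even : ∀ f → Feasible f → ∑ f % 2 ≡ 0
  Feasible⇒even f feas with %2-cases (∑ f)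
  ... | inj₁ p = p
  ... | inj₂ p = ⊥-elim (1+n≰n (begin
    1               ≡⟨ p ⟨
    ∑ f % 2         ≡⟨ cong (_% 2) (∑-cls-suc f c) ⟨
    (cls f c zero + ∑ (λ j → cls f c (suc j))) % 2 ≡⟨ cong (λ x → (x + ∑ (λ j → cls f c (suc j))) % 2) c0 ⟩
    ∑ (λ j → cls f c (suc j)) % 2 ≡⟨ ∑-%2 (λ j → cls f c (suc j)) ⟨
    odd f c % 2     ≤⟨ m%n≤m (odd f c) 2 ⟩
    odd f c         ≤⟨ feas c (λ _ _ _ → inj₂ (inj₂ refl)) ⟩
    cls f c zero    ≡⟨ c0 ⟩
    0 ∎))
    where
    open ≤-Reasoning
    c : Fin n → Fin 2
    c _ = suc zero
    c0 : cls f c zero ≡ 0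
    c0 = ∑-0 (λ u → refl)

  part : ∀ {N} → (Fin N → Bool) → Fin (suc N) → ℕ
  part P zero    = 0
  part P (suc j) = ⟦ P j ⟧

  restrict : ∀ {N} → (Fin N → Bool) → (Fin n → Fin (suc N)) → (Fin n → ℕ) → Fin n → ℕ
  restrict P c f u = part P (c u) * f u

  -- Recolouring by c' the union of the colour classes of c selected by P.
  module Refine {N N' : ℕ} (P : Fin N → Bool) where

    -- The selected old colours become empty rather than disappear, the new classes take fresh
    -- colours after them, and both barriers share colour 0.
    shift : Fin (suc N') → Fin (suc (N + N'))
    shift zero    = zero
    shift (suc k) = suc (N ↑ʳ k)

    mix : Fin (suc N) → Fin (suc N') → Fin (suc (N + N'))
    mix zero    y = zero
    mix (suc j) y = if P j then shift y else suc (j ↑ˡ N')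

    mix-zero : ∀ x y a → δ (mix x y) zero * a ≡ δ x zero * a + δ y zero * (part P x * a)
    mix-zero zero y a = trans (sym (+-identityʳ _)) (cong (1 * a +_) (sym (*-zeroʳ (δ y zero))))
    mix-zero (suc j) y a with P j
    mix-zero (suc j) zero    a | true  = sym (cong (_+ 0) (*-identityˡ a))
    mix-zero (suc j) (suc k) a | true  = refl
    mix-zero (suc j) y       a | false = sym (*-zeroʳ (δ y zero))

    mix-old : ∀ x y a j → δ (mix x y) (suc (j ↑ˡ N')) * a ≡ ⟦ not (P j) ⟧ * (δ x (suc j) * a)
    mix-old zero y a j = sym (*-zeroʳ ⟦ not (P j) ⟧)
    mix-old (suc i) y a j with δ-cases i j
    ... | inj₂ (i≢j , q) = trans (cong (_* a) (other y)) (sym (trans (cong (λ d → ⟦ not (P j) ⟧ * (d * a)) (trans (δ-suc i j) q)) (*-zeroʳ ⟦ not (P j) ⟧)))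
      where
      other : ∀ y → δ (if P i then shift y else suc (i ↑ˡ N')) (suc (j ↑ˡ N')) ≡ 0
      other y with P i
      other zero    | true = refl
      other (suc k) | true = δ-≢ (λ p → ↑ˡ≢↑ʳ j k (sym (suc-injective p)))
      other y       | false = δ-≢ (λ p → i≢j (↑ˡ-injective N' i j (suc-injective p)))
    ... | inj₁ (refl , q) with P i
    mix-old (suc i) zero    a j | inj₁ (refl , q) | true  = refl
    mix-old (suc i) (suc k) a j | inj₁ (refl , q) | true  = cong (_* a) (δ-≢ (λ p → ↑ˡ≢↑ʳ j k (sym (suc-injective p))))
    mix-old (suc i) y       a j | inj₁ (refl , q) | false =
      trans (cong (_* a) (trans (δ-refl (suc (i ↑ˡ N'))) (sym (δ-refl (suc i))))) (sym (+-identityʳ _))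

    mix-new : ∀ x y a k → δ (mix x y) (suc (N ↑ʳ k)) * a ≡ δ y (suc k) * (part P x * a)
    mix-new zero y a k = sym (*-zeroʳ (δ y (suc k)))
    mix-new (suc j) y a k with P j
    mix-new (suc j) y a k       | false = trans (cong (_* a) (δ-≢ (λ p → ↑ˡ≢↑ʳ j k (suc-injective p)))) (sym (*-zeroʳ (δ y (suc k))))
    mix-new (suc j) zero a k    | true = refl
    mix-new (suc j) (suc i) a k | true = cong₂ _*_ shifted (sym (*-identityˡ a))
      where
      shifted : δ (suc (N ↑ʳ i)) (suc (N ↑ʳ k)) ≡ δ (suc i) (suc k)
      shifted with δ-cases i k
      ... | inj₁ (refl , q) = trans (δ-refl (suc (N ↑ʳ i))) (sym (δ-refl (suc i)))
      ... | inj₂ (i≢k , q)  = trans (δ-≢ (λ p → i≢k (↑ʳ-injective N i k (suc-injective p)))) (sym (δ-≢ (i≢k ∘ suc-injective)))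

    module _ (f : Fin n → ℕ) (c : Fin n → Fin (suc N)) (c' : Fin n → Fin (suc N')) where

      refined : Fin n → Fin (suc (N + N'))
      refined u = mix (c u) (c' u)

      refined-Valid : Valid c → Valid c' → Valid refined
      refined-Valid val val' u w r with c u | c w | val u w r
      ... | zero  | _     | _ = inj₁ refl
      ... | suc i | zero  | _ = inj₂ (inj₁ refl)
      ... | suc i | suc i | inj₂ (inj₂ refl) with P i
      ...   | false = inj₂ (inj₂ refl)
      ...   | true with c' u | c' w | val' u w r
      ...     | zero  | _     | _ = inj₁ refl
      ...     | suc k | zero  | _ = inj₂ (inj₁ refl)
      ...     | suc k | suc k | inj₂ (inj₂ refl) = inj₂ (inj₂ refl)

      cls-refined-zero : cls f refined zero ≡ cls f c zero + cls (restrict P c f) c' zero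
      cls-refined-zero = trans (∑-cong (λ u → mix-zero (c u) (c' u) (f u))) (∑-+ _ _)

      score-refined : ∀ φ → score φ f refined ≡ ∑ (λ j → φ (⟦ not (P j) ⟧ * cls f c (suc j))) + score φ (restrict P c f) c'
      score-refined φ = trans (∑-↑ N N' _) (cong₂ _+_
        (∑-cong (λ j → cong φ (trans (∑-cong (λ u → mix-old (c u) (c' u) (f u) j)) (∑-*ˡ ⟦ not (P j) ⟧ _))))
        (∑-cong (λ k → cong φ (∑-cong (λ u → mix-new (c u) (c' u) (f u) k)))))

-- With this `φ`, `score` is the total demand lying in odd classes. A tight barrier that minimises
-- it has no tight refinement in which demand has left the odd classes.
weigh : ℕ → ℕ
weigh x = x % 2 * x

weigh-even : ∀ x → x % 2 ≡ 0 → weigh x ≡ 0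
weigh-even x p = cong (_* x) p

weigh-odd : ∀ x → x % 2 ≡ 1 → weigh x ≡ x
weigh-odd x p = trans (cong (_* x) p) (*-identityˡ x)

weigh≤ : ∀ x → weigh x ≤ x
weigh≤ x with %2-cases x
... | inj₁ p = ≤-trans (≤-reflexive (weigh-even x p)) z≤n
... | inj₂ p = ≤-reflexive (weigh-odd x p)

isOdd : ℕ → Bool
isOdd x = ⌊ x % 2 ≟ℕ 1 ⌋

⟦isOdd⟧ : ∀ x → ⟦ isOdd x ⟧ ≡ x % 2
⟦isOdd⟧ x with %2-cases x
... | inj₁ p rewrite p = refl
... | inj₂ p rewrite p = refl

isOdd⇒ : ∀ x → isOdd x ≡ true → x % 2 ≡ 1
isOdd⇒ x p = trans (sym (⟦isOdd⟧ x)) (cong ⟦_⟧ p)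

isPos : ℕ → Bool
isPos zero    = false
isPos (suc _) = true

true⇒isPos : ∀ {x} → isPos x ≡ true → 1 ≤ x
true⇒isPos {suc x} _ = s≤s z≤n

-- For a tight barrier of least weight, the demand on an odd class stays feasible when lowered by one at any vertex v.
module OddClass {n : ℕ} (R : Fin n → Fin n → Set) (f : Fin n → ℕ) (feas : Factor.Feasible R f)
  {N : ℕ} (c : Fin n → Fin (suc N)) (val : Factor.Valid R c) (tight : Factor.odd R f c ≡ Factor.cls R f c zero)
  (least : ∀ {N'} (c' : Fin n → Fin (suc N')) → Factor.Valid R c' → Factor.odd R f c' ≡ Factor.cls R f c' zero →
           1 ≤ Factor.cls R f c' zero → Factor.score R weigh f c ≤ Factor.score R weigh f c')
  (pos : 1 ≤ Factor.cls R f c zero)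
  (j₀ : Fin N) (odd₀ : Factor.cls R f c (suc j₀) % 2 ≡ 1) where
  open Factor R

  P : Fin N → Bool
  P j = ⌊ j₀ ≟ j ⌋

  module _ {N' : ℕ} where
    open Refine {N} {N'} P public

  g : Fin n → ℕ
  g u = δ (c u) (suc j₀) * f u

  restrict≡g : ∀ u → restrict P c f u ≡ g u
  restrict≡g u with c u
  ... | zero  = refl
  ... | suc j = cong (_* f u) (trans (δ-sym j₀ j) (sym (δ-suc j j₀)))

  others : ∀ φ → φ 0 ≡ 0 →
    ∑ (λ j → φ (⟦ not (P j) ⟧ * cls f c (suc j))) + φ (cls f c (suc j₀)) ≡ score φ f c
  others φ φ0 = trans (cong (∑ (λ j → φ (⟦ not (P j) ⟧ * cls f c (suc j))) +_) (sym (∑-δ j₀ (λ j → φ (cls f c (suc j))))))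
    (trans (sym (∑-+ _ _)) (∑-cong pointwise))
    where
    pointwise : ∀ j → φ (⟦ not (P j) ⟧ * cls f c (suc j)) + δ j₀ j * φ (cls f c (suc j)) ≡ φ (cls f c (suc j))
    pointwise j with P j
    ... | true  = trans (cong (_+ 1 * φ (cls f c (suc j))) φ0) (*-identityˡ _)
    ... | false = trans (+-identityʳ _) (cong φ (*-identityˡ _))

  module _ {N' : ℕ} (c' : Fin n → Fin (suc N')) (val' : Valid c') where

    score-g : ∀ φ → score φ (restrict P c f) c' ≡ score φ g c'
    score-g φ = ∑-cong (λ k → cong φ (∑-cong (λ u → cong (δ (c' u) (suc k) *_) (restrict≡g u))))

    zero-g : cls f (refined f c c') zero ≡ cls f c zero + cls g c' zero
    zero-g = trans (cls-refined-zero f c c') (cong (cls f c zero +_) (∑-cong (λ u → cong (δ (c' u) zero *_) (restrict≡g u))))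

    score-refined-g : ∀ φ → φ 0 ≡ 0 → score φ f (refined f c c') + φ (cls f c (suc j₀)) ≡ score φ f c + score φ g c'
    score-refined-g φ φ0 = begin
      score φ f (refined f c c') + x                 ≡⟨ cong (_+ x) (score-refined f c c' φ) ⟩
      rest + score φ (restrict P c f) c' + x      ≡⟨ cong (λ s → rest + s + x) (score-g φ) ⟩
      rest + score φ g c' + x                        ≡⟨ shuffle rest _ x ⟩
      rest + x + score φ g c'                        ≡⟨ cong (_+ score φ g c') (others φ φ0) ⟩
      score φ f c + score φ g c'                     ∎
      where
      open ≡-Reasoning
      x = φ (cls f c (suc j₀))
      rest = ∑ (λ j → φ (⟦ not (P j) ⟧ * cls f c (suc j)))
      shuffle : ∀ a b c → a + b + c ≡ a + c + b
      shuffle = solve-∀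

    odd-refined : odd f (refined f c c') + 1 ≡ cls f c zero + odd g c'
    odd-refined = trans (cong (odd f (refined f c c') +_) (sym odd₀))
      (trans (score-refined-g (_% 2) refl) (cong (_+ odd g c') tight))

    -- Splitting the class `j₀` by `c'` gives up one odd class and gains those of `c'`. Feasibility
    -- of the refined colouring, less the tightness of `c`, is the claim.
    upper : odd g c' ≤ cls g c' zero + 1
    upper = +-cancelˡ-≤ (cls f c zero) _ _ (begin
      cls f c zero + odd g c'        ≡⟨ odd-refined ⟨
      odd f (refined f c c') + 1     ≤⟨ +-monoˡ-≤ 1 (feas (refined f c c') (refined-Valid f c c' val val')) ⟩
      cls f (refined f c c') zero + 1 ≡⟨ cong (_+ 1) zero-g ⟩
      cls f c zero + cls g c' zero + 1 ≡⟨ +-assoc (cls f c zero) _ 1 ⟩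
      cls f c zero + (cls g c' zero + 1) ∎)
      where open ≤-Reasoning

    -- When the bound is attained, the refined colouring is tight as well, so by minimality it covers the whole class.
    attained : cls g c' zero + 1 ≤ odd g c' →
               cls g c' zero + ∑ (λ k → cls g c' (suc k)) ≤ score weigh g c'
    attained h = begin
      cls g c' zero + ∑ (λ k → cls g c' (suc k))  ≡⟨ ∑-cls-suc g c' ⟩
      cls f c (suc j₀)                            ≡⟨ weigh-odd (cls f c (suc j₀)) odd₀ ⟨
      weigh (cls f c (suc j₀))                    ≤⟨ +-cancelˡ-≤ (score weigh f (refined f c c')) _ _ (begin
        score weigh f (refined f c c') + weigh (cls f c (suc j₀)) ≡⟨ score-refined-g weigh refl ⟩
        score weigh f c + score weigh g c'
          ≤⟨ +-monoˡ-≤ _ (least (refined f c c') (refined-Valid f c c' val val') tight' pos') ⟩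
        score weigh f (refined f c c') + score weigh g c' ∎) ⟩
      score weigh g c' ∎
      where
      open ≤-Reasoning
      tight' : odd f (refined f c c') ≡ cls f (refined f c c') zero
      tight' = +-cancelʳ-≡ 1 _ _ (trans odd-refined (trans (cong (cls f c zero +_) (≤-antisym upper h))
        (trans (sym (+-assoc (cls f c zero) _ 1)) (cong (_+ 1) (sym zero-g)))))
      pos' : 1 ≤ cls f (refined f c c') zero
      pos' = ≤-trans pos (≤-trans (m≤m+n _ _) (≤-reflexive (sym zero-g)))

    score-weigh≤ : score weigh g c' ≤ ∑ (λ k → cls g c' (suc k))
    score-weigh≤ = ∑-mono (λ k → weigh≤ (cls g c' (suc k)))

    score-weigh+even≤ : ∀ t → cls g c' (suc t) % 2 ≡ 0 →
                        score weigh g c' + cls g c' (suc t) ≤ ∑ (λ k → cls g c' (suc k))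
    score-weigh+even≤ t ev = begin
      score weigh g c' + cls g c' (suc t)
        ≡⟨ cong (score weigh g c' +_) (∑-δ t (λ k → cls g c' (suc k))) ⟨
      score weigh g c' + ∑ (λ k → δ t k * cls g c' (suc k))
        ≡⟨ ∑-+ _ _ ⟨
      ∑ (λ k → weigh (cls g c' (suc k)) + δ t k * cls g c' (suc k))
        ≤⟨ ∑-mono pointwise ⟩
      ∑ (λ k → cls g c' (suc k)) ∎
      where
      open ≤-Reasoning
      pointwise : ∀ k → weigh (cls g c' (suc k)) + δ t k * cls g c' (suc k) ≤ cls g c' (suc k)
      pointwise k with δ-cases t k
      ... | inj₁ (refl , q) = ≤-reflexive (cong₂ _+_ (weigh-even (cls g c' (suc t)) ev) (trans (cong (_* cls g c' (suc t)) q) (*-identityˡ _)))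
      ... | inj₂ (_ , q) = ≤-trans (≤-reflexive (trans (cong (λ d → weigh (cls g c' (suc k)) + d * cls g c' (suc k)) q) (+-identityʳ _))) (weigh≤ (cls g c' (suc k)))

  ∑g-odd : ∑ g % 2 ≡ 1
  ∑g-odd = odd₀

  module Lowered (v : Fin n) (f' : Fin n → ℕ) (g-v : ∀ u → g u ≡ δ v u + f' u) where

    f'-even : ∑ f' % 2 ≡ 0
    f'-even with %2-cases (∑ f')
    ... | inj₁ p = p
    ... | inj₂ p = ⊥-elim (0≢1+n (trans (sym (suc-%2-1 (∑ f') p)) (trans (cong (_% 2) (sym ∑g)) ∑g-odd)))
      where
      ∑g : ∑ g ≡ 1 + ∑ f'
      ∑g = trans (∑-cong g-v) (trans (∑-+ _ _) (cong (_+ ∑ f') (∑-δ1 v)))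

    module _ {N' : ℕ} (c' : Fin n → Fin (suc N')) (val' : Valid c') where

      cls-g : ∀ j → cls g c' j ≡ δ (c' v) j + cls f' c' j
      cls-g j = trans (cls-+ g (δ v) f' c' g-v j) (cong (_+ cls f' c' j) (cls-δ v c' j))

      gap : cls f' c' zero < odd f' c' → cls f' c' zero + 2 ≤ odd f' c'
      gap lt with m≤n⇒m<n∨m≡n lt
      ... | inj₁ lt' = subst (_≤ odd f' c') (+-comm 2 (cls f' c' zero)) lt'
      ... | inj₂ eq = ⊥-elim (suc-%2-≢ (cls f' c' zero) (trans (cong (_% 2) eq) (odd-parity f' f'-even c')))

      -- By the colour of `v`. If `v` lies in the barrier, or in a class that is even for `g`, then
      -- `g` attains the bound of `upper`, and `attained` puts all demand into odd classes, although
      -- `v` has demand outside them. If the class of `v` is odd for `g`, then `g` has one odd class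
      -- more than `f'` and exceeds that bound.
      gap-absurd : ¬ (cls f' c' zero + 2 ≤ odd f' c')
      gap-absurd h = at (c' v) refl
        where
        at : ∀ y → c' v ≡ y → Empty
        at zero eq = 1+n≰n (begin
          1 + ∑ (λ k → cls g c' (suc k))              ≤⟨ +-monoˡ-≤ _ (≤-trans (m≤m+n 1 _) (≤-reflexive (sym zero-v))) ⟩
          cls g c' zero + ∑ (λ k → cls g c' (suc k))  ≤⟨ attained c' val' bound ⟩
          score weigh g c'                            ≤⟨ score-weigh≤ c' val' ⟩
          ∑ (λ k → cls g c' (suc k))                  ∎)
          where
          open ≤-Reasoning
          zero-v : cls g c' zero ≡ 1 + cls f' c' zero
          zero-v = trans (cls-g zero) (cong (_+ cls f' c' zero) (δ-≡ eq))
          same : odd f' c' ≡ odd g c'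
          same = ∑-cong (λ k → cong (_% 2) (sym (trans (cls-g (suc k)) (cong (λ y → δ y (suc k) + cls f' c' (suc k)) eq))))
          shift2 : ∀ a → 1 + a + 1 ≡ a + 2
          shift2 = solve-∀
          bound : cls g c' zero + 1 ≤ odd g c'
          bound = subst₂ _≤_ (trans (sym (shift2 (cls f' c' zero))) (cong (_+ 1) (sym zero-v))) same h
        at (suc t) eq = by-parity (%2-cases (cls g c' (suc t)))
          where
          open ≤-Reasoning
          zero-v : cls g c' zero ≡ cls f' c' zero
          zero-v = trans (cls-g zero) (cong (λ y → δ y zero + cls f' c' zero) eq)
          cls-t : cls g c' (suc t) ≡ 1 + cls f' c' (suc t)
          cls-t = trans (cls-g (suc t)) (cong (_+ cls f' c' (suc t)) (δ-≡ eq))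
          exchange : odd g c' + cls f' c' (suc t) % 2 ≡ odd f' c' + cls g c' (suc t) % 2
          exchange = trans (cong (odd g c' +_) (sym (∑-δ t (λ k → cls f' c' (suc k) % 2))))
            (trans (sym (∑-+ _ _)) (trans (∑-cong pointwise)
              (trans (∑-+ _ _) (cong (odd f' c' +_) (∑-δ t (λ k → cls g c' (suc k) % 2))))))
            where
            pointwise : ∀ k → cls g c' (suc k) % 2 + δ t k * (cls f' c' (suc k) % 2) ≡ cls f' c' (suc k) % 2 + δ t k * (cls g c' (suc k) % 2)
            pointwise k with δ-cases t k
            ... | inj₁ (refl , q) rewrite q = swap (cls g c' (suc k) % 2) (cls f' c' (suc k) % 2)
              where
              swap : ∀ a b → a + (b + 0) ≡ b + (a + 0)
              swap = solve-∀
            ... | inj₂ (t≢k , q) rewrite q = cong (λ x → x % 2 + 0) (trans (cls-g (suc k))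
              (cong (_+ cls f' c' (suc k)) (δ-≢ (λ p → t≢k (suc-injective (trans (sym eq) p))))))
          by-parity : cls g c' (suc t) % 2 ≡ 0 ⊎ cls g c' (suc t) % 2 ≡ 1 → Empty
          by-parity (inj₁ ev) = 1+n≰n (begin
            1 + score weigh g c'                        ≤⟨ ≤-trans (≤-reflexive (+-comm 1 _)) (+-monoʳ-≤ _ (≤-trans (m≤m+n 1 _) (≤-reflexive (sym cls-t)))) ⟩
            score weigh g c' + cls g c' (suc t)         ≤⟨ score-weigh+even≤ c' val' t ev ⟩
            ∑ (λ k → cls g c' (suc k))                  ≤⟨ m≤n+m _ _ ⟩
            cls g c' zero + ∑ (λ k → cls g c' (suc k))  ≤⟨ attained c' val' bound ⟩
            score weigh g c'                            ∎)
            where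
            bound : cls g c' zero + 1 ≤ odd g c'
            bound = +-cancelʳ-≤ 1 _ _ (begin
              cls g c' zero + 1 + 1 ≡⟨ +-assoc (cls g c' zero) 1 1 ⟩
              cls g c' zero + 2    ≡⟨ cong (_+ 2) zero-v ⟩
              cls f' c' zero + 2   ≤⟨ h ⟩
              odd f' c'            ≤⟨ m≤m+n _ _ ⟩
              odd f' c' + cls g c' (suc t) % 2 ≡⟨ exchange ⟨
              odd g c' + cls f' c' (suc t) % 2 ≤⟨ +-monoʳ-≤ _ (≤-pred (m%n<n (cls f' c' (suc t)) 2)) ⟩
              odd g c' + 1         ∎)
          by-parity (inj₂ od) = <⇒≱ {cls g c' zero + 1} {odd g c' } (begin-strict
              cls g c' zero + 1    ≡⟨ cong (_+ 1) zero-v ⟩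
              cls f' c' zero + 1   <⟨ +-monoʳ-< (cls f' c' zero) (n<1+n 1) ⟩
              cls f' c' zero + 2   ≤⟨ h ⟩
              odd f' c'            ≤⟨ m≤m+n _ _ ⟩
              odd f' c' + cls g c' (suc t) % 2 ≡⟨ exchange ⟨
              odd g c' + cls f' c' (suc t) % 2 ≡⟨ cong (odd g c' +_) lower-even ⟩
              odd g c' + 0         ≡⟨ +-identityʳ _ ⟩
              odd g c'             ∎) (upper c' val')
            where
            lower-even : cls f' c' (suc t) % 2 ≡ 0
            lower-even with %2-cases (cls f' c' (suc t))
            ... | inj₁ p = p
            ... | inj₂ p = ⊥-elim (0≢1+n (trans (sym (suc-%2-1 (cls f' c' (suc t)) p)) (trans (cong (_% 2) (sym cls-t)) od)))

    lowered-Feasible : Feasible f'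
    lowered-Feasible c' val' = ≮⇒≥ (λ lt → gap-absurd c' val' (gap c' val' lt))

-- Each odd class sends one edge to the barrier, as assigned by Hall's theorem, and is then finished by induction.
module Barrier {n : ℕ} (R : Fin n → Fin n → Set) (R? : ∀ u w → Dec (R u w)) (R-sym : ∀ {u w} → R u w → R w u)
  (f : Fin n → ℕ) (feas : Factor.Feasible R f)
  (IH : ∀ g → ∑ g < ∑ f → Factor.Feasible R g → ¬ ¬ Factor.Good R g)
  {N : ℕ} (c : Fin n → Fin (suc N)) (val : Factor.Valid R c) (tight : Factor.odd R f c ≡ Factor.cls R f c zero)
  (least : ∀ {N'} (c' : Fin n → Fin (suc N')) → Factor.Valid R c' → Factor.odd R f c' ≡ Factor.cls R f c' zero →
           1 ≤ Factor.cls R f c' zero → Factor.score R weigh f c ≤ Factor.score R weigh f c')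
  (pos : 1 ≤ Factor.cls R f c zero) where
  open Factor R

  sel : Fin N → Bool
  sel j = isOdd (cls f c (suc j))

  -- `1 ≤ f u` is required because the edge from `s` to `u` will use up one unit of the demand at
  -- `u`.
  A? : ∀ j s → Dec (c s ≡ zero × ∃ λ u → c u ≡ suc j × 1 ≤ f u × R s u)
  A? j s = (c s ≟ zero) ×-dec any? (λ u → (c u ≟ suc j) ×-dec (1 ≤? f u) ×-dec R? s u)

  A : Fin N → Subset n
  A j = subset (A? j)

  f₀ : Fin n → ℕ
  f₀ s = δ (c s) zero * f s

  -- Vertices of zero demand and X form the barrier; classes attached only to X keep their colour, all else is merged.
  module _ (X : Subset n) where

    kept : Fin N → Bool
    kept j = sel j ∧ ⌊ A j ⊆? X ⌋

    recolour : Bool → Fin (suc N) → Bool → Fin (suc (suc N))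
    recolour false _       _     = zero
    recolour true  zero    true  = zero
    recolour true  zero    false = suc zero
    recolour true  (suc j) _     = if kept j then suc (suc j) else suc zero

    cX : Fin n → Fin (suc (suc N))
    cX u = recolour (isPos (f u)) (c u) (lookup X u)

    recolour-zero : ∀ a x b → δ (recolour (isPos a) x b) zero * a ≡ ⟦ b ⟧ * (δ x zero * a)
    recolour-zero zero x b = sym (trans (cong (⟦ b ⟧ *_) (*-zeroʳ (δ x zero))) (*-zeroʳ ⟦ b ⟧))
    recolour-zero (suc a) zero true = sym (+-identityʳ _)
    recolour-zero (suc a) zero false = refl
    recolour-zero (suc a) (suc j) b with kept j
    ... | true  = sym (*-zeroʳ ⟦ b ⟧)
    ... | false = sym (*-zeroʳ ⟦ b ⟧)

    recolour-kept : ∀ a x b j → δ (recolour (isPos a) x b) (suc (suc j)) * a ≡ ⟦ kept j ⟧ * (δ x (suc j) * a)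
    recolour-kept zero x b j = sym (trans (cong (⟦ kept j ⟧ *_) (*-zeroʳ (δ x (suc j)))) (*-zeroʳ ⟦ kept j ⟧))
    recolour-kept (suc a) zero true j = sym (*-zeroʳ ⟦ kept j ⟧)
    recolour-kept (suc a) zero false j = sym (*-zeroʳ ⟦ kept j ⟧)
    recolour-kept (suc a) (suc i) b j with δ-cases i j
    ... | inj₂ (i≢j , q) = trans (cong (_* suc a) other)
      (sym (trans (cong (λ d → ⟦ kept j ⟧ * (d * suc a)) (trans (δ-suc i j) q)) (*-zeroʳ ⟦ kept j ⟧)))
      where
      other : δ (if kept i then suc (suc i) else suc zero) (suc (suc j)) ≡ 0
      other with kept i
      ... | true  = δ-≢ (λ p → i≢j (suc-injective (suc-injective p)))
      ... | false = refl
    ... | inj₁ (refl , q) with kept i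
    ...   | true  = trans (cong (_* suc a) (trans (δ-refl (suc (suc i))) (sym (δ-refl (suc i))))) (sym (+-identityʳ _))
    ...   | false = refl

    kept⇒⊆ : ∀ j → kept j ≡ true → A j ⊆ X
    kept⇒⊆ j p with sel j | A j ⊆? X
    kept⇒⊆ j p  | true  | yes h = h
    kept⇒⊆ j () | true  | no _
    kept⇒⊆ j () | false | _

    -- The critical edges join a barrier vertex outside `X` to a vertex of positive demand in a kept
    -- class `j`. Such a barrier vertex belongs to `A j`, hence to `X`.
    cX-Valid : Valid cX
    cX-Valid u w r = go (isPos (f u)) (c u) (lookup X u) (isPos (f w)) (c w) (lookup X w) refl refl refl refl refl refl
      where
      go : ∀ a x p b y q → isPos (f u) ≡ a → c u ≡ x → lookup X u ≡ p → isPos (f w) ≡ b → c w ≡ y → lookup X w ≡ q →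
           recolour a x p ≡ zero ⊎ recolour b y q ≡ zero ⊎ recolour a x p ≡ recolour b y q
      go false _ _ _ _ _ _ _ _ _ _ _ = inj₁ refl
      go true  _ _ false _ _ _ _ _ _ _ _ = inj₂ (inj₁ refl)
      go true zero true true _ _ _ _ _ _ _ _ = inj₁ refl
      go true zero false true zero true  _ _ _ _ _ _ = inj₂ (inj₁ refl)
      go true zero false true zero false _ _ _ _ _ _ = inj₂ (inj₂ refl)
      go true zero false true (suc j) _ _ cu xu fw cw _ with kept j in k
      ... | false = inj₂ (inj₂ refl)
      ... | true with () ← trans (sym xu) (∈⇒lookup (kept⇒⊆ j k (subset-intro (A? j) (cu , w , cw , true⇒isPos fw , r))))
      go true (suc i) _ true zero true  _ _ _ _ _ _ = inj₂ (inj₁ refl)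
      go true (suc i) _ true zero false fu cu _ _ cw xw with kept i in k
      ... | false = inj₂ (inj₂ refl)
      ... | true with () ← trans (sym xw) (∈⇒lookup (kept⇒⊆ i k (subset-intro (A? i) (cw , u , cu , true⇒isPos fu , R-sym r))))
      go true (suc i) _ true (suc j) _ _ cu _ _ cw _ with val u w r
      ... | inj₁ e with () ← trans (sym cu) e
      ... | inj₂ (inj₁ e) with () ← trans (sym cw) e
      ... | inj₂ (inj₂ e) with refl ← trans (sym cu) (trans e cw) = inj₂ (inj₂ refl)

    -- Hall's condition at `X` is feasibility at `cX`: an odd class confined to `X` keeps its colour
    -- and stays odd, and the barrier of `cX` carries exactly the demand of `f₀` on `X`.
    confined≤ : confined A sel X ≤ f₀ ⟨ X ⟩
    confined≤ = begin
      confined A sel X                                  ≤⟨ ∑-mono pointwise ⟩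
      ∑ (λ j → (⟦ kept j ⟧ * cls f c (suc j)) % 2)      ≡⟨ ∑-cong (λ j → cong (_% 2) (cls-kept j)) ⟨
      ∑ (λ j → cls f cX (suc (suc j)) % 2)              ≤⟨ m≤n+m _ (cls f cX (suc zero) % 2) ⟩
      cls f cX (suc zero) % 2 + ∑ (λ j → cls f cX (suc (suc j)) % 2) ≡⟨ ∑-suc _ ⟨
      odd f cX                                          ≤⟨ feas cX cX-Valid ⟩
      cls f cX zero                                     ≡⟨ ∑-cong (λ u → recolour-zero (f u) (c u) (lookup X u)) ⟩
      f₀ ⟨ X ⟩ ∎
      where
      open ≤-Reasoning
      cls-kept : ∀ j → cls f cX (suc (suc j)) ≡ ⟦ kept j ⟧ * cls f c (suc j)
      cls-kept j = trans (∑-cong (λ u → recolour-kept (f u) (c u) (lookup X u) j)) (∑-*ˡ ⟦ kept j ⟧ _)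
      pointwise : ∀ j → ⟦ sel j ⟧ * within (A j) X ≤ (⟦ kept j ⟧ * cls f c (suc j)) % 2
      pointwise j with sel j in s | ⌊ A j ⊆? X ⌋
      ... | false | _     = z≤n
      ... | true  | false = z≤n
      ... | true  | true  = ≤-reflexive (sym (trans (cong (_% 2) (*-identityˡ (cls f c (suc j)))) (isOdd⇒ (cls f c (suc j)) s)))

  matching : ∃ λ (y : Fin N → Fin n → ℕ) → (∀ j → Served (A j) (sel j) (y j)) × (∀ v → ∑ (λ j → y j v) ≡ f₀ v)
  matching = hall N A sel f₀ confined≤ (trans (∑-cong (λ j → ⟦isOdd⟧ (cls f c (suc j)))) tight)

  y = proj₁ matching

  open module EvenPart {N' : ℕ} = Refine {N} {N'} (λ j → not (sel j)) using (refined; refined-Valid; cls-refined-zero; score-refined)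

  f-even : Fin n → ℕ
  f-even = restrict (λ j → not (sel j)) c f

  -- Refining the even classes by `c'` keeps every odd class of `c`, so tightness of `c` can be
  -- subtracted from the feasibility of the refined colouring.
  f-even-Feasible : Feasible f-even
  f-even-Feasible {N'} c' val' = +-cancelˡ-≤ (cls f c zero) _ _ (begin
    cls f c zero + odd f-even c'          ≡⟨ cong (_+ odd f-even c') tight ⟨
    odd f c + odd f-even c'               ≡⟨ cong (_+ odd f-even c') (∑-cong selected) ⟨
    _                                     ≡⟨ score-refined f c c' (_% 2) ⟨
    odd f (refined f c c')                ≤⟨ feas (refined f c c') (refined-Valid f c c' val val') ⟩
    cls f (refined f c c') zero           ≡⟨ cls-refined-zero f c c' ⟩
    cls f c zero + cls f-even c' zero     ∎)
    where
    open ≤-Reasoning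
    selected : ∀ j → (⟦ not (not (sel j)) ⟧ * cls f c (suc j)) % 2 ≡ cls f c (suc j) % 2
    selected j with %2-cases (cls f c (suc j))
    ... | inj₁ p rewrite p = refl
    ... | inj₂ p rewrite p = trans (cong (_% 2) (*-identityˡ (cls f c (suc j)))) p

  ∑-drop : ∀ (g : Fin n → ℕ) s → (∀ u → g u ≤ f u) → g s < f s → ∑ g < ∑ f
  ∑-drop g s g≤f lt = begin-strict
    ∑ g                     <⟨ n<1+n _ ⟩
    1 + ∑ g                 ≡⟨ cong (_+ ∑ g) (∑-δ1 s) ⟨
    ∑ (δ s) + ∑ g           ≡⟨ ∑-+ _ _ ⟨
    ∑ (λ u → δ s u + g u)   ≤⟨ ∑-mono pointwise ⟩
    ∑ f                     ∎
    where
    open ≤-Reasoning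
    pointwise : ∀ u → δ s u + g u ≤ f u
    pointwise u with δ-cases s u
    ... | inj₁ (refl , q) = ≤-trans (≤-reflexive (cong (_+ g s) q)) lt
    ... | inj₂ (_ , q)    = ≤-trans (≤-reflexive (cong (_+ g u) q)) (g≤f u)

  -- `f-even` and the demands of the odd classes all vanish at this vertex while `f` does not, so
  -- the induction hypothesis applies to them.
  barrier-vertex : ∃ λ s → c s ≡ zero × 1 ≤ f s
  barrier-vertex with ∑-pos _ pos
  ... | s , q with δ-cases (c s) zero
  ...   | inj₁ (cs , d) = s , cs , subst (1 ≤_) (trans (cong (_* f s) d) (*-identityˡ (f s))) q
  ...   | inj₂ (_ , d) with () ← ≤-trans q (≤-reflexive (cong (_* f s) d))

  s₀ = proj₁ barrier-vertex
  c-s₀ = proj₁ (proj₂ barrier-vertex)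
  f-s₀ = proj₂ (proj₂ barrier-vertex)

  f-even-Good : ¬ ¬ Good f-even
  f-even-Good = IH f-even (∑-drop f-even s₀ below (≤-trans (s≤s (≤-reflexive (cong (λ x → part (λ j → not (sel j)) x * f s₀) c-s₀))) f-s₀)) f-even-Feasible
    where
    below : ∀ u → f-even u ≤ f u
    below u with c u
    ... | zero  = z≤n
    ... | suc j = ≤-trans (*-monoˡ-≤ (f u) (⟦⟧≤1 (not (sel j)))) (≤-reflexive (*-identityˡ (f u)))

  -- These shares and `f-even` add up to `f`: the matching distributes the barrier demand, one unit
  -- to each odd class.
  class : Fin N → Fin n → ℕ
  class j u = y j u + ⟦ sel j ⟧ * (δ (c u) (suc j) * f u)

  class-Good : ∀ j → ¬ ¬ Good (class j)
  class-Good j with sel j in odd-j | proj₁ (proj₂ matching) j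
  ... | false | skip y≡0 = λ k → k (Good-cong none (λ u → trans (+-identityʳ _) (y≡0 u)))
  ... | true  | serve s s∈A y≡δ with v , c-v , f-v , r ← proj₂ (subset-elim (A? j) s∈A) = λ k →
    IH f' smaller lowered-Feasible λ good →
      k (Good-cong (plus (edge r) good) λ u → (begin
        y j u + 1 * (δ (c u) (suc j) * f u)    ≡⟨ cong₂ _+_ (y≡δ u) (trans (*-identityˡ _) (g-v u)) ⟩
        δ s u + (δ v u + f' u)                 ≡⟨ +-assoc (δ s u) _ _ ⟨
        δ s u + δ v u + f' u                   ∎))
    where
    open ≡-Reasoning
    open OddClass R f feas c val tight least pos j (isOdd⇒ (cls f c (suc j)) odd-j)
    lower = minus-δ g v (≤-trans f-v (≤-reflexive (sym (trans (cong (_* f v) (δ-≡ c-v)) (*-identityˡ (f v))))))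
    f' = proj₁ lower
    g-v = proj₂ lower
    open Lowered v f' g-v
    f'≤g : ∀ u → f' u ≤ g u
    f'≤g u = ≤-trans (m≤n+m _ (δ v u)) (≤-reflexive (sym (g-v u)))
    smaller : ∑ f' < ∑ f
    smaller = ∑-drop f' s₀ (λ u → ≤-trans (f'≤g u) (≤-trans (*-monoˡ-≤ (f u) (δ≤1 (c u) (suc j))) (≤-reflexive (*-identityˡ (f u)))))
      (≤-trans (s≤s (≤-trans (f'≤g s₀) (≤-reflexive (cong (λ x → δ x (suc j) * f s₀) c-s₀)))) f-s₀)

  barrier-Good : ¬ ¬ Good f
  barrier-Good k = f-even-Good λ even → ¬¬-∀Fin class-Good λ classes →
    k (Good-cong (plus even (Good-∑ class classes)) total)
    where
    total : ∀ u → f u ≡ f-even u + ∑ (λ j → class j u)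
    total u = sym (trans (cong (f-even u +_) (trans (∑-+ _ _) (cong (_+ ∑ (λ j → ⟦ sel j ⟧ * (δ (c u) (suc j) * f u))) (proj₂ (proj₂ matching) u)))) (at (c u)))
      where
      at : ∀ x → part (λ j → not (sel j)) x * f u + (δ x zero * f u + ∑ (λ j → ⟦ sel j ⟧ * (δ x (suc j) * f u))) ≡ f u
      at zero = trans (cong (f u + 0 +_) (∑-0 (λ j → *-zeroʳ ⟦ sel j ⟧))) (trans (+-identityʳ _) (+-identityʳ _))
      at (suc i) = begin
        ⟦ not (sel i) ⟧ * f u + ∑ (λ j → ⟦ sel j ⟧ * (δ (suc i) (suc j) * f u))
          ≡⟨ cong (⟦ not (sel i) ⟧ * f u +_) (trans (∑-cong swap) (∑-δ i (λ j → ⟦ sel j ⟧ * f u))) ⟩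
        ⟦ not (sel i) ⟧ * f u + ⟦ sel i ⟧ * f u
          ≡⟨ *-distribʳ-+ (f u) ⟦ not (sel i) ⟧ _ ⟨
        (⟦ not (sel i) ⟧ + ⟦ sel i ⟧) * f u
          ≡⟨ cong (_* f u) (trans (+-comm ⟦ not (sel i) ⟧ _) (⟦not⟧ (sel i))) ⟩
        1 * f u ≡⟨ *-identityˡ (f u) ⟩
        f u ∎
        where
        open ≡-Reasoning
        move : ∀ a b c → a * (b * c) ≡ b * (a * c)
        move = solve-∀
        swap : ∀ j → ⟦ sel j ⟧ * (δ (suc i) (suc j) * f u) ≡ δ i j * (⟦ sel j ⟧ * f u)
        swap j = trans (move ⟦ sel j ⟧ (δ (suc i) (suc j)) (f u)) (cong (_* (⟦ sel j ⟧ * f u)) (δ-suc i j))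

-- The induction for parity factors

module _ {n : ℕ} (R : Fin n → Fin n → Set) (R? : ∀ u w → Dec (R u w)) (R-sym : ∀ {u w} → R u w → R w u) where
  open Factor R

  private
    -- Without a barrier some demand can be lowered by two, since a vertex of demand 1 would be a barrier by itself.
    step : ∀ f → Feasible f → (∀ g → ∑ g < ∑ f → Feasible g → ¬ ¬ Good g) → ¬ ¬ Good f
    step f feas IH ¬good = by-demand (any? (λ v → 1 ≤? f v))
      where
      Tight-at : (Σ ℕ λ N → Fin n → Fin (suc N)) → Set
      Tight-at (N , c) = Valid c × odd f c ≡ cls f c zero × 1 ≤ cls f c zero

      no-barrier : ∀ {N} (c : Fin n → Fin (suc N)) → Valid c → odd f c ≡ cls f c zero → ¬ (1 ≤ cls f c zero)
      no-barrier {N} c val tight pos =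
        ¬¬-minimum Tight-at (λ (N , c) → score weigh f c) (N , c) (val , tight , pos)
          λ ((N₀ , c₀) , (val₀ , tight₀ , pos₀) , least) →
            Barrier.barrier-Good R R? R-sym f feas IH c₀ val₀ tight₀
              (λ {N'} c' val' tight' pos' → least (N' , c') (val' , tight' , pos')) pos₀ ¬good

      even = Feasible⇒even f feas

      -- By parity, a colouring that violates feasibility for `g` does so by at least two. Adding
      -- two units at `v` changes no class parity and raises the barrier demand by at most two, so
      -- the colouring would be a tight barrier for `f`.
      by-two : ∀ v g → (∀ u → f u ≡ g u + (δ v u + δ v u)) → Empty
      by-two v g eq = IH g smaller g-Feasible λ good → ¬good (lift good λ u → δ v u , eq u)
        where
        ∑f : ∑ f ≡ ∑ g + 2
        ∑f = trans (∑-cong eq) (trans (∑-+ _ _) (cong (∑ g +_) (trans (∑-+ _ _) (cong₂ _+_ (∑-δ1 v) (∑-δ1 v)))))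
        smaller : ∑ g < ∑ f
        smaller = subst (∑ g <_) (sym ∑f) (m<m+n (∑ g) (s≤s z≤n))
        g-even : ∑ g % 2 ≡ 0
        g-even = trans (sym (%2-+double (∑ g) 1)) (trans (cong (_% 2) (sym ∑f)) even)
        g-Feasible : Feasible g
        g-Feasible c val = ≮⇒≥ λ lt → no-barrier c val (≤-antisym (feas c val) (begin
          cls f c zero                      ≡⟨ cls-f zero ⟩
          cls g c zero + (δ (c v) zero + δ (c v) zero) ≤⟨ +-monoʳ-≤ _ (+-mono-≤ (δ≤1 (c v) zero) (δ≤1 (c v) zero)) ⟩
          cls g c zero + 2                  ≤⟨ jump lt ⟩
          odd g c                           ≡⟨ odd≡ ⟨
          odd f c                           ∎)) (begin
          1                                 ≤⟨ ≤-trans (s≤s z≤n) lt ⟩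
          odd g c                           ≡⟨ odd≡ ⟨
          odd f c                           ≤⟨ feas c val ⟩
          cls f c zero                      ∎)
          where
          open ≤-Reasoning
          cls-f : ∀ j → cls f c j ≡ cls g c j + (δ (c v) j + δ (c v) j)
          cls-f j = trans (cls-+ f g (λ u → δ v u + δ v u) c eq j)
            (cong (cls g c j +_) (trans (cls-+ _ (δ v) (δ v) c (λ u → refl) j) (cong₂ _+_ (cls-δ v c j) (cls-δ v c j))))
          odd≡ : odd f c ≡ odd g c
          odd≡ = ∑-cong (λ j → trans (cong (_% 2) (cls-f (suc j))) (%2-+double (cls g c (suc j)) (δ (c v) (suc j))))
          jump : cls g c zero < odd g c → cls g c zero + 2 ≤ odd g c
          jump lt with m≤n⇒m<n∨m≡n lt
          ... | inj₁ lt' = subst (_≤ odd g c) (+-comm 2 (cls g c zero)) lt'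
          ... | inj₂ e = ⊥-elim (suc-%2-≢ (cls g c zero) (trans (cong (_% 2) e) (odd-parity g g-even c)))

      by-one : ∀ v → f v ≡ 1 → Empty
      by-one v fv = no-barrier c (λ u w r → valid u w) (trans odd≡1 (sym cls0)) (≤-reflexive (sym cls0))
        where
        pick : ∀ {P : Set} → Dec P → Fin 2
        pick (yes _) = zero
        pick (no _)  = suc zero
        c : Fin n → Fin 2
        c u = pick (v ≟ u)
        valid : ∀ u w → c u ≡ zero ⊎ c w ≡ zero ⊎ c u ≡ c w
        valid u w with v ≟ u | v ≟ w
        ... | yes _ | _     = inj₁ refl
        ... | no _  | yes _ = inj₂ (inj₁ refl)
        ... | no _  | no _  = inj₂ (inj₂ refl)
        cls0 : cls f c zero ≡ 1
        cls0 = trans (∑-cong (λ u → cong (_* f u) (at u))) (trans (∑-δ v f) fv)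
          where
          at : ∀ u → δ (c u) zero ≡ δ v u
          at u with v ≟ u
          ... | yes _ = refl
          ... | no _  = refl
        -- The total is even and `v` contributes 1, so the other vertices form a single odd class.
        odd≡1 : odd f c ≡ 1
        odd≡1 = trans (∑-suc _) (trans (cong₂ _+_ class-odd (∑-0 (λ ()))) (+-identityʳ 1))
          where
          class-odd : cls f c (suc zero) % 2 ≡ 1
          class-odd = trans (sym (%2-idem (cls f c (suc zero)))) (trans (cong (_% 2) (trans (sym (+-identityʳ _)) (trans (cong (cls f c (suc zero) % 2 +_) (sym (∑-0 (λ ())))) (sym (∑-suc _)))))
            (trans (odd-parity f even c) (cong (_% 2) cls0)))

      by-demand : Dec (∃ λ v → 1 ≤ f v) → Empty
      by-demand (no all0) = ¬good (Good-cong none (λ u → n≤0⇒n≡0 (≮⇒≥ (λ p → all0 (u , p)))))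
      by-demand (yes (v , fv≥1)) with m≤n⇒m<n∨m≡n fv≥1
      ... | inj₂ fv = by-one v (sym fv)
      ... | inj₁ fv≥2 = by-two v g₂ (λ u → trans (eq₁ u) (trans (cong (δ v u +_) (eq₂ u)) (shuffle (δ v u) (g₂ u))))
        where
        shuffle : ∀ a b → a + (a + b) ≡ b + (a + a)
        shuffle = solve-∀
        g₁ = proj₁ (minus-δ f v fv≥1)
        eq₁ = proj₂ (minus-δ f v fv≥1)
        g₁v≥1 : 1 ≤ g₁ v
        g₁v≥1 = ≤-pred (≤-trans fv≥2 (≤-reflexive (trans (eq₁ v) (cong (_+ g₁ v) (δ-refl v)))))
        g₂ = proj₁ (minus-δ g₁ v g₁v≥1)
        eq₂ = proj₂ (minus-δ g₁ v g₁v≥1)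

  -- Strong induction on the total demand; the bound `B` makes the recursion structural.
  parity-factor : ∀ f → Feasible f → ¬ ¬ Good f
  parity-factor f = below (suc (∑ f)) f ≤-refl
    where
    below : ∀ B f → ∑ f < B → Feasible f → ¬ ¬ Good f
    below (suc B) f lt feas = step f feas (λ g lt' → below B g (<-≤-trans lt' (≤-pred lt)))

-- Degrees and connectivity

ceil-≥ : ∀ a k → .{{_ : NonZero k}} → a ≤ k * ⌈ a / k ⌉
ceil-≥ a (suc b) = +-cancelʳ-≤ b a _ (begin
  a + b                                            ≡⟨ m≡m%n+[m/n]*n (a + b) (suc b) ⟩
  (a + b) % suc b + (a + b) / suc b * suc b        ≤⟨ +-monoˡ-≤ _ (≤-pred (m%n<n (a + b) (suc b))) ⟩
  b + (a + b) / suc b * suc b                      ≡⟨ +-comm b _ ⟩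
  (a + b) / suc b * suc b + b                      ≡⟨ cong (_+ b) (*-comm ((a + b) / suc b) (suc b)) ⟩
  suc b * ((a + b) / suc b) + b                    ∎)
  where open ≤-Reasoning

ceil-≤ : ∀ a k q → .{{_ : NonZero k}} → a ≤ k * q → ⌈ a / k ⌉ ≤ q
ceil-≤ a (suc b) q h = ≤-pred (m<n*o⇒m/o<n {n = suc q} (begin-strict
  a + b                <⟨ +-mono-≤-< h (n<1+n b) ⟩
  suc b * q + suc b    ≡⟨ trans (+-comm _ (suc b)) (cong (suc b +_) (*-comm (suc b) q)) ⟩
  suc q * suc b        ∎))
  where open ≤-Reasoning

ceil-mono : ∀ {a a'} k → .{{_ : NonZero k}} → a ≤ a' → ⌈ a / k ⌉ ≤ ⌈ a' / k ⌉
ceil-mono {a} {a'} k h = ceil-≤ a k _ (≤-trans h (ceil-≥ a' k))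

-- Distinct colours joined by an edge are merged until only one colour is left; each merger uses up an edge.
module Image {n M : ℕ} where

  hit? : ∀ (φ : Fin n → Fin M) j → Dec (∃ λ v → φ v ≡ j)
  hit? φ j = any? (λ v → φ v ≟ j)

  hit : (Fin n → Fin M) → Fin M → ℕ
  hit φ j = ⟦ ⌊ hit? φ j ⌋ ⟧

  hit-1 : ∀ φ j v → φ v ≡ j → hit φ j ≡ 1
  hit-1 φ j v p with hit? φ j
  ... | yes _ = refl
  ... | no ¬p = ⊥-elim (¬p (v , p))

  hit-≤ : ∀ φ j x → (∀ v → φ v ≡ j → 1 ≤ x) → hit φ j ≤ x
  hit-≤ φ j x h with hit? φ j
  ... | yes (v , p) = h v p
  ... | no _        = z≤n

  image : (Fin n → Fin M) → ℕ
  image φ = ∑ (hit φ)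

  merge : Fin M → Fin M → Fin M → Fin M
  merge x y z with z ≟ y
  ... | yes _ = x
  ... | no _  = z

  merge-≡ : ∀ x y → merge x y y ≡ x
  merge-≡ x y with y ≟ y
  ... | yes _ = refl
  ... | no ¬p = ⊥-elim (¬p refl)

  merge-≢ : ∀ x y z → z ≢ y → merge x y z ≡ z
  merge-≢ x y z ¬p with z ≟ y
  ... | yes p = ⊥-elim (¬p p)
  ... | no _  = refl

  image-merge : ∀ φ x y → image φ ≤ image (merge x y ∘ φ) + 1
  image-merge φ x y = begin
    image φ                                ≤⟨ ∑-mono (λ j → hit-≤ φ j _ (pointwise j)) ⟩
    ∑ (λ j → hit (merge x y ∘ φ) j + δ y j) ≡⟨ trans (∑-+ _ _) (cong (image (merge x y ∘ φ) +_) (∑-δ1 y)) ⟩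
    image (merge x y ∘ φ) + 1 ∎
    where
    open ≤-Reasoning
    pointwise : ∀ j v → φ v ≡ j → 1 ≤ hit (merge x y ∘ φ) j + δ y j
    pointwise j v p with δ-cases y j
    ... | inj₁ (_ , q) = ≤-trans (≤-reflexive (sym q)) (m≤n+m _ _)
    ... | inj₂ (y≢j , _) = ≤-trans (≤-reflexive (sym (hit-1 (merge x y ∘ φ) j v
      (trans (merge-≢ x y (φ v) (λ e → y≢j (trans (sym e) p))) p)))) (m≤m+n _ _)

module _ (G : Graph) where
  private
    V = Fin (n G)
    E = Fin (e G)

  fst snd : E → V
  fst i = proj₁ (ends G i)
  snd i = proj₂ (ends G i)

  -- A sum in place of the disjunction in `incident`: the two agree because there are no loops, and
  -- the sum can be exchanged with other sums.
  inc : E → V → ℕ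
  inc i v = δ v (fst i) + δ v (snd i)

  deg≡ : ∀ S v → deg G S v ≡ ∑ (λ i → ⟦ lookup S i ⟧ * inc i v)
  deg≡ S v = trans (∣∣≡∑ (S ∩ incident G v)) (∑-cong pointwise)
    where
    pointwise : ∀ i → ⟦ lookup (S ∩ incident G v) i ⟧ ≡ ⟦ lookup S i ⟧ * inc i v
    pointwise i rewrite lookup-∩ S (incident G v) i
                | lookup∘tabulate (λ i → ⌊ v ≟ fst i ⌋ ∨ ⌊ v ≟ snd i ⌋) i
      = trans (⟦∧⟧ (lookup S i) _) (cong (⟦ lookup S i ⟧ *_) bits)
      where
      bits : ⟦ ⌊ v ≟ fst i ⌋ ∨ ⌊ v ≟ snd i ⌋ ⟧ ≡ δ v (fst i) + δ v (snd i)
      bits with v ≟ fst i | v ≟ snd i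
      ... | yes p | yes q = ⊥-elim (loopless G i (trans (sym p) q))
      ... | yes _ | no _  = refl
      ... | no _  | yes _ = refl
      ... | no _  | no _  = refl

  deg-⊤ : ∀ v → deg G ⊤ v ≡ ∑ (λ i → inc i v)
  deg-⊤ v = trans (deg≡ ⊤ v) (∑-cong (λ i → trans (cong (λ b → ⟦ b ⟧ * inc i v) (∈⇒lookup (∈⊤ {x = i}))) (*-identityˡ _)))

  ∑-inc : ∀ i (g : V → ℕ) → ∑ (λ v → inc i v * g v) ≡ g (fst i) + g (snd i)
  ∑-inc i g = trans (∑-cong (λ v → trans (*-distribʳ-+ (g v) (δ v (fst i)) _)
      (cong₂ _+_ (cong (_* g v) (δ-sym v (fst i))) (cong (_* g v) (δ-sym v (snd i))))))
    (trans (∑-+ _ _) (cong₂ _+_ (∑-δ (fst i) g) (∑-δ (snd i) g)))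

  -- The weighted handshake lemma; with an indicator for `g` it counts the ends that edges of `S`
  -- have in a vertex set.
  ∑-deg : ∀ S (g : V → ℕ) → ∑ (λ v → g v * deg G S v) ≡ ∑ (λ i → ⟦ lookup S i ⟧ * (g (fst i) + g (snd i)))
  ∑-deg S g = begin
    ∑ (λ v → g v * deg G S v)
      ≡⟨ ∑-cong (λ v → trans (cong (g v *_) (deg≡ S v)) (sym (∑-*ˡ (g v) _))) ⟩
    ∑ (λ v → ∑ (λ i → g v * (⟦ lookup S i ⟧ * inc i v)))
      ≡⟨ ∑-swap _ ⟩
    ∑ (λ i → ∑ (λ v → g v * (⟦ lookup S i ⟧ * inc i v)))
      ≡⟨ ∑-cong (λ i → trans (∑-cong (λ v → shuffle (g v) ⟦ lookup S i ⟧ (inc i v))) (trans (∑-*ˡ ⟦ lookup S i ⟧ _) (cong (⟦ lookup S i ⟧ *_) (∑-inc i g)))) ⟩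
    ∑ (λ i → ⟦ lookup S i ⟧ * (g (fst i) + g (snd i))) ∎
    where
    open ≡-Reasoning
    shuffle : ∀ a b c → a * (b * c) ≡ b * (c * a)
    shuffle = solve-∀

  ∑-deg-⊤-even : ∑ (deg G ⊤) % 2 ≡ 0
  ∑-deg-⊤-even = trans (cong (_% 2) (trans (∑-cong (λ v → sym (*-identityˡ (deg G ⊤ v)))) (trans (∑-deg ⊤ (λ _ → 1))
      (trans (∑-cong (λ i → *-distribˡ-+ ⟦ lookup ⊤ i ⟧ 1 1)) (∑-+ _ _)))))
    (double-%2 (∑ (λ i → ⟦ lookup (⊤ {e G}) i ⟧ * 1)))

  deg-∁ : ∀ S v → deg G (∁ S) v + deg G S v ≡ deg G ⊤ v
  deg-∁ S v = trans (cong₂ _+_ (deg≡ (∁ S) v) (deg≡ S v)) (trans (sym (∑-+ _ _)) (trans (∑-cong pointwise) (sym (deg-⊤ v))))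
    where
    pointwise : ∀ i → ⟦ lookup (∁ S) i ⟧ * inc i v + ⟦ lookup S i ⟧ * inc i v ≡ inc i v
    pointwise i rewrite lookup-map i not S = trans (sym (*-distribʳ-+ (inc i v) ⟦ not (lookup S i) ⟧ _))
      (trans (cong (_* inc i v) (trans (+-comm ⟦ not (lookup S i) ⟧ _) (⟦not⟧ (lookup S i)))) (*-identityˡ _))

  edge-deg : ∀ {S i} v → i ∈ S → 1 ≤ inc i v → 1 ≤ deg G S v
  edge-deg {S} {i} v i∈S h = begin
    1                                        ≤⟨ h ⟩
    inc i v                                  ≡⟨ *-identityˡ _ ⟨
    1 * inc i v                              ≡⟨ cong (λ b → ⟦ b ⟧ * inc i v) (∈⇒lookup i∈S) ⟨
    ⟦ lookup S i ⟧ * inc i v                 ≤⟨ ∑-term _ i ⟩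
    ∑ (λ i → ⟦ lookup S i ⟧ * inc i v)       ≡⟨ deg≡ S v ⟨
    deg G S v ∎
    where open ≤-Reasoning

  Reach-deg : ∀ {S u w} → Reach G S u w → u ≢ w → 1 ≤ deg G S u
  Reach-deg here u≢u = ⊥-elim (u≢u refl)
  Reach-deg {S} {u} (fwd i i∈S r) _ with u ≟ fst i
  ... | yes refl = edge-deg (fst i) i∈S (≤-trans (≤-reflexive (sym (δ-refl (fst i)))) (m≤m+n _ _))
  ... | no u≢    = Reach-deg r u≢
  Reach-deg {S} {u} (bwd i i∈S r) _ with u ≟ snd i
  ... | yes refl = edge-deg (snd i) i∈S (≤-trans (≤-reflexive (sym (δ-refl (snd i)))) (m≤n+m _ (δ (snd i) (fst i))))
  ... | no u≢    = Reach-deg r u≢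

  deg-neighbour : ∀ S v → 1 ≤ deg G S v → ∃ λ u → v ≢ u
  deg-neighbour S v h with ∑-pos _ (≤-trans h (≤-reflexive (deg≡ S v)))
  ... | i , p with v ≟ fst i | v ≟ snd i
  ...   | yes v≡a | _       = snd i , λ v≡b → loopless G i (trans (sym v≡a) v≡b)
  ...   | no v≢a  | _ = fst i , v≢a

  Reach-constant : ∀ {A : Set} {T} (φ : V → A) → (∀ i → i ∈ T → φ (fst i) ≡ φ (snd i)) → ∀ {u w} → Reach G T u w → φ u ≡ φ w
  Reach-constant φ h here          = refl
  Reach-constant φ h (fwd i i∈T r) = trans (Reach-constant φ h r) (h i i∈T)
  Reach-constant φ h (bwd i i∈T r) = trans (Reach-constant φ h r) (sym (h i i∈T))

  module _ {M : ℕ} where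
    open Image {n G} {M}

    cross : (V → Fin M) → E → ℕ
    cross φ i = ⟦ not ⌊ φ (fst i) ≟ φ (snd i) ⌋ ⟧

    cross-≡ : ∀ φ i → φ (fst i) ≡ φ (snd i) → cross φ i ≡ 0
    cross-≡ φ i p with φ (fst i) ≟ φ (snd i)
    ... | yes _ = refl
    ... | no ¬p = ⊥-elim (¬p p)

    cross-≢ : ∀ φ i → φ (fst i) ≢ φ (snd i) → cross φ i ≡ 1
    cross-≢ φ i ¬p with φ (fst i) ≟ φ (snd i)
    ... | yes p = ⊥-elim (¬p p)
    ... | no _  = refl

    crossing : Subset (e G) → (V → Fin M) → ℕ
    crossing T φ = ∑ (λ i → ⟦ lookup T i ⟧ * cross φ i)

    image≤crossing : ∀ T → Connected G T → ∀ φ → image φ ≤ crossing T φ + 1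
    image≤crossing T conn φ = below (suc (crossing T φ)) φ ≤-refl
      where
      open ≤-Reasoning
      below : ∀ B φ → crossing T φ < B → image φ ≤ crossing T φ + 1
      below (suc B) φ lt with any? (λ i → (i ∈? T) ×-dec ¬? (φ (fst i) ≟ φ (snd i)))
      ... | no none = ≮⇒≥ λ big → let j , p = ∑-pos _ (≤-trans (s≤s z≤n) big) in <⇒≱ big (single j p)
        where
        constant : ∀ u w → φ u ≡ φ w
        constant u w = Reach-constant φ (λ i i∈T → decidable-stable (φ (fst i) ≟ φ (snd i)) (λ ¬p → none (i , i∈T , ¬p))) (conn u w)
        single : ∀ j → 1 ≤ hit φ j → image φ ≤ crossing T φ + 1
        single j p with hit? φ j
        single j _ | yes (v , refl) = ≤-trans (∑-mono (λ j' → hit-≤ φ j' (δ (φ v) j') (λ w q → ≤-reflexive (sym (δ-≡ (trans (constant v w) q))))))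
          (≤-trans (≤-reflexive (∑-δ1 (φ v))) (m≤n+m 1 _))
      ... | yes (i , i∈T , φ≢) = begin
        image φ                    ≤⟨ image-merge φ (φ (fst i)) (φ (snd i)) ⟩
        image φ' + 1               ≤⟨ +-monoˡ-≤ 1 (below B φ' (<-≤-trans fewer (≤-pred lt))) ⟩
        crossing T φ' + 1 + 1      ≤⟨ +-monoˡ-≤ 1 (subst (_≤ crossing T φ) (+-comm 1 _) fewer) ⟩
        crossing T φ + 1           ∎
        where
        φ' = merge (φ (fst i)) (φ (snd i)) ∘ φ
        fewer : crossing T φ' < crossing T φ
        fewer = begin-strict
          crossing T φ'       <⟨ n<1+n _ ⟩
          1 + crossing T φ'   ≡⟨ cong (_+ crossing T φ') (∑-δ1 i) ⟨
          ∑ (δ i) + crossing T φ' ≡⟨ ∑-+ _ _ ⟨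
          _                   ≤⟨ ∑-mono pointwise ⟩
          crossing T φ        ∎
          where
          pointwise : ∀ j → δ i j + ⟦ lookup T j ⟧ * cross φ' j ≤ ⟦ lookup T j ⟧ * cross φ j
          pointwise j with δ-cases i j
          ... | inj₁ (refl , q) rewrite q | ∈⇒lookup i∈T | cross-≢ φ i φ≢
              | cross-≡ φ' i (trans (merge-≢ (φ (fst i)) (φ (snd i)) _ φ≢) (sym (merge-≡ (φ (fst i)) (φ (snd i))))) = ≤-refl
          ... | inj₂ (_ , q) rewrite q = *-monoʳ-≤ ⟦ lookup T j ⟧ mono
            where
            mono : cross φ' j ≤ cross φ j
            mono with φ (fst j) ≟ φ (snd j)
            ... | yes p = ≤-reflexive (cross-≡ φ' j (cong (merge (φ (fst i)) (φ (snd i))) p))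
            ... | no _  = ⟦⟧≤1 (not ⌊ φ' (fst j) ≟ φ' (snd j) ⌋)

  disjoint-bits≤1 : ∀ {q} (b : Fin q → Bool) → (∀ j j' → j ≢ j' → b j ≡ true → b j' ≡ true → Empty) → ∑ (λ j → ⟦ b j ⟧) ≤ 1
  disjoint-bits≤1 b disj with any? (λ j → b j ≟ᵇ true)
  ... | no none = ≤-trans (≤-reflexive (∑-0 (λ j → cong ⟦_⟧ (¬-not (λ p → none (j , p)))))) z≤n
  ... | yes (j , bj) = ≤-trans (∑-mono pointwise) (≤-reflexive (∑-δ1 j))
    where
    pointwise : ∀ j' → ⟦ b j' ⟧ ≤ δ j j'
    pointwise j' with δ-cases j j' | b j' in bj'
    ... | inj₁ (_ , q) | b' = ≤-trans (⟦⟧≤1 b') (≤-reflexive (sym q))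
    ... | inj₂ (j≢j' , q) | true  = ⊥-elim (disj j j' j≢j' bj bj')
    ... | inj₂ (j≢j' , q) | false = z≤n

  Disjoint : ∀ {q} → (Fin q → Subset (e G)) → Set
  Disjoint T = ∀ j j' → j ≢ j' → ∀ i → i ∈ T j → i ∈ T j' → Empty

  ∑-disjoint≤ : ∀ {q} (T : Fin q → Subset (e G)) → Disjoint T → (g : E → ℕ) →
                ∑ (λ j → ∑ (λ i → ⟦ lookup (T j) i ⟧ * g i)) ≤ ∑ g
  ∑-disjoint≤ T disj g = begin
    ∑ (λ j → ∑ (λ i → ⟦ lookup (T j) i ⟧ * g i)) ≡⟨ ∑-swap _ ⟩
    ∑ (λ i → ∑ (λ j → ⟦ lookup (T j) i ⟧ * g i)) ≡⟨ ∑-cong (λ i → trans (∑-cong (λ j → *-comm ⟦ lookup (T j) i ⟧ (g i))) (∑-*ˡ (g i) _)) ⟩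
    ∑ (λ i → g i * ∑ (λ j → ⟦ lookup (T j) i ⟧)) ≤⟨ ∑-mono (λ i → *-monoʳ-≤ (g i) (disjoint-bits≤1 (λ j → lookup (T j) i)
                                                       (λ j j' j≢j' p q → disj j j' j≢j' i (lookup⇒∈ p) (lookup⇒∈ q)))) ⟩
    ∑ (λ i → g i * 1)                            ≡⟨ ∑-cong (λ i → *-identityʳ (g i)) ⟩
    ∑ g ∎
    where open ≤-Reasoning

-- Parity subgraphs of a union of connected subgraphs

module Union (G : Graph) {k : ℕ} .{{k≢0 : NonZero k}} (T : Fin k → Subset (e G)) (conn : ∀ j → Connected G (T j)) where
  private
    V = Fin (n G)
    E = Fin (e G)

  Used : E → Set
  Used i = ∃ λ j → i ∈ T j

  Used? : ∀ i → Dec (Used i)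
  Used? i = any? (λ j → i ∈? T j)

  Joins : E → V → V → Set
  Joins i u w = (fst G i ≡ u × snd G i ≡ w) ⊎ (fst G i ≡ w × snd G i ≡ u)

  R : V → V → Set
  R u w = ∃ λ i → Used i × Joins i u w

  R? : ∀ u w → Dec (R u w)
  R? u w = any? (λ i → Used? i ×-dec (((fst G i ≟ u) ×-dec (snd G i ≟ w)) ⊎-dec ((fst G i ≟ w) ×-dec (snd G i ≟ u))))

  R-sym : ∀ {u w} → R u w → R w u
  R-sym (i , used , inj₁ p) = i , used , inj₂ p
  R-sym (i , used , inj₂ p) = i , used , inj₁ p

  open Factor R

  ParityFactor : (V → ℕ) → Subset (e G) → Set
  ParityFactor f F = (∀ i → i ∈ F → Used i) × (∀ v → deg G F v ≤ f v × deg G F v % 2 ≡ f v % 2)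

  ParityFactor? : ∀ f F → Dec (ParityFactor f F)
  ParityFactor? f F = all? (λ i → (i ∈? F) →-dec Used? i) ×-dec all? (λ v → (deg G F v ≤? f v) ×-dec (deg G F v % 2 ≟ℕ f v % 2))

  -- Several parts of a derivation may use the same edge, so edges receive multiplicities; the uses
  -- of `lift` collect in the even surplus `c + c`.
  Good⇒multiplicities : ∀ {f} → Good f → ∃ λ (x : E → ℕ) → (∀ i → 1 ≤ x i → Used i) ×
                        (∀ v → ∃ λ c → f v ≡ ∑ (λ i → x i * inc G i v) + (c + c))
  Good⇒multiplicities none = (λ _ → 0) , (λ i ()) , λ v → 0 , sym (trans (+-identityʳ _) (∑-0 (λ _ → refl)))
  Good⇒multiplicities (edge {u} {w} (i , used , joins)) = δ i , used-only , λ v → 0 , sym (trans (+-identityʳ _) (trans (∑-δ i (λ i → inc G i v)) (ends-at v joins)))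
    where
    used-only : ∀ i' → 1 ≤ δ i i' → Used i'
    used-only i' p with δ-cases i i'
    ... | inj₁ (refl , _) = used
    ... | inj₂ (_ , q) with () ← ≤-trans p (≤-reflexive q)
    ends-at : ∀ v → Joins i u w → inc G i v ≡ δ u v + δ w v
    ends-at v (inj₁ (refl , refl)) = cong₂ _+_ (δ-sym v _) (δ-sym v _)
    ends-at v (inj₂ (refl , refl)) = trans (+-comm (δ v (fst G i)) _) (cong₂ _+_ (δ-sym v _) (δ-sym v _))
  Good⇒multiplicities (plus good good') with x , sx , dx ← Good⇒multiplicities good | y , sy , dy ← Good⇒multiplicities good' =
    (λ i → x i + y i) , supp , degs
    where
    supp : ∀ i → 1 ≤ x i + y i → Used i
    supp i p with x i in eq
    ... | zero  = sy i p
    ... | suc _ = sx i (subst (1 ≤_) (sym eq) (s≤s z≤n))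
    degs : ∀ v → ∃ λ c → _ ≡ ∑ (λ i → (x i + y i) * inc G i v) + (c + c)
    degs v with c , p ← dx v | d , q ← dy v = c + d ,
      trans (cong₂ _+_ p q) (trans (shuffle (∑ (λ i → x i * inc G i v)) (∑ (λ i → y i * inc G i v)) c d) (cong (_+ (c + d + (c + d)))
        (sym (trans (∑-cong (λ i → *-distribʳ-+ (inc G i v) (x i) (y i))) (∑-+ _ _)))))
      where
      shuffle : ∀ a b c d → a + (c + c) + (b + (d + d)) ≡ a + b + (c + d + (c + d))
      shuffle = solve-∀
  Good⇒multiplicities (lift good h) with x , sx , dx ← Good⇒multiplicities good = x , sx , degs
    where
    degs : ∀ v → ∃ λ c → _ ≡ ∑ (λ i → x i * inc G i v) + (c + c)
    degs v with c , p ← dx v | d , q ← h v = c + d , trans q (trans (cong (_+ (d + d)) p) (shuffle (∑ (λ i → x i * inc G i v)) c d))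
      where
      shuffle : ∀ a c d → a + (c + c) + (d + d) ≡ a + (c + d + (c + d))
      shuffle = solve-∀

  -- Copies of an edge are discarded in pairs. Every degree drops by an even number, so it stays
  -- below `f` with the same parity.
  Good⇒ParityFactor : ∀ {f} → Good f → ∃ (ParityFactor f)
  Good⇒ParityFactor {f} good with x , sx , dx ← Good⇒multiplicities good = F , used , bounds
    where
    F : Subset (e G)
    F = tabulate (λ i → isOdd (x i))
    F-bit : ∀ i → ⟦ lookup F i ⟧ ≡ x i % 2
    F-bit i = trans (cong ⟦_⟧ (lookup∘tabulate (λ i → isOdd (x i)) i)) (⟦isOdd⟧ (x i))
    used : ∀ i → i ∈ F → Used i
    used i i∈F = sx i (≤-trans (≤-reflexive (trans (sym (cong ⟦_⟧ (∈⇒lookup i∈F))) (F-bit i))) (m%n≤m (x i) 2))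
    halves : ∀ v → ℕ
    halves v = ∑ (λ i → x i / 2 * inc G i v)
    degs : ∀ v → ∑ (λ i → x i * inc G i v) ≡ deg G F v + (halves v + halves v)
    degs v = begin
      ∑ (λ i → x i * inc G i v)
        ≡⟨ ∑-cong (λ i → trans (cong (_* inc G i v) (half (x i))) (distrib (x i % 2) (x i / 2) (inc G i v))) ⟩
      ∑ (λ i → x i % 2 * inc G i v + (x i / 2 * inc G i v + x i / 2 * inc G i v))
        ≡⟨ trans (∑-+ _ _) (cong (∑ (λ i → x i % 2 * inc G i v) +_) (∑-+ _ _)) ⟩
      ∑ (λ i → x i % 2 * inc G i v) + (halves v + halves v)
        ≡⟨ cong (_+ (halves v + halves v)) (trans (deg≡ G F v) (∑-cong (λ i → cong (_* inc G i v) (F-bit i)))) ⟨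
      deg G F v + (halves v + halves v) ∎
      where
      open ≡-Reasoning
      distrib : ∀ a b c → (a + (b + b)) * c ≡ a * c + (b * c + b * c)
      distrib = solve-∀
    bounds : ∀ v → deg G F v ≤ f v × deg G F v % 2 ≡ f v % 2
    bounds v with c , p ← dx v = ≤-trans (m≤m+n _ _) (≤-reflexive (sym eq)) ,
      trans (sym (%2-+double (deg G F v) (halves v + c))) (cong (_% 2) (sym eq))
      where
      shuffle : ∀ a b c → a + (b + b) + (c + c) ≡ a + (b + c + (b + c))
      shuffle = solve-∀
      eq : f v ≡ deg G F v + (halves v + c + (halves v + c))
      eq = trans p (trans (cong (_+ (c + c)) (degs v)) (shuffle (deg G F v) (halves v) c))

  total-deg : V → ℕ
  total-deg v = ∑ (λ j → deg G (T j) v)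

  -- Contract each class of the colouring: a connected T j still joins the barrier vertices and the odd classes,
  -- and each of its remaining edges has an end in the barrier.
  module _ {N : ℕ} (f : V → ℕ) (c : V → Fin (suc N)) (val : Valid c) where
    open Image {n G} {n G + N}

    contract : V → Fin (n G + N)
    contract u with c u
    ... | zero  = u ↑ˡ N
    ... | suc j = n G ↑ʳ j

    contract-zero : ∀ u → c u ≡ zero → contract u ≡ u ↑ˡ N
    contract-zero u p with c u
    contract-zero u refl | zero = refl

    contract-suc : ∀ u j → c u ≡ suc j → contract u ≡ n G ↑ʳ j
    contract-suc u j p with c u
    contract-suc u j refl | suc j = refl

    barrier-size : ℕ
    barrier-size = ∑ (λ u → δ (c u) zero)

    barrier+odd≤image : barrier-size + odd f c ≤ image contract
    barrier+odd≤image = ≤-trans (+-mono-≤ (∑-mono barrier-hit) (∑-mono class-hit)) (≤-reflexive (sym (∑-↑ (n G) N _)))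
      where
      barrier-hit : ∀ u → δ (c u) zero ≤ hit contract (u ↑ˡ N)
      barrier-hit u with δ-cases (c u) zero
      ... | inj₁ (p , q) = ≤-reflexive (trans q (sym (hit-1 contract _ u (contract-zero u p))))
      ... | inj₂ (_ , q) = ≤-trans (≤-reflexive q) z≤n
      class-hit : ∀ j → cls f c (suc j) % 2 ≤ hit contract (n G ↑ʳ j)
      class-hit j with %2-cases (cls f c (suc j))
      ... | inj₁ p = ≤-trans (≤-reflexive p) z≤n
      ... | inj₂ p with u , q ← ∑-pos _ (≤-trans (≤-reflexive (sym p)) (m%n≤m (cls f c (suc j)) 2)) with δ-cases (c u) (suc j)
      ...   | inj₁ (r , _) = ≤-reflexive (trans p (sym (hit-1 contract _ u (contract-suc u j r))))
      ...   | inj₂ (_ , r) with () ← ≤-trans q (≤-reflexive (cong (_* f u) r))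

    crossing≤ : ∀ j → crossing G (T j) contract ≤ ∑ (λ v → δ (c v) zero * deg G (T j) v)
    crossing≤ j = ≤-trans (∑-mono pointwise) (≤-reflexive (sym (∑-deg G (T j) (λ v → δ (c v) zero))))
      where
      pointwise : ∀ i → ⟦ lookup (T j) i ⟧ * cross G contract i ≤ ⟦ lookup (T j) i ⟧ * (δ (c (fst G i)) zero + δ (c (snd G i)) zero)
      pointwise i with lookup (T j) i in i∈T
      ... | false = z≤n
      ... | true  = *-monoʳ-≤ 1 (bound (val (fst G i) (snd G i) (i , (j , lookup⇒∈ i∈T) , inj₁ (refl , refl))))
        where
        same : ∀ x y → c x ≡ c y → c x ≢ zero → contract x ≡ contract y
        same x y p x≢0 with c x in cx
        ... | zero  = ⊥-elim (x≢0 refl)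
        ... | suc t = sym (contract-suc y t (sym p))
        bound : _ → cross G contract i ≤ δ (c (fst G i)) zero + δ (c (snd G i)) zero
        bound (inj₁ p) = ≤-trans (⟦⟧≤1 (not ⌊ contract (fst G i) ≟ contract (snd G i) ⌋)) (≤-trans (≤-reflexive (sym (δ-≡ p))) (m≤m+n _ _))
        bound (inj₂ (inj₁ p)) = ≤-trans (⟦⟧≤1 (not ⌊ contract (fst G i) ≟ contract (snd G i) ⌋)) (≤-trans (≤-reflexive (sym (δ-≡ p))) (m≤n+m _ _))
        bound (inj₂ (inj₂ p)) = [ (λ (q , _) → bound (inj₁ q))
                                , (λ (q , _) → ≤-trans (≤-reflexive (cross-≡ G contract i (same (fst G i) (snd G i) p q))) z≤n) ]′
                                (δ-cases (c (fst G i)) zero)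

    -- The sum over `j` of the inequality for a single `T j`: barrier size plus number of odd
    -- classes is at most 1 plus the degree sum over the barrier. The `+ 1` of the hypothesis at
    -- each barrier vertex pays for the barrier size, which cancels.
    barrier+odd≤ : (∀ v → total-deg v ≤ k * (f v + 1)) → odd f c ≤ cls f c zero + 1
    barrier+odd≤ h = +-cancelˡ-≤ barrier-size _ _ (*-cancelˡ-≤ k (begin
      k * (barrier-size + odd f c)                    ≡⟨ ∑-const k _ ⟨
      ∑ {k} (λ _ → barrier-size + odd f c)            ≤⟨ ∑-mono (λ j → ≤-trans barrier+odd≤image (≤-trans (image≤crossing G (T j) (conn j) contract) (+-monoˡ-≤ 1 (crossing≤ j)))) ⟩
      ∑ (λ j → ∑ (λ v → δ (c v) zero * deg G (T j) v) + 1) ≡⟨ trans (∑-+ _ _) (cong₂ _+_ (trans (∑-swap _) (∑-cong (λ v → ∑-*ˡ (δ (c v) zero) _))) (∑-const k 1)) ⟩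
      ∑ (λ v → δ (c v) zero * total-deg v) + k * 1    ≤⟨ +-monoˡ-≤ (k * 1) (∑-mono (λ v → *-monoʳ-≤ (δ (c v) zero) (h v))) ⟩
      ∑ (λ v → δ (c v) zero * (k * (f v + 1))) + k * 1 ≡⟨ cong (_+ k * 1) (trans (∑-cong (λ v → shuffle (δ (c v) zero) k (f v))) (trans (∑-*ˡ k _) (cong (k *_) (∑-+ _ _)))) ⟩
      k * (cls f c zero + barrier-size) + k * 1       ≡⟨ collect k (cls f c zero) barrier-size ⟩
      k * (barrier-size + (cls f c zero + 1))         ∎))
      where
      open ≤-Reasoning
      shuffle : ∀ d k f → d * (k * (f + 1)) ≡ k * (d * f + d)
      shuffle = solve-∀
      collect : ∀ k a b → k * (a + b) + k * 1 ≡ k * (b + (a + 1))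
      collect = solve-∀

  feasible : ∀ f → ∑ f % 2 ≡ 0 → (∀ v → total-deg v ≤ k * (f v + 1)) → Feasible f
  feasible f even h c val = ≤1+∧≡%2⇒≤ (≤-trans (barrier+odd≤ f c val h) (≤-reflexive (+-comm _ 1))) (odd-parity f even c)

  opaque
    -- Being a parity factor is decidable and there are finitely many edge sets, so the double
    -- negation can be removed here.
    factor : ∀ f → Feasible f → ∃ (ParityFactor f)
    factor f feas = decidable-stable (anySubset? (ParityFactor? f)) λ none →
      parity-factor R R? R-sym f feas (none ∘ Good⇒ParityFactor)

  parity-subgraph : (p : V → ℕ) → ∑ p % 2 ≡ 0 → ∃ λ F → (∀ i → i ∈ F → Used i) ×
                    (∀ v → deg G F v ≤ ⌈ total-deg v / k ⌉ × deg G F v % 2 ≡ p v % 2)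
  parity-subgraph p even = F , used , λ v → ≤-trans (proj₁ (bounds v)) (f≤r v) , trans (proj₂ (bounds v)) (f≡p v)
    where
    r : V → ℕ
    r v = ⌈ total-deg v / k ⌉

    adjust : ∀ a b → ℕ
    adjust a b with a % 2 ≟ℕ b % 2
    ... | yes _ = a
    ... | no _  = a ∸ 1

    f : V → ℕ
    f v = adjust (r v) (p v)

    adjust≤ : ∀ a b → adjust a b ≤ a
    adjust≤ a b with a % 2 ≟ℕ b % 2
    ... | yes _ = ≤-refl
    ... | no _  = m∸n≤m a 1

    ≤adjust+1 : ∀ a b → a ≤ adjust a b + 1
    ≤adjust+1 a b with a % 2 ≟ℕ b % 2
    ... | yes _ = m≤m+n a 1
    ... | no _  = ≤-trans (m≤n+m∸n a 1) (≤-reflexive (+-comm 1 _))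

    adjust-parity : ∀ a b → (a ≡ 0 → b % 2 ≡ 0) → adjust a b % 2 ≡ b % 2
    adjust-parity a b h with a % 2 ≟ℕ b % 2
    ... | yes q = q
    adjust-parity zero b h | no ¬q = ⊥-elim (¬q (sym (h refl)))
    adjust-parity (suc a) b h | no ¬q with %2-cases a | %2-cases b
    ... | inj₁ x | inj₁ y = trans x (sym y)
    ... | inj₂ x | inj₂ y = trans x (sym y)
    ... | inj₁ x | inj₂ y = ⊥-elim (¬q (trans (suc-%2-0 a x) (sym y)))
    ... | inj₂ x | inj₁ y = ⊥-elim (¬q (trans (suc-%2-1 a x) (sym y)))

    f≤r : ∀ v → f v ≤ r v
    f≤r v = adjust≤ (r v) (p v)

    -- This excludes the one failure of `adjust`, where `a ∸ 1` is truncated at 0. If there is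
    -- another vertex, each of the `k` connected `T j` has an edge at `v` and the ceiling is
    -- positive; otherwise `p v` is the whole sum, which is even.
    isolated-even : ∀ v → r v ≡ 0 → p v % 2 ≡ 0
    isolated-even v r≡0 with any? (λ u → ¬? (v ≟ u))
    ... | no alone = trans (cong (_% 2) (trans (sym (∑-δ v p)) (∑-cong at))) even
      where
      at : ∀ u → δ v u * p u ≡ p u
      at u = trans (cong (_* p u) (δ-≡ (decidable-stable (v ≟ u) (λ v≢u → alone (u , v≢u))))) (*-identityˡ (p u))
    ... | yes (u , v≢u) = ⊥-elim (1+n≰n (begin
      1                              ≤⟨ >-nonZero⁻¹ k ⟩
      k                              ≡⟨ *-identityʳ k ⟨
      k * 1                          ≡⟨ ∑-const k 1 ⟨
      ∑ {k} (λ _ → 1)                ≤⟨ ∑-mono (λ j → Reach-deg G (conn j v u) v≢u) ⟩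
      total-deg v                    ≤⟨ ceil-≥ (total-deg v) k ⟩
      k * r v                        ≡⟨ trans (cong (k *_) r≡0) (*-zeroʳ k) ⟩
      0                              ∎))
      where open ≤-Reasoning

    f≡p : ∀ v → f v % 2 ≡ p v % 2
    f≡p v = adjust-parity (r v) (p v) (isolated-even v)

    f-even : ∑ f % 2 ≡ 0
    f-even = trans (sym (∑-%2 f)) (trans (cong (_% 2) (∑-cong f≡p)) (trans (∑-%2 p) even))

    found : ∃ (ParityFactor f)
    found = factor f (feasible f f-even λ v → ≤-trans (ceil-≥ (total-deg v) k) (*-monoʳ-≤ k (≤adjust+1 (r v) (p v))))

    F = proj₁ found
    used = proj₁ (proj₂ found)
    bounds = proj₂ (proj₂ found)

-- Removing a parity subgraph

module _ (G : Graph) (Q : Subset (n G)) (Q-even : Even ∣ Q ∣) where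

  -- `S` survives because `F` lies in the union of the `T j`. The deleted degree is returned as a
  -- number `d` with an additive equation, in the form that both degree bounds of the theorem use.
  remove-parity-subgraph : ∀ {k m} .{{_ : NonZero k}} (T : Fin k → Subset (e G)) → (∀ j → Connected G (T j)) →
    (S : Fin m → Subset (e G)) → (∀ j → Connected G (S j)) → (∀ j → Acyclic G (S j)) → Disjoint G S →
    (∀ j j' i → i ∈ T j → i ∈ S j' → Empty) →
    ∃ λ H → TreeConnected G H m ×
      (∀ v → ∃ λ d → deg G H v + d ≡ deg G ⊤ v × d ≤ deg G ⊤ v × d ≤ ⌈ ∑ (λ j → deg G (T j) v) / k ⌉) ×
      (∀ v → Odd (deg G H v) ⇔ v ∈ Q)
  remove-parity-subgraph {k} T T-conn S S-conn S-acyclic S-disjoint apart =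
    ∁ F , (S , (λ j → S⊆∁F j , S-conn j , S-acyclic j) , S-disjoint)
    , (λ v → deg G F v , deg-∁ G F v , ≤-trans (m≤n+m _ _) (≤-reflexive (deg-∁ G F v)) , proj₁ (bounds v))
    , λ v → mk⇔ (to v) (from v)
    where
    open Union G T T-conn
    p : Fin (n G) → ℕ
    -- The complement of `F` has the parities prescribed by `Q` exactly when `F` has these. Their
    -- total is even by the handshake lemma and `Q-even`.
    p v = deg G ⊤ v + ⟦ lookup Q v ⟧
    p-even : ∑ p % 2 ≡ 0
    p-even = trans (cong (_% 2) (∑-+ _ _))
      (%2-cong-+ (∑ (deg G ⊤)) (∑ (λ v → ⟦ lookup Q v ⟧)) 0 0 (∑-deg-⊤-even G) (trans (cong (_% 2) (sym (∣∣≡∑ Q))) Q-even))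
    found = parity-subgraph p p-even
    F = proj₁ found
    bounds = proj₂ (proj₂ found)
    S⊆∁F : ∀ j → S j ⊆ ∁ F
    S⊆∁F j {i} i∈S = x∉p⇒x∈∁p λ i∈F → let j' , i∈T = proj₁ (proj₂ found) i i∈F in apart j' j i i∈T i∈S
    parity : ∀ v → deg G (∁ F) v % 2 ≡ ⟦ lookup Q v ⟧ % 2
    parity v = even+⇒≡ (deg G (∁ F) v) ⟦ lookup Q v ⟧ (begin
      (deg G (∁ F) v + ⟦ lookup Q v ⟧) % 2
        ≡⟨ %2-+double (deg G (∁ F) v + ⟦ lookup Q v ⟧) (deg G F v) ⟨
      (deg G (∁ F) v + ⟦ lookup Q v ⟧ + (deg G F v + deg G F v)) % 2
        ≡⟨ cong (_% 2) (trans (shuffle (deg G (∁ F) v) ⟦ lookup Q v ⟧ (deg G F v)) (cong (λ d → deg G F v + (d + ⟦ lookup Q v ⟧)) (deg-∁ G F v))) ⟩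
      (deg G F v + p v) % 2
        ≡⟨ ≡⇒even+ (deg G F v) (p v) (proj₂ (bounds v)) ⟩
      0 ∎)
      where
      open ≡-Reasoning
      shuffle : ∀ a b c → a + b + (c + c) ≡ c + (a + c + b)
      shuffle = solve-∀
    to : ∀ v → Odd (deg G (∁ F) v) → v ∈ Q
    to v odd = lookup⇒∈ (bit (lookup Q v) (trans (sym (parity v)) odd))
      where
      bit : ∀ b → ⟦ b ⟧ % 2 ≡ 1 → b ≡ true
      bit true _ = refl
    from : ∀ v → v ∈ Q → Odd (deg G (∁ F) v)
    from v v∈Q = trans (parity v) (cong (λ b → ⟦ b ⟧ % 2) (∈⇒lookup v∈Q))

-- Orientations of edge-connected graphs

⟨⟩-disjoint : ∀ {n} (f : Fin n → ℕ) X Y → (∀ v → v ∈ X → v ∈ Y → Empty) → f ⟨ X ∪ Y ⟩ ≡ f ⟨ X ⟩ + f ⟨ Y ⟩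
⟨⟩-disjoint f X Y disj = trans (cong (_+ f ⟨ X ∪ Y ⟩) (sym (∑-0 none))) (⟨⟩-∩∪ f X Y)
  where
  none : ∀ v → ⟦ lookup (X ∩ Y) v ⟧ * f v ≡ 0
  none v = cong (λ b → ⟦ b ⟧ * f v) (∉⇒lookup (λ v∈ → let p , q = x∈p∩q⁻ X Y v∈ in disj v p q))

-- The number of arcs that must enter `X` in Edmonds' condition. As a function of `X` it is modular,
-- which is used in uncrossing both for the in-degrees and for the arborescences.
rootless : ∀ {n} → Fin n → ℕ → Subset n → ℕ
rootless r l X = ⟦ not (lookup X r) ⟧ * l

rootless-modular : ∀ {n} (r : Fin n) l X Y → rootless r l X + rootless r l Y ≡ rootless r l (X ∩ Y) + rootless r l (X ∪ Y)
rootless-modular r l X Y rewrite lookup-∩ X Y r | lookup-∪ X Y r =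
  trans (sym (*-distribʳ-+ l ⟦ not (lookup X r) ⟧ _)) (trans (cong (_* l) (bits (lookup X r) (lookup Y r))) (*-distribʳ-+ l ⟦ not (lookup X r ∧ lookup Y r) ⟧ _))
  where
  bits : ∀ a b → ⟦ not a ⟧ + ⟦ not b ⟧ ≡ ⟦ not (a ∧ b) ⟧ + ⟦ not (a ∨ b) ⟧
  bits true  true  = refl
  bits true  false = refl
  bits false true  = refl
  bits false false = refl

module Cuts (G : Graph) (l : ℕ) (ec : EdgeConnected G (l + l)) (r : Fin (n G)) where
  private
    V = Fin (n G)
    E = Fin (e G)
    D = deg G ⊤

  inside : Subset (n G) → E → ℕ
  inside X i = ⟦ lookup X (fst G i) ∧ lookup X (snd G i) ⟧

  boundary : Subset (n G) → E → ℕ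
  boundary X i = ⟦ lookup X (fst G i) xor lookup X (snd G i) ⟧

  D⟨⟩ : ∀ X → D ⟨ X ⟩ ≡ ∑ (inside X) + ∑ (inside X) + ∑ (boundary X)
  D⟨⟩ X = begin
    D ⟨ X ⟩
      ≡⟨ ∑-deg G ⊤ (λ v → ⟦ lookup X v ⟧) ⟩
    ∑ (λ i → ⟦ lookup ⊤ i ⟧ * (⟦ lookup X (fst G i) ⟧ + ⟦ lookup X (snd G i) ⟧))
      ≡⟨ ∑-cong (λ i → trans (cong (λ b → ⟦ b ⟧ * (⟦ lookup X (fst G i) ⟧ + ⟦ lookup X (snd G i) ⟧)) (∈⇒lookup (∈⊤ {x = i})))
                       (bits (lookup X (fst G i)) (lookup X (snd G i)))) ⟩
    ∑ (λ i → inside X i + inside X i + boundary X i)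
      ≡⟨ trans (∑-+ _ _) (cong (_+ ∑ (boundary X)) (∑-+ _ _)) ⟩
    ∑ (inside X) + ∑ (inside X) + ∑ (boundary X) ∎
    where
    open ≡-Reasoning
    bits : ∀ a b → 1 * (⟦ a ⟧ + ⟦ b ⟧) ≡ ⟦ a ∧ b ⟧ + ⟦ a ∧ b ⟧ + ⟦ a xor b ⟧
    bits true  true  = refl
    bits true  false = refl
    bits false true  = refl
    bits false false = refl

  -- If a smaller boundary is deleted, `G` stays connected, yet membership in `X` is constant along
  -- the surviving edges.
  boundary≥ : ∀ X v w → v ∈ X → w ∉ X → l + l ≤ ∑ (boundary X)
  boundary≥ X v w v∈X w∉X = ≮⇒≥ λ small →
    let conn = ec F (≤-<-trans (≤-reflexive size) small)
        same = Reach-constant G (lookup X) constant (conn v w)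
    in w∉X (lookup⇒∈ (trans (sym same) (∈⇒lookup v∈X)))
    where
    F : Subset (e G)
    F = tabulate (λ i → lookup X (fst G i) xor lookup X (snd G i))
    size : ∣ F ∣ ≡ ∑ (boundary X)
    size = trans (∣∣≡∑ F) (∑-cong (λ i → cong ⟦_⟧ (lookup∘tabulate (λ i → lookup X (fst G i) xor lookup X (snd G i)) i)))
    xor-false : ∀ a b → a xor b ≡ false → a ≡ b
    xor-false true  true  _ = refl
    xor-false false false _ = refl
    constant : ∀ i → i ∈ ∁ F → lookup X (fst G i) ≡ lookup X (snd G i)
    constant i i∈∁F = xor-false _ _ (trans (sym (lookup∘tabulate (λ i → lookup X (fst G i) xor lookup X (snd G i)) i))
      (∉⇒lookup (x∈∁p⇒x∉p i∈∁F)))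

  -- In any orientation the in-degrees over `X` add up to the edges inside `X` plus the arcs
  -- entering it. In-degrees of total at least `demand X` therefore force enough entering arcs.
  demand : Subset (n G) → ℕ
  demand X = ∑ (inside X) + rootless r l X

  inside-supermodular : ∀ X Y → ∑ (inside X) + ∑ (inside Y) ≤ ∑ (inside (X ∩ Y)) + ∑ (inside (X ∪ Y))
  inside-supermodular X Y = subst₂ _≤_ (∑-+ _ _) (∑-+ _ _) (∑-mono pointwise)
    where
    bits : ∀ a b c d → ⟦ a ∧ c ⟧ + ⟦ b ∧ d ⟧ ≤ ⟦ (a ∧ b) ∧ (c ∧ d) ⟧ + ⟦ (a ∨ b) ∧ (c ∨ d) ⟧
    bits true  true  true  true  = ≤-refl
    bits true  true  true  false = ≤-refl
    bits true  true  false true  = ≤-refl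
    bits true  true  false false = z≤n
    bits true  false true  d     = ≤-reflexive refl
    bits true  false false d     = z≤n
    bits false true  true  true  = ≤-refl
    bits false true  false true  = ≤-refl
    bits false true  c     false = z≤n
    bits false false c     d     = z≤n
    pointwise : ∀ i → inside X i + inside Y i ≤ inside (X ∩ Y) i + inside (X ∪ Y) i
    pointwise i rewrite lookup-∩ X Y (fst G i) | lookup-∩ X Y (snd G i) | lookup-∪ X Y (fst G i) | lookup-∪ X Y (snd G i) =
      bits (lookup X (fst G i)) (lookup Y (fst G i)) (lookup X (snd G i)) (lookup Y (snd G i))

  demand-supermodular : ∀ X Y → demand X + demand Y ≤ demand (X ∩ Y) + demand (X ∪ Y)
  demand-supermodular X Y = begin
    demand X + demand Y
      ≡⟨ shuffle (∑ (inside X)) (rootless r l X) (∑ (inside Y)) (rootless r l Y) ⟩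
    ∑ (inside X) + ∑ (inside Y) + (rootless r l X + rootless r l Y)
      ≤⟨ +-mono-≤ (inside-supermodular X Y) (≤-reflexive (rootless-modular r l X Y)) ⟩
    ∑ (inside (X ∩ Y)) + ∑ (inside (X ∪ Y)) + (rootless r l (X ∩ Y) + rootless r l (X ∪ Y))
      ≡⟨ shuffle (∑ (inside (X ∩ Y))) (rootless r l (X ∩ Y)) (∑ (inside (X ∪ Y))) (rootless r l (X ∪ Y)) ⟨
    demand (X ∩ Y) + demand (X ∪ Y) ∎
    where
    open ≤-Reasoning
    shuffle : ∀ a b c d → a + b + (c + d) ≡ a + c + (b + d)
    shuffle = solve-∀

  -- Half the degrees would meet every demand: `D ⟨ X ⟩` counts inner edges twice and boundary edges
  -- once, and edge-connectivity gives `l + l` boundary edges when `X` avoids the root.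
  demand-half : ∀ X v → v ∈ X → demand X + demand X ≤ D ⟨ X ⟩
  demand-half X v v∈X = begin
    demand X + demand X
      ≡⟨ shuffle (∑ (inside X)) (rootless r l X) ⟩
    ∑ (inside X) + ∑ (inside X) + (rootless r l X + rootless r l X)
      ≤⟨ +-monoʳ-≤ (∑ (inside X) + ∑ (inside X)) bound ⟩
    ∑ (inside X) + ∑ (inside X) + ∑ (boundary X)
      ≡⟨ D⟨⟩ X ⟨
    D ⟨ X ⟩ ∎
    where
    open ≤-Reasoning
    shuffle : ∀ a b → a + b + (a + b) ≡ a + a + (b + b)
    shuffle = solve-∀
    bound : rootless r l X + rootless r l X ≤ ∑ (boundary X)
    bound with r ∈? X
    ... | yes r∈X rewrite ∈⇒lookup r∈X = z≤n
    ... | no r∉X rewrite ∉⇒lookup r∉X | +-identityʳ l = boundary≥ X v r v∈X r∉X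

  -- Restricted to nonempty `X`: the demand of the empty set is `l`, while its in-degree sum is 0.
  Meets : (V → ℕ) → Set
  Meets m = ∀ X v → v ∈ X → demand X ≤ m ⟨ X ⟩

  D-Meets : Meets D
  D-Meets X v v∈X = ≤-trans (m≤m+n _ _) (demand-half X v v∈X)

  module _ {m : V → ℕ} (meets : Meets m) where

    Saturated : Subset (n G) → Set
    Saturated X = m ⟨ X ⟩ ≤ demand X

    -- Uncrossing as in Hall's theorem, but for intersecting sets, because `meets` is applied to the
    -- intersection.
    Saturated-∪ : ∀ X Y v → v ∈ X ∩ Y → Saturated X → Saturated Y → Saturated (X ∪ Y)
    Saturated-∪ X Y v v∈ sX sY = +-cancelˡ-≤ (demand (X ∩ Y)) _ _ (begin
      demand (X ∩ Y) + m ⟨ X ∪ Y ⟩       ≤⟨ +-monoˡ-≤ _ (meets (X ∩ Y) v v∈) ⟩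
      m ⟨ X ∩ Y ⟩ + m ⟨ X ∪ Y ⟩          ≡⟨ ⟨⟩-∩∪ m X Y ⟩
      m ⟨ X ⟩ + m ⟨ Y ⟩                  ≤⟨ +-mono-≤ sX sY ⟩
      demand X + demand Y                ≤⟨ demand-supermodular X Y ⟩
      demand (X ∩ Y) + demand (X ∪ Y)    ∎)
      where open ≤-Reasoning

    -- Saturated sets that do not meet need not have a saturated union, so a disjoint family of them
    -- is kept instead.
    data Packed : Subset (n G) → Set where
      empty : Packed ⊥
      add   : ∀ {Z X v} → Packed Z → Saturated X → v ∈ X → (∀ u → u ∈ Z → u ∈ X → Empty) → Packed (Z ∪ X)

    -- If `X` meets the last member `Y`, then `Y ∪ X` is saturated and is inserted into the rest;
    -- otherwise `X` is inserted first and `Y` put back. The inclusion `Z' ⊆ Z ∪ X` ensures that `Y`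
    -- is still disjoint from the rest.
    absorb : ∀ {Z} → Packed Z → ∀ X v → v ∈ X → Saturated X → ∃ λ Z' → Packed Z' × Z ∪ X ⊆ Z' × Z' ⊆ Z ∪ X
    absorb empty X v v∈X sX = ⊥ ∪ X , add empty sX v∈X (λ u u∈⊥ _ → ∉⊥ u∈⊥) , id , id
    absorb (add {Z} {Y} {y} pZ sY y∈Y disj) X v v∈X sX with nonempty? (Y ∩ X)
    ... | yes (u , u∈) with Z' , pZ' , ⊆Z' , Z'⊆ ← absorb pZ (Y ∪ X) v (x∈p∪q⁺ (inj₂ v∈X)) (Saturated-∪ Y X u u∈ sY sX) =
      Z' , pZ' , (λ {x} → subst (λ W → x ∈ W → x ∈ Z') assoc ⊆Z') , (λ {x} → subst (λ W → x ∈ Z' → x ∈ W) assoc Z'⊆)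
      where
      assoc : Z ∪ (Y ∪ X) ≡ (Z ∪ Y) ∪ X
      assoc = sym (∪-assoc Z Y X)
    ... | no disjoint with Z' , pZ' , ⊆Z' , Z'⊆ ← absorb pZ X v v∈X sX =
      Z' ∪ Y , add pZ' sY y∈Y apart , forth , back
      where
      apart : ∀ u → u ∈ Z' → u ∈ Y → Empty
      apart u u∈Z' u∈Y with x∈p∪q⁻ Z X (Z'⊆ u∈Z')
      ... | inj₁ u∈Z = disj u u∈Z u∈Y
      ... | inj₂ u∈X = disjoint (u , x∈p∩q⁺ (u∈Y , u∈X))
      forth : (Z ∪ Y) ∪ X ⊆ Z' ∪ Y
      forth u∈ with x∈p∪q⁻ (Z ∪ Y) X u∈
      ... | inj₂ u∈X = x∈p∪q⁺ (inj₁ (⊆Z' (x∈p∪q⁺ (inj₂ u∈X))))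
      ... | inj₁ u∈ZY with x∈p∪q⁻ Z Y u∈ZY
      ...   | inj₁ u∈Z = x∈p∪q⁺ (inj₁ (⊆Z' (x∈p∪q⁺ (inj₁ u∈Z))))
      ...   | inj₂ u∈Y = x∈p∪q⁺ (inj₂ u∈Y)
      back : Z' ∪ Y ⊆ (Z ∪ Y) ∪ X
      back u∈ with x∈p∪q⁻ Z' Y u∈
      ... | inj₂ u∈Y = x∈p∪q⁺ (inj₁ (x∈p∪q⁺ (inj₂ u∈Y)))
      ... | inj₁ u∈Z' with x∈p∪q⁻ Z X (Z'⊆ u∈Z')
      ...   | inj₁ u∈Z = x∈p∪q⁺ (inj₁ (x∈p∪q⁺ (inj₁ u∈Z)))
      ...   | inj₂ u∈X = x∈p∪q⁺ (inj₂ u∈X)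

    Packed-half : ∀ {Z} → Packed Z → m ⟨ Z ⟩ + m ⟨ Z ⟩ ≤ D ⟨ Z ⟩
    Packed-half empty = ≤-trans (≤-reflexive (cong₂ _+_ (⟨⊥⟩ m) (⟨⊥⟩ m))) z≤n
    Packed-half (add {Z} {X} {v} pZ sX v∈X disj) = begin
      m ⟨ Z ∪ X ⟩ + m ⟨ Z ∪ X ⟩            ≡⟨ cong (λ x → x + x) (⟨⟩-disjoint m Z X disj) ⟩
      m ⟨ Z ⟩ + m ⟨ X ⟩ + (m ⟨ Z ⟩ + m ⟨ X ⟩) ≡⟨ shuffle (m ⟨ Z ⟩) (m ⟨ X ⟩) ⟩
      m ⟨ Z ⟩ + m ⟨ Z ⟩ + (m ⟨ X ⟩ + m ⟨ X ⟩) ≤⟨ +-mono-≤ (Packed-half pZ) (≤-trans (+-mono-≤ sX sX) (demand-half X v v∈X)) ⟩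
      D ⟨ Z ⟩ + D ⟨ X ⟩                    ≡⟨ ⟨⟩-disjoint D Z X disj ⟨
      D ⟨ Z ∪ X ⟩ ∎
      where
      open ≤-Reasoning
      shuffle : ∀ a b → a + b + (a + b) ≡ a + a + (b + b)
      shuffle = solve-∀

  ∑D : ∑ D ≡ e G + e G
  ∑D = trans (sym (⟨⊤⟩ D)) (trans (D⟨⟩ ⊤) (trans (cong₂ (λ x y → x + x + y) (trans (∑-cong (λ i → cong ⟦_⟧ (bits i))) (trans (∑-const (e G) 1) (*-identityʳ (e G)))) (∑-0 none)) (+-identityʳ _)))
    where
    full : ∀ v → lookup (⊤ {n G}) v ≡ true
    full v = ∈⇒lookup (∈⊤ {x = v})
    bits : ∀ i → lookup (⊤ {n G}) (fst G i) ∧ lookup (⊤ {n G}) (snd G i) ≡ true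
    bits i = cong₂ _∧_ (full (fst G i)) (full (snd G i))
    none : ∀ i → boundary ⊤ i ≡ 0
    none i = cong ⟦_⟧ (cong₂ _xor_ (full (fst G i)) (full (snd G i)))

  -- That is, `m v` is at least half of `D v` rounded down, which leaves an out-degree of at most
  -- half of `D v` rounded up.
  Large : (V → ℕ) → Set
  Large m = ∀ v → D v ≤ m v + m v + 1

  Coverable : (V → ℕ) → V → Set
  Coverable m v = ∃ λ X → v ∈ X × m ⟨ X ⟩ ≤ demand X

  Coverable? : ∀ m v → Dec (Coverable m v)
  Coverable? m v = anySubset? (λ X → (v ∈? X) ×-dec (m ⟨ X ⟩ ≤? demand X))

  module _ {m : V → ℕ} (meets : Meets m) (large : Large m) where

    decrease : ∀ v → D v < m v + m v → ¬ Coverable m v → ∃ λ m' → Meets m' × Large m' × ∑ m' < ∑ m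
    decrease v D<2m loose = m' , meets' , large' , smaller
      where
      open ≤-Reasoning
      mv>0 : ∀ x → D v < x + x → 1 ≤ x
      mv>0 (suc x) _ = s≤s z≤n
      lower = minus-δ m v (mv>0 (m v) D<2m)
      m' = proj₁ lower
      m-δ = proj₂ lower
      smaller : ∑ m' < ∑ m
      smaller = ≤-reflexive (sym (trans (∑-cong m-δ) (trans (∑-+ _ _) (cong (_+ ∑ m') (∑-δ1 v)))))
      m⟨⟩ : ∀ X → m ⟨ X ⟩ ≡ ⟦ lookup X v ⟧ + m' ⟨ X ⟩
      m⟨⟩ X = trans (⟨⟩-cong X m-δ) (trans (⟨⟩-+ (δ v) m' X) (cong (_+ m' ⟨ X ⟩) (⟨⟩-δ v X)))
      meets-at : ∀ X u → u ∈ X → Dec (v ∈ X) → demand X ≤ m' ⟨ X ⟩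
      meets-at X u u∈X (yes v∈X) = ≤-pred (begin
        suc (demand X)                 ≤⟨ ≰⇒> (λ t → loose (X , v∈X , t)) ⟩
        m ⟨ X ⟩                        ≡⟨ m⟨⟩ X ⟩
        ⟦ lookup X v ⟧ + m' ⟨ X ⟩      ≡⟨ cong (λ b → ⟦ b ⟧ + m' ⟨ X ⟩) (∈⇒lookup v∈X) ⟩
        suc (m' ⟨ X ⟩)                 ∎)
      meets-at X u u∈X (no v∉X) =
        ≤-trans (meets X u u∈X) (≤-reflexive (trans (m⟨⟩ X) (cong (λ b → ⟦ b ⟧ + m' ⟨ X ⟩) (∉⇒lookup v∉X))))
      meets' : Meets m'
      meets' X u u∈X = meets-at X u u∈X (v ∈? X)
      large' : Large m'
      large' u with δ-cases v u
      ... | inj₁ (refl , q) = ≤-pred (≤-trans D<2m (≤-reflexive (trans (cong (λ x → x + x) (trans (m-δ u) (cong (_+ m' u) q))) (shuffle (m' u)))))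
        where
        shuffle : ∀ x → 1 + x + (1 + x) ≡ 1 + (x + x + 1)
        shuffle = solve-∀
      ... | inj₂ (_ , q) = ≤-trans (large u) (≤-reflexive (cong (λ x → x + x + 1) (trans (m-δ u) (cong (_+ m' u) q))))

    Packed-total : ∀ {Z} → Packed meets Z → (∀ v → v ∉ Z → m v + m v ≤ D v) → ∑ m ≤ e G
    Packed-total {Z} pZ off-Z = *-cancelˡ-≤ 2 (begin
      2 * ∑ m                                        ≡⟨ cong (2 *_) (split m) ⟨
      2 * (m ⟨ Z ⟩ + m ⟨ ∁ Z ⟩)                      ≡⟨ shuffle (m ⟨ Z ⟩) (m ⟨ ∁ Z ⟩) ⟩
      m ⟨ Z ⟩ + m ⟨ Z ⟩ + (m ⟨ ∁ Z ⟩ + m ⟨ ∁ Z ⟩)    ≤⟨ +-mono-≤ (Packed-half meets pZ) (≤-trans (≤-reflexive (sym (∑-+ _ _))) (∑-mono pointwise)) ⟩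
      D ⟨ Z ⟩ + D ⟨ ∁ Z ⟩                            ≡⟨ split D ⟩
      ∑ D                                            ≡⟨ trans ∑D (cong (e G +_) (sym (+-identityʳ (e G)))) ⟩
      2 * e G                                        ∎)
      where
      open ≤-Reasoning
      shuffle : ∀ a b → 2 * (a + b) ≡ a + a + (b + b)
      shuffle = solve-∀
      split : ∀ (f : V → ℕ) → f ⟨ Z ⟩ + f ⟨ ∁ Z ⟩ ≡ ∑ f
      split f = trans (sym (⟨⟩-disjoint f Z (∁ Z) (λ v p q → x∈∁p⇒x∉p q p))) (trans (cong (f ⟨_⟩) (p∪∁p≡⊤ Z)) (⟨⊤⟩ f))
      scale : ∀ b x y → (b ≡ true → x + x ≤ y) → ⟦ b ⟧ * x + ⟦ b ⟧ * x ≤ ⟦ b ⟧ * y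
      scale true  x y h = subst₂ _≤_ (sym (cong₂ _+_ (*-identityˡ x) (*-identityˡ x))) (sym (*-identityˡ y)) (h refl)
      scale false x y h = z≤n
      pointwise : ∀ v → ⟦ lookup (∁ Z) v ⟧ * m v + ⟦ lookup (∁ Z) v ⟧ * m v ≤ ⟦ lookup (∁ Z) v ⟧ * D v
      pointwise v = scale (lookup (∁ Z) v) (m v) (D v) (λ p → off-Z v (x∈∁p⇒x∉p (lookup⇒∈ p)))

    Meets-total : e G ≤ ∑ m
    Meets-total = begin
      e G                     ≡⟨ trans (∑-const (e G) 1) (*-identityʳ (e G)) ⟨
      ∑ {e G} (λ _ → 1)       ≡⟨ ∑-cong (λ i → cong₂ (λ a b → ⟦ a ∧ b ⟧) (∈⇒lookup (∈⊤ {x = fst G i})) (∈⇒lookup (∈⊤ {x = snd G i}))) ⟨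
      ∑ (inside ⊤)            ≤⟨ m≤m+n _ _ ⟩
      demand ⊤                ≤⟨ meets ⊤ r ∈⊤ ⟩
      m ⟨ ⊤ ⟩                 ≡⟨ ⟨⊤⟩ m ⟩
      ∑ m                     ∎
      where open ≤-Reasoning

    -- An orientation has exactly one head per edge, so the total must be `e G`. Disjoint saturated
    -- sets cover all vertices with `m v` above half the degree. On the cover `m` is at most half
    -- the degree sum, elsewhere it is so pointwise; the demand of the full vertex set gives the
    -- converse.
    minimal-total : (∀ v → D v < m v + m v → Coverable m v) → ∑ m ≡ e G
    minimal-total covered = ≤-antisym (conclude packing) Meets-total
      where
      Excess : V → Set
      Excess v = D v < m v + m v
      Excess? : ∀ v → Dec (Excess v)
      Excess? v = D v <? m v + m v
      excess : Subset (n G)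
      excess = subset Excess?
      packing : ∃ λ Z → Packed meets Z × excess ⊆ Z
      packing = cover (Packed meets) excess empty λ Z v pZ v∈ →
        let X , v∈X , sX = covered v (subset-elim Excess? v∈)
            Z' , pZ' , ⊆Z' , _ = absorb meets pZ X v v∈X sX
        in Z' , pZ' , (λ z → ⊆Z' (x∈p∪q⁺ (inj₁ z))) , ⊆Z' (x∈p∪q⁺ (inj₂ v∈X))
      conclude : (∃ λ Z → Packed meets Z × excess ⊆ Z) → ∑ m ≤ e G
      conclude (Z , pZ , excess⊆Z) = Packed-total pZ (λ v v∉Z → ≮⇒≥ (λ D<2m → v∉Z (excess⊆Z (subset-intro Excess? D<2m))))

  opaque
    -- The in-degrees of the orientation to be constructed: a minimal vector meeting the demands.
    indegrees : ∃ λ (m : V → ℕ) → Meets m × Large m × ∑ m ≡ e G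
    indegrees = descend (suc (∑ D)) D ≤-refl D-Meets (λ v → ≤-trans (m≤m+n (D v) (D v)) (m≤m+n _ 1))
      where
      descend : ∀ B m → ∑ m < B → Meets m → Large m → ∃ λ (m : V → ℕ) → Meets m × Large m × ∑ m ≡ e G
      descend (suc B) m lt meets large = choose (any? (λ v → (D v <? m v + m v) ×-dec ¬? (Coverable? m v)))
        where
        choose : Dec (∃ λ v → D v < m v + m v × ¬ Coverable m v) → ∃ λ (m : V → ℕ) → Meets m × Large m × ∑ m ≡ e G
        choose (yes (v , D<2m , loose)) = let m' , meets' , large' , smaller = decrease meets large v D<2m loose in
          descend B m' (<-≤-trans smaller (≤-pred lt)) meets' large'
        choose (no none) = m , meets , large ,
          minimal-total meets large (λ v D<2m → decidable-stable (Coverable? m v) (λ ¬p → none (v , D<2m , ¬p)))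

  m = proj₁ indegrees
  m-meets = proj₁ (proj₂ indegrees)
  D≤2m+1 = proj₁ (proj₂ (proj₂ indegrees))
  ∑m = proj₂ (proj₂ (proj₂ indegrees))

  EndsOf : E → Subset (n G)
  EndsOf i = ⁅ fst G i ⁆ ∪ ⁅ snd G i ⁆

  opaque
    -- Each edge picks one of its ends as head. An edge is confined to `X` just when it lies inside,
    -- so Hall's condition follows from `Meets`; the empty set is treated apart, as no edge is
    -- confined to it.
    assignment : ∃ λ (y : E → V → ℕ) → (∀ i → Served (EndsOf i) true (y i)) × (∀ v → ∑ (λ i → y i v) ≡ m v)
    assignment = hall (e G) EndsOf (λ _ → true) m confined≤ (trans (trans (∑-const (e G) 1) (*-identityʳ (e G))) (sym ∑m))
      where
      within≤inside : ∀ X i → 1 * within (EndsOf i) X ≤ inside X i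
      within≤inside X i with within-cases (EndsOf i) X
      ... | inj₂ q = ≤-trans (≤-reflexive (trans (*-identityˡ _) q)) z≤n
      ... | inj₁ (p , q) = ≤-reflexive (trans (trans (*-identityˡ _) q) (sym (cong₂ (λ a b → ⟦ a ∧ b ⟧)
        (∈⇒lookup (p (x∈p∪q⁺ (inj₁ (x∈⁅x⁆ (fst G i)))))) (∈⇒lookup (p (x∈p∪q⁺ (inj₂ (x∈⁅x⁆ (snd G i)))))))))
      confined≤ : ∀ X → confined EndsOf (λ _ → true) X ≤ m ⟨ X ⟩
      confined≤ X with nonempty? X
      ... | yes (v , v∈X) = ≤-trans (∑-mono (within≤inside X)) (≤-trans (m≤m+n _ _) (m-meets X v v∈X))
      ... | no none = ≤-trans (≤-reflexive (∑-0 (λ i → n≤0⇒n≡0 (≤-trans (within≤inside X i)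
        (≤-reflexive (cong (λ b → ⟦ b ∧ lookup X (snd G i) ⟧) (∉⇒lookup (λ p → none (_ , p)))))))))  z≤n

  record Oriented (i : E) : Set where
    constructor oriented
    field
      head tail : V
      ends-split : (head ≡ fst G i × tail ≡ snd G i) ⊎ (head ≡ snd G i × tail ≡ fst G i)
      serves : ∀ u → proj₁ assignment i u ≡ δ head u

  orientation : ∀ i → Oriented i
  orientation i with proj₁ (proj₂ assignment) i
  ... | serve v v∈ eq with x∈p∪q⁻ ⁅ fst G i ⁆ ⁅ snd G i ⁆ v∈
  ...   | inj₁ p = oriented v (snd G i) (inj₁ (x∈⁅y⁆⇒x≡y _ p , refl)) eq
  ...   | inj₂ p = oriented v (fst G i) (inj₂ (x∈⁅y⁆⇒x≡y _ p , refl)) eq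

  hd tl : E → V
  hd i = Oriented.head (orientation i)
  tl i = Oriented.tail (orientation i)

  hd-tl : ∀ i → (hd i ≡ fst G i × tl i ≡ snd G i) ⊎ (hd i ≡ snd G i × tl i ≡ fst G i)
  hd-tl i = Oriented.ends-split (orientation i)

  ∑-hd : ∀ v → ∑ (λ i → δ (hd i) v) ≡ m v
  ∑-hd v = trans (∑-cong (λ i → sym (Oriented.serves (orientation i) v))) (proj₂ (proj₂ assignment) v)

  entering≥ : ∀ X v → v ∈ X → rootless r l X ≤ ∑ (λ i → ⟦ lookup X (hd i) ∧ not (lookup X (tl i)) ⟧)
  entering≥ X v v∈X = +-cancelˡ-≤ (∑ (inside X)) _ _ (begin
    demand X                                                     ≤⟨ m-meets X v v∈X ⟩
    m ⟨ X ⟩                                                      ≡⟨ ∑-cong (λ u → trans (cong (⟦ lookup X u ⟧ *_) (sym (∑-hd u))) (sym (∑-*ˡ ⟦ lookup X u ⟧ _))) ⟩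
    ∑ (λ u → ∑ (λ i → ⟦ lookup X u ⟧ * δ (hd i) u))              ≡⟨ trans (∑-swap _) (∑-cong (λ i → ⟨⟩-δ (hd i) X)) ⟩
    ∑ (λ i → ⟦ lookup X (hd i) ⟧)                                ≡⟨ trans (∑-cong pointwise) (∑-+ _ _) ⟩
    ∑ (inside X) + ∑ (λ i → ⟦ lookup X (hd i) ∧ not (lookup X (tl i)) ⟧) ∎)
    where
    open ≤-Reasoning
    bits : ∀ a b → ⟦ a ⟧ ≡ ⟦ a ∧ b ⟧ + ⟦ a ∧ not b ⟧
    bits true  true  = refl
    bits true  false = refl
    bits false b     = refl
    bits' : ∀ a b → ⟦ a ⟧ ≡ ⟦ b ∧ a ⟧ + ⟦ a ∧ not b ⟧
    bits' true  true  = refl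
    bits' true  false = refl
    bits' false true  = refl
    bits' false false = refl
    pointwise : ∀ i → ⟦ lookup X (hd i) ⟧ ≡ inside X i + ⟦ lookup X (hd i) ∧ not (lookup X (tl i)) ⟧
    pointwise i with hd-tl i
    ... | inj₁ (p , q) = subst₂ (λ h t → ⟦ lookup X h ⟧ ≡ inside X i + ⟦ lookup X h ∧ not (lookup X t) ⟧) (sym p) (sym q) (bits (lookup X (fst G i)) (lookup X (snd G i)))
    ... | inj₂ (p , q) = subst₂ (λ h t → ⟦ lookup X h ⟧ ≡ inside X i + ⟦ lookup X h ∧ not (lookup X t) ⟧) (sym p) (sym q) (bits' (lookup X (snd G i)) (lookup X (fst G i)))

-- Edge-disjoint arborescences

Reach-trans : ∀ {G S u v w} → Reach G S u v → Reach G S v w → Reach G S u w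
Reach-trans p here          = p
Reach-trans p (fwd i i∈S q) = fwd i i∈S (Reach-trans p q)
Reach-trans p (bwd i i∈S q) = bwd i i∈S (Reach-trans p q)

Reach-sym : ∀ {G S u w} → Reach G S u w → Reach G S w u
Reach-sym here          = here
Reach-sym (fwd i i∈S q) = Reach-trans (bwd i i∈S here) (Reach-sym q)
Reach-sym (bwd i i∈S q) = Reach-trans (fwd i i∈S here) (Reach-sym q)

Reach-bind : ∀ {G S S' u w} → (∀ i → i ∈ S → Reach G S' (fst G i) (snd G i)) → Reach G S u w → Reach G S' u w
Reach-bind h here          = here
Reach-bind h (fwd i i∈S q) = Reach-trans (Reach-bind h q) (h i i∈S)
Reach-bind h (bwd i i∈S q) = Reach-trans (Reach-bind h q) (Reach-sym (h i i∈S))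

Reach-mono : ∀ {G S S' u w} → S ⊆ S' → Reach G S u w → Reach G S' u w
Reach-mono S⊆S' = Reach-bind (λ i i∈S → fwd i (S⊆S' i∈S) here)

module _ (G : Graph) where
  open Image {n G} {n G}

  Connected-size : ∀ S → Connected G S → n G ≤ ∣ S ∣ + 1
  Connected-size S conn = begin
    n G                       ≡⟨ trans (∑-const (n G) 1) (*-identityʳ (n G)) ⟨
    ∑ {n G} (λ _ → 1)         ≡⟨ ∑-cong (λ v → hit-1 id v v refl) ⟨
    image id                  ≤⟨ image≤crossing G S conn id ⟩
    crossing G S id + 1       ≤⟨ +-monoˡ-≤ 1 (∑-mono (λ i → ≤-trans (*-monoʳ-≤ ⟦ lookup S i ⟧ (⟦⟧≤1 (not ⌊ fst G i ≟ snd G i ⌋))) (≤-reflexive (*-identityʳ _)))) ⟩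
    ∑ (λ i → ⟦ lookup S i ⟧) + 1 ≡⟨ cong (_+ 1) (∣∣≡∑ S) ⟨
    ∣ S ∣ + 1                 ∎
    where open ≤-Reasoning

  -- An edge whose ends stay joined without it could be removed, leaving a connected subgraph with
  -- fewer than n - 1 edges.
  small-connected⇒Acyclic : ∀ S → Connected G S → ∣ S ∣ + 1 ≤ n G → Acyclic G S
  small-connected⇒Acyclic S conn small i i∈S path = <⇒≱ (x∈p⇒∣p-x∣<∣p∣ i∈S)
    (+-cancelʳ-≤ 1 _ _ (≤-trans small (Connected-size (S ∖ i) λ u w → Reach-bind reroute (conn u w))))
    where
    reroute : ∀ j → j ∈ S → Reach G (S ∖ i) (fst G j) (snd G j)
    reroute j j∈S with j ≟ i
    ... | yes refl = path
    ... | no j≢i   = fwd j (x∈p∧x≢y⇒x∈p-y j∈S j≢i) here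

minimal-subset : ∀ {n} {P : Subset n → Set} → (∀ X → Dec (P X)) → ∃ P → ∃ λ X → P X × (∀ Y → P Y → ∣ X ∣ ≤ ∣ Y ∣)
minimal-subset {n} {P} P? (X , pX) = below (suc ∣ X ∣) X pX ≤-refl
  where
  below : ∀ B X → P X → ∣ X ∣ < B → ∃ λ X → P X × (∀ Y → P Y → ∣ X ∣ ≤ ∣ Y ∣)
  below (suc B) X pX lt with anySubset? (λ Y → P? Y ×-dec (∣ Y ∣ <? ∣ X ∣))
  ... | yes (Y , pY , smaller) = below B Y pY (<-≤-trans smaller (≤-pred lt))
  ... | no none = X , pX , λ Y pY → ≮⇒≥ (λ smaller → none (Y , pY , smaller))

insert-bit : ∀ {n} (U : Subset n) {x} → x ∉ U → ∀ v → ⟦ lookup (U ∪ ⁅ x ⁆) v ⟧ ≡ ⟦ lookup U v ⟧ + δ x v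
insert-bit U {x} x∉U v with δ-cases x v
... | inj₁ (refl , q) rewrite ∈⇒lookup (x∈p∪q⁺ {p = U} {q = ⁅ x ⁆} (inj₂ (x∈⁅x⁆ x))) | ∉⇒lookup x∉U = sym q
... | inj₂ (x≢v , q) = trans (cong ⟦_⟧ (trans (lookup-∪ U ⁅ x ⁆ v) (trans (cong (lookup U v ∨_) (∉⇒lookup (λ v∈ → x≢v (sym (x∈⁅y⁆⇒x≡y x v∈))))) (∨-identityʳ (lookup U v)))))
  (sym (trans (cong (⟦ lookup U v ⟧ +_) q) (+-identityʳ _)))

module Arborescences (G : Graph) (r : Fin (n G)) (hd tl : Fin (e G) → Fin (n G))
  (hd-tl : ∀ i → (hd i ≡ fst G i × tl i ≡ snd G i) ⊎ (hd i ≡ snd G i × tl i ≡ fst G i)) where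
  private
    V = Fin (n G)
    E = Fin (e G)

  along : ∀ {S i u} → i ∈ S → Reach G S u (tl i) → Reach G S u (hd i)
  along {S} {i} {u} i∈S q with hd-tl i
  ... | inj₁ (h , t) = subst (Reach G S u) (sym h) (bwd i i∈S (subst (Reach G S u) t q))
  ... | inj₂ (h , t) = subst (Reach G S u) (sym h) (fwd i i∈S (subst (Reach G S u) t q))

  enters : Subset (n G) → E → Bool
  enters X i = lookup X (hd i) ∧ not (lookup X (tl i))

  ρ : Subset (e G) → Subset (n G) → ℕ
  ρ D X = ∑ (λ i → ⟦ lookup D i ⟧ * ⟦ enters X i ⟧)

  Rooted : ℕ → Subset (e G) → Set
  Rooted l D = ∀ X v → v ∈ X → rootless r l X ≤ ρ D X

  indeg : Subset (e G) → V → ℕ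
  indeg A v = ∑ (λ i → ⟦ lookup A i ⟧ * δ (hd i) v)

  ρ-submodular : ∀ D X Y → ρ D (X ∩ Y) + ρ D (X ∪ Y) ≤ ρ D X + ρ D Y
  ρ-submodular D X Y = subst₂ _≤_ (∑-+ _ _) (∑-+ _ _) (∑-mono pointwise)
    where
    bits : ∀ a b c d → ⟦ (a ∧ b) ∧ not (c ∧ d) ⟧ + ⟦ (a ∨ b) ∧ not (c ∨ d) ⟧ ≤ ⟦ a ∧ not c ⟧ + ⟦ b ∧ not d ⟧
    bits true  true  true  true  = z≤n
    bits true  true  true  false = ≤-refl
    bits true  true  false true  = ≤-refl
    bits true  true  false false = ≤-refl
    bits true  false true  d     = z≤n
    bits true  false false true  = z≤n
    bits true  false false false = ≤-refl
    bits false true  true  d     = z≤n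
    bits false true  false true  = z≤n
    bits false true  false false = ≤-refl
    bits false false c     d     = z≤n
    pointwise : ∀ i → ⟦ lookup D i ⟧ * ⟦ enters (X ∩ Y) i ⟧ + ⟦ lookup D i ⟧ * ⟦ enters (X ∪ Y) i ⟧ ≤ ⟦ lookup D i ⟧ * ⟦ enters X i ⟧ + ⟦ lookup D i ⟧ * ⟦ enters Y i ⟧
    pointwise i rewrite lookup-∩ X Y (hd i) | lookup-∩ X Y (tl i) | lookup-∪ X Y (hd i) | lookup-∪ X Y (tl i) =
      subst₂ _≤_ (*-distribˡ-+ ⟦ lookup D i ⟧ _ _) (*-distribˡ-+ ⟦ lookup D i ⟧ _ _)
        (*-monoʳ-≤ ⟦ lookup D i ⟧ (bits (lookup X (hd i)) (lookup Y (hd i)) (lookup X (tl i)) (lookup Y (tl i))))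

  ρ≤⇒arc : ∀ D X Y → ρ D X < ρ D Y → ∃ λ i → i ∈ D × enters Y i ≡ true × enters X i ≡ false
  ρ≤⇒arc D X Y lt with any? (λ i → (i ∈? D) ×-dec ((enters Y i ≟ᵇ true) ×-dec (enters X i ≟ᵇ false)))
  ... | yes found = found
  ... | no none = ⊥-elim (<⇒≱ lt (∑-mono pointwise))
    where
    pointwise : ∀ i → ⟦ lookup D i ⟧ * ⟦ enters Y i ⟧ ≤ ⟦ lookup D i ⟧ * ⟦ enters X i ⟧
    pointwise i with lookup D i in d | enters Y i in y | enters X i in x
    ... | false | _     | _     = z≤n
    ... | true  | false | _     = z≤n
    ... | true  | true  | true  = ≤-refl
    ... | true  | true  | false = ⊥-elim (none (i , lookup⇒∈ d , y , x))

  enters⇒ : ∀ X i → enters X i ≡ true → hd i ∈ X × tl i ∉ X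
  enters⇒ X i eq = ∧-elim (lookup X (hd i)) (lookup X (tl i)) refl refl eq
    where
    ∧-elim : ∀ a b → lookup X (hd i) ≡ a → lookup X (tl i) ≡ b → a ∧ not b ≡ true → hd i ∈ X × tl i ∉ X
    ∧-elim true false p q _ = lookup⇒∈ p , λ t∈ → contradiction (trans (sym (∈⇒lookup t∈)) q) λ ()

  ⇒enters : ∀ X i → hd i ∈ X → tl i ∉ X → enters X i ≡ true
  ⇒enters X i h∈ t∉ = cong₂ (λ a b → a ∧ not b) (∈⇒lookup h∈) (∉⇒lookup t∉)

  infixl 6 _∣−_
  _∣−_ : Subset (e G) → Subset (e G) → Subset (e G)
  D ∣− A = D ∩ ∁ A

  module _ (l : ℕ) (D : Subset (e G)) (D-Rooted : Rooted (suc l) D) where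

    -- An arborescence A on the vertex set U, grown from r, whose removal costs at most one unit of connectivity.
    record Partial (U : Subset (n G)) (A : Subset (e G)) : Set where
      field
        root∈   : r ∈ U
        reach   : ∀ u → u ∈ U → Reach G A r u
        A⊆D     : A ⊆ D
        heads∈  : ∀ i → i ∈ A → hd i ∈ U
        -- One inequality for three cases: no arc of `A` ends at the root, at most one at any other
        -- vertex of `U`, none outside `U`.
        indeg≤  : ∀ v → indeg A v + δ r v ≤ ⟦ lookup U v ⟧
        rest    : Rooted l (D ∣− A)

    module _ {U A} (P : Partial U A) where
      open Partial P

      private
        Rest = D ∣− A

      Tight-beyond : Subset (n G) → Set
      Tight-beyond W = (∃ λ v → v ∈ W × v ∉ U) × ρ Rest W ≤ rootless r l W

      Tight-beyond? : ∀ W → Dec (Tight-beyond W)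
      Tight-beyond? W = any? (λ v → (v ∈? W) ×-dec ¬? (v ∈? U)) ×-dec (ρ Rest W ≤? rootless r l W)

      -- Arcs of `A` have their heads in `U`, so removing `A` takes away no arc entering a set
      -- outside `U`.
      ρ-beyond : ∀ W → ρ D (W ∩ ∁ U) ≤ ρ Rest (W ∩ ∁ U)
      ρ-beyond W = ∑-mono pointwise
        where
        pointwise : ∀ i → ⟦ lookup D i ⟧ * ⟦ enters (W ∩ ∁ U) i ⟧ ≤ ⟦ lookup Rest i ⟧ * ⟦ enters (W ∩ ∁ U) i ⟧
        pointwise i with lookup D i in d | enters (W ∩ ∁ U) i in en
        ... | false | _     = z≤n
        ... | true  | false = z≤n
        ... | true  | true  = ≤-reflexive (cong (λ b → ⟦ b ⟧ * 1) (sym (∈⇒lookup {X = Rest} (x∈p∩q⁺ (lookup⇒∈ d , x∉p⇒x∈∁p i∉A)))))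
          where
          i∉A : i ∉ A
          i∉A i∈A = x∈∁p⇒x∉p (proj₂ (x∈p∩q⁻ W (∁ U) (proj₁ (enters⇒ (W ∩ ∁ U) i en)))) (heads∈ i i∈A)

      NextArc : E → Set
      NextArc i = i ∈ Rest × tl i ∈ U × hd i ∉ U × (∀ Y → enters Y i ≡ true → suc (rootless r l Y) ≤ ρ Rest Y)

      -- No arc enters the full vertex set. It is thus a tight set to start from whenever `U` misses
      -- a vertex.
      ρ⊤ : ρ Rest ⊤ ≤ rootless r l ⊤
      ρ⊤ = ≤-trans (≤-reflexive (∑-0 (λ i → trans (cong (λ b → ⟦ lookup Rest i ⟧ * ⟦ b ⟧) (not-entered i)) (*-zeroʳ ⟦ lookup Rest i ⟧)))) z≤n
        where
        not-entered : ∀ i → enters ⊤ i ≡ false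
        not-entered i = cong₂ (λ a b → a ∧ not b) (∈⇒lookup (∈⊤ {x = hd i})) (∈⇒lookup (∈⊤ {x = tl i}))

      -- The part of `W` outside `U` misses the root and keeps its `suc l` entering arcs of `D`,
      -- whereas a tight `W` is entered by at most `l` arcs of `Rest`.
      beyond-more : ∀ W → Tight-beyond W → ρ Rest W < ρ Rest (W ∩ ∁ U)
      beyond-more W ((x , x∈W , x∉U) , tightW) = begin-strict
        ρ Rest W                    ≤⟨ tightW ⟩
        rootless r l W                ≤⟨ ≤-trans (*-monoˡ-≤ l (⟦⟧≤1 (not (lookup W r)))) (≤-reflexive (*-identityˡ l)) ⟩
        l                           <⟨ n<1+n l ⟩
        suc l                       ≡⟨ *-identityˡ (suc l) ⟨
        1 * suc l                   ≡⟨ cong (λ b → ⟦ not b ⟧ * suc l) (∉⇒lookup (λ r∈ → x∈∁p⇒x∉p (proj₂ (x∈p∩q⁻ W (∁ U) r∈)) root∈)) ⟨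
        rootless r (suc l) (W ∩ ∁ U)  ≤⟨ D-Rooted (W ∩ ∁ U) x (x∈p∩q⁺ (x∈W , x∉p⇒x∈∁p x∉U)) ⟩
        ρ D (W ∩ ∁ U)               ≤⟨ ρ-beyond W ⟩
        ρ Rest (W ∩ ∁ U)            ∎
        where open ≤-Reasoning

      -- `ρ` is submodular and `rootless` modular. The vertex `x` makes the union nonempty, so its
      -- requirement holds and absorbs none of the tightness.
      tight∩ : ∀ W Y x → x ∈ W → ρ Rest W ≤ rootless r l W → ρ Rest Y ≤ rootless r l Y → ρ Rest (W ∩ Y) ≤ rootless r l (W ∩ Y)
      tight∩ W Y x x∈W tightW tightY = +-cancelʳ-≤ (rootless r l (W ∪ Y)) _ _ (begin
        ρ Rest (W ∩ Y) + rootless r l (W ∪ Y)      ≤⟨ +-monoʳ-≤ _ (rest (W ∪ Y) x (x∈p∪q⁺ (inj₁ x∈W))) ⟩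
        ρ Rest (W ∩ Y) + ρ Rest (W ∪ Y)          ≤⟨ ρ-submodular Rest W Y ⟩
        ρ Rest W + ρ Rest Y                      ≤⟨ +-mono-≤ tightW tightY ⟩
        rootless r l W + rootless r l Y              ≡⟨ rootless-modular r l W Y ⟩
        rootless r l (W ∩ Y) + rootless r l (W ∪ Y)  ∎)
        where open ≤-Reasoning

      from-minimal : ∀ W → Tight-beyond W → (∀ Y → Tight-beyond Y → ∣ W ∣ ≤ ∣ Y ∣) →
                     ∀ i → i ∈ Rest → enters (W ∩ ∁ U) i ≡ true → enters W i ≡ false → NextArc i
      from-minimal W ((x , x∈W , x∉U) , tightW) least i i∈Rest into notW = i∈Rest , tl∈U , hd∉U , safe
        where
        hd∈ = x∈p∩q⁻ W (∁ U) (proj₁ (enters⇒ (W ∩ ∁ U) i into))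
        hd∈W = proj₁ hd∈
        hd∉U = x∈∁p⇒x∉p (proj₂ hd∈)
        tl∈W : tl i ∈ W
        tl∈W = decidable-stable (tl i ∈? W) (λ t∉ → contradiction (trans (sym notW) (⇒enters W i hd∈W t∉)) λ ())
        tl∈U : tl i ∈ U
        tl∈U = decidable-stable (tl i ∈? U) (λ t∉ → proj₂ (enters⇒ (W ∩ ∁ U) i into) (x∈p∩q⁺ (tl∈W , x∉p⇒x∈∁p t∉)))
        safe : ∀ Y → enters Y i ≡ true → suc (rootless r l Y) ≤ ρ Rest Y
        safe Y en = ≰⇒> λ tightY → <⇒≱ smaller (least (W ∩ Y) ((hd i , x∈p∩q⁺ (hd∈W , hd∈Y) , hd∉U) , tight∩ W Y x x∈W tightW tightY))
          where
          hd∈Y = proj₁ (enters⇒ Y i en)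
          tl∉Y = proj₂ (enters⇒ Y i en)
          smaller : ∣ W ∩ Y ∣ < ∣ W ∣
          smaller = p⊂q⇒∣p∣<∣q∣ (p∩q⊆p W Y , tl i , tl∈W , λ t∈ → tl∉Y (proj₂ (x∈p∩q⁻ W Y t∈)))

      opaque
        -- A minimal W that is tight and leaves U has an arc from W ∩ U to W ∖ U, as W ∖ U is not tight;
        -- were a tight Y entered by this arc, W ∩ Y would be smaller.
        next-arc : ∀ w → w ∉ U → ∃ NextArc
        next-arc w w∉U =
          let W , tight-beyond , least = minimal-subset Tight-beyond? (⊤ , (w , ∈⊤ , w∉U) , ρ⊤)
              i , i∈Rest , into , notW = ρ≤⇒arc Rest W (W ∩ ∁ U) (beyond-more W tight-beyond)
          in i , from-minimal W tight-beyond least i i∈Rest into notW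

      extend : ∀ i → i ∈ Rest → tl i ∈ U → hd i ∉ U → (∀ Y → enters Y i ≡ true → suc (rootless r l Y) ≤ ρ Rest Y) →
               Partial (U ∪ ⁅ hd i ⁆) (A ∪ ⁅ i ⁆)
      extend i i∈Rest tl∈U hd∉U safe = record
        { root∈  = x∈p∪q⁺ (inj₁ root∈)
        ; reach  = reach'
        ; A⊆D    = A'⊆D
        ; heads∈ = heads'
        ; indeg≤ = indeg'
        ; rest   = rest'
        }
        where
        open ≤-Reasoning
        A' = A ∪ ⁅ i ⁆
        i∉A : i ∉ A
        i∉A = x∈∁p⇒x∉p (proj₂ (x∈p∩q⁻ D (∁ A) i∈Rest))
        reach' : ∀ u → u ∈ U ∪ ⁅ hd i ⁆ → Reach G A' r u
        reach' u u∈ with x∈p∪q⁻ U ⁅ hd i ⁆ u∈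
        ... | inj₁ u∈U = Reach-mono (p⊆p∪q ⁅ i ⁆) (reach u u∈U)
        ... | inj₂ u∈h with refl ← x∈⁅y⁆⇒x≡y (hd i) u∈h =
          along (x∈p∪q⁺ (inj₂ (x∈⁅x⁆ i))) (Reach-mono (p⊆p∪q ⁅ i ⁆) (reach (tl i) tl∈U))
        A'⊆D : A' ⊆ D
        A'⊆D j∈ with x∈p∪q⁻ A ⁅ i ⁆ j∈
        ... | inj₁ j∈A = A⊆D j∈A
        ... | inj₂ j∈i with refl ← x∈⁅y⁆⇒x≡y i j∈i = proj₁ (x∈p∩q⁻ D (∁ A) i∈Rest)
        heads' : ∀ j → j ∈ A' → hd j ∈ U ∪ ⁅ hd i ⁆
        heads' j j∈ with x∈p∪q⁻ A ⁅ i ⁆ j∈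
        ... | inj₁ j∈A = x∈p∪q⁺ (inj₁ (heads∈ j j∈A))
        ... | inj₂ j∈i with refl ← x∈⁅y⁆⇒x≡y i j∈i = x∈p∪q⁺ (inj₂ (x∈⁅x⁆ (hd i)))
        indeg-A' : ∀ v → indeg A' v ≡ indeg A v + δ (hd i) v
        indeg-A' v = trans (∑-cong (λ j → trans (cong (_* δ (hd j) v) (insert-bit A i∉A j)) (*-distribʳ-+ (δ (hd j) v) ⟦ lookup A j ⟧ _)))
          (trans (∑-+ _ _) (cong (indeg A v +_) (∑-δ i (λ j → δ (hd j) v))))
        indeg' : ∀ v → indeg A' v + δ r v ≤ ⟦ lookup (U ∪ ⁅ hd i ⁆) v ⟧
        indeg' v = begin
          indeg A' v + δ r v                     ≡⟨ cong (_+ δ r v) (indeg-A' v) ⟩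
          indeg A v + δ (hd i) v + δ r v         ≡⟨ shuffle (indeg A v) (δ (hd i) v) (δ r v) ⟩
          indeg A v + δ r v + δ (hd i) v         ≤⟨ +-monoˡ-≤ (δ (hd i) v) (indeg≤ v) ⟩
          ⟦ lookup U v ⟧ + δ (hd i) v            ≡⟨ insert-bit U hd∉U v ⟨
          ⟦ lookup (U ∪ ⁅ hd i ⁆) v ⟧            ∎
          where
          shuffle : ∀ a b c → a + b + c ≡ a + c + b
          shuffle = solve-∀
        rest-bit : ∀ j → ⟦ lookup (D ∣− A') j ⟧ + δ i j ≡ ⟦ lookup Rest j ⟧
        rest-bit j with δ-cases i j
        ... | inj₁ (refl , q) = trans (cong₂ _+_ (cong ⟦_⟧ (∉⇒lookup (λ p → x∈∁p⇒x∉p (proj₂ (x∈p∩q⁻ D (∁ A') p)) (x∈p∪q⁺ (inj₂ (x∈⁅x⁆ i)))))) q)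
          (sym (cong ⟦_⟧ (∈⇒lookup i∈Rest)))
        ... | inj₂ (i≢j , q) = trans (trans (cong (⟦ lookup (D ∣− A') j ⟧ +_) q) (+-identityʳ _)) (cong ⟦_⟧ same)
          where
          same : lookup (D ∣− A') j ≡ lookup Rest j
          same = trans (lookup-∩ D (∁ A') j) (trans (cong (lookup D j ∧_) (trans (lookup-map j not A') (trans (cong not
            (trans (lookup-∪ A ⁅ i ⁆ j) (trans (cong (lookup A j ∨_) (∉⇒lookup (λ p → i≢j (sym (x∈⁅y⁆⇒x≡y i p))))) (∨-identityʳ _)))) (sym (lookup-map j not A)))))
            (sym (lookup-∩ D (∁ A) j)))
        ρ-split : ∀ Y → ρ (D ∣− A') Y + ⟦ enters Y i ⟧ ≡ ρ Rest Y
        ρ-split Y = trans (cong (ρ (D ∣− A') Y +_) (sym (∑-δ i (λ j → ⟦ enters Y j ⟧)))) (trans (sym (∑-+ _ _))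
          (∑-cong (λ j → trans (sym (*-distribʳ-+ ⟦ enters Y j ⟧ ⟦ lookup (D ∣− A') j ⟧ _)) (cong (_* ⟦ enters Y j ⟧) (rest-bit j)))))
        rest' : Rooted l (D ∣− A')
        rest' Y v v∈Y = by-arc (enters Y i) refl
          where
          by-arc : ∀ b → enters Y i ≡ b → rootless r l Y ≤ ρ (D ∣− A') Y
          by-arc true en = +-cancelʳ-≤ 1 _ _ (≤-trans (≤-reflexive (+-comm (rootless r l Y) 1)) (≤-trans (safe Y en)
            (≤-reflexive (trans (sym (ρ-split Y)) (cong (λ b → ρ (D ∣− A') Y + ⟦ b ⟧) en)))))
          by-arc false en = ≤-trans (rest Y v v∈Y) (≤-reflexive (trans (sym (ρ-split Y)) (trans (cong (λ b → ρ (D ∣− A') Y + ⟦ b ⟧) en) (+-identityʳ _))))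

    start : Partial ⁅ r ⁆ ⊥
    start = record
      { root∈  = x∈⁅x⁆ r
      ; reach  = λ u u∈ → subst (Reach G ⊥ r) (sym (x∈⁅y⁆⇒x≡y r u∈)) here
      ; A⊆D    = λ i∈⊥ → ⊥-elim (∉⊥ i∈⊥)
      ; heads∈ = λ i i∈⊥ → ⊥-elim (∉⊥ i∈⊥)
      ; indeg≤ = indeg⊥
      ; rest   = λ X v v∈X → ≤-trans (*-monoʳ-≤ ⟦ not (lookup X r) ⟧ (n≤1+n l)) (≤-trans (D-Rooted X v v∈X) (≤-reflexive (∑-cong (λ i → cong (λ b → ⟦ b ⟧ * ⟦ enters X i ⟧) (whole i)))))
      }
      where
      whole : ∀ i → lookup D i ≡ lookup (D ∣− ⊥) i
      whole i = sym (trans (lookup-∩ D (∁ ⊥) i) (trans (cong (lookup D i ∧_) (∈⇒lookup (x∉p⇒x∈∁p (∉⊥ {x = i})))) (∧-identityʳ _)))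
      indeg⊥ : ∀ v → indeg ⊥ v + δ r v ≤ ⟦ lookup ⁅ r ⁆ v ⟧
      indeg⊥ v = ≤-trans (≤-reflexive (cong (_+ δ r v) (∑-0 (λ i → cong (λ b → ⟦ b ⟧ * δ (hd i) v) (∉⇒lookup (∉⊥ {x = i})))))) (bound (δ-cases r v))
        where
        bound : (r ≡ v × δ r v ≡ 1) ⊎ (r ≢ v × δ r v ≡ 0) → δ r v ≤ ⟦ lookup ⁅ r ⁆ v ⟧
        bound (inj₁ (refl , q)) = ≤-reflexive (trans q (sym (cong ⟦_⟧ (∈⇒lookup (x∈⁅x⁆ r)))))
        bound (inj₂ (_ , q)) = ≤-trans (≤-reflexive q) z≤n

    opaque
      grow : ∀ B U A → n G < ∣ U ∣ + B → Partial U A → ∃ λ U → ∃ λ A → Partial U A × (∀ v → v ∈ U)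
      grow zero    U A room P = ⊥-elim (<⇒≱ room (≤-trans (≤-reflexive (+-identityʳ ∣ U ∣)) (∣p∣≤n U)))
      grow (suc B) U A room P = continue (any? (λ w → ¬? (w ∈? U)))
        where
        size : ∀ i → hd i ∉ U → ∣ U ∪ ⁅ hd i ⁆ ∣ ≡ ∣ U ∣ + 1
        size i hd∉U = trans (∣∣≡∑ (U ∪ ⁅ hd i ⁆)) (trans (∑-cong (insert-bit U hd∉U)) (trans (∑-+ _ _) (cong₂ _+_ (sym (∣∣≡∑ U)) (∑-δ1 (hd i)))))
        room' : ∀ i → hd i ∉ U → n G < ∣ U ∪ ⁅ hd i ⁆ ∣ + B
        room' i hd∉U = subst (n G <_) (sym (trans (cong (_+ B) (size i hd∉U)) (+-assoc ∣ U ∣ 1 B))) room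
        continue : Dec (∃ λ w → w ∉ U) → ∃ λ U → ∃ λ A → Partial U A × (∀ v → v ∈ U)
        continue (no full) = U , A , P , λ v → decidable-stable (v ∈? U) (λ v∉U → full (v , v∉U))
        continue (yes (w , w∉U)) = let i , i∈Rest , tl∈U , hd∉U , safe = next-arc P w w∉U in
          grow B (U ∪ ⁅ hd i ⁆) (A ∪ ⁅ i ⁆) (room' i hd∉U) (extend P i i∈Rest tl∈U hd∉U safe)

      spanning : ∃ λ U → ∃ λ A → Partial U A × (∀ v → v ∈ U)
      spanning = grow (suc (n G)) ⁅ r ⁆ ⊥ (m≤n+m (suc (n G)) _) start

  record Arborescence (A : Subset (e G)) : Set where
    field
      connected : Connected G A
      acyclic   : Acyclic G A
      indeg≤1   : ∀ v → indeg A v ≤ 1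

  opaque
    -- Acyclicity comes from counting: the in-degree bounds, summed over all vertices, leave at most
    -- n - 1 arcs in a connected subgraph.
    complete : ∀ {l D rooted U A} → Partial l D rooted U A → (∀ v → v ∈ U) → Arborescence A
    complete {l} {D} {rooted} {U} {A} P full =
      record { connected = conn ; acyclic = small-connected⇒Acyclic G A conn small ; indeg≤1 = λ v → ≤-trans (m≤m+n _ (δ r v)) (at-most-1 v) }
      where
      open Partial P
      open ≤-Reasoning
      conn : Connected G A
      conn u w = Reach-trans (Reach-sym (reach u (full u))) (reach w (full w))
      at-most-1 : ∀ v → indeg A v + δ r v ≤ 1
      at-most-1 v = ≤-trans (indeg≤ v) (⟦⟧≤1 (lookup U v))
      small : ∣ A ∣ + 1 ≤ n G
      small = begin
        ∣ A ∣ + 1                                ≡⟨ cong₂ _+_ (trans (∣∣≡∑ A) (∑-cong (λ i → sym (trans (cong (⟦ lookup A i ⟧ *_) (∑-δ1 (hd i))) (*-identityʳ _))))) (sym (∑-δ1 r)) ⟩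
        ∑ (λ i → ⟦ lookup A i ⟧ * ∑ (δ (hd i))) + ∑ (δ r) ≡⟨ cong (_+ ∑ (δ r)) (trans (∑-cong (λ i → sym (∑-*ˡ ⟦ lookup A i ⟧ _))) (∑-swap _)) ⟩
        ∑ (indeg A) + ∑ (δ r)                    ≡⟨ ∑-+ _ _ ⟨
        ∑ (λ v → indeg A v + δ r v)              ≤⟨ ∑-mono at-most-1 ⟩
        ∑ {n G} (λ _ → 1)                        ≡⟨ trans (∑-const (n G) 1) (*-identityʳ (n G)) ⟩
        n G                                      ∎

    arborescence : ∀ l D → Rooted (suc l) D → ∃ λ A → Arborescence A × A ⊆ D × Rooted l (D ∣− A)
    arborescence l D rooted = let U , A , P , full = spanning l D rooted in
      A , complete P full , Partial.A⊆D P , Partial.rest P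

    -- Edmonds' disjoint arborescences, by Lovász's argument.
    arborescences : ∀ l D → Rooted l D → ∃ λ (A : Fin l → Subset (e G)) → (∀ j → Arborescence (A j) × A j ⊆ D) × Disjoint G A
    arborescences zero    D _ = (λ ()) , (λ ()) , λ ()
    arborescences (suc l) D rooted = let A₀ , arb₀ , A₀⊆D , rest = arborescence l D rooted in
      add-arborescence arb₀ A₀⊆D (arborescences l (D ∣− A₀) rest)
      where
      add-arborescence : ∀ {A₀} → Arborescence A₀ → A₀ ⊆ D →
        (∃ λ (A : Fin l → Subset (e G)) → (∀ j → Arborescence (A j) × A j ⊆ D ∣− A₀) × Disjoint G A) →
        ∃ λ (A : Fin (suc l) → Subset (e G)) → (∀ j → Arborescence (A j) × A j ⊆ D) × Disjoint G A
      add-arborescence {A₀} arb₀ A₀⊆D (A , arbs , disj) = family , arbs' , disj'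
        where
        family : Fin (suc l) → Subset (e G)
        family zero    = A₀
        family (suc j) = A j
        arbs' : ∀ j → Arborescence (family j) × family j ⊆ D
        arbs' zero    = arb₀ , A₀⊆D
        arbs' (suc j) = proj₁ (arbs j) , λ i∈ → proj₁ (x∈p∩q⁻ D (∁ A₀) (proj₂ (arbs j) i∈))
        apart : ∀ j i → i ∈ A₀ → i ∈ A j → Empty
        apart j i i∈A₀ i∈A = x∈∁p⇒x∉p (proj₂ (x∈p∩q⁻ D (∁ A₀) (proj₂ (arbs j) i∈A))) i∈A₀
        disj' : Disjoint G family
        disj' zero    zero     0≢0   i p q = 0≢0 refl
        disj' zero    (suc j') _     i p q = apart j' i p q
        disj' (suc j) zero     _     i p q = apart j i q p
        disj' (suc j) (suc j') j≢j' i p q = disj j j' (λ eq → j≢j' (cong suc eq)) i p q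

-- The two cases of the theorem

module _ (k m : ℕ) .{{k≢0 : NonZero k}} (G : Graph) (Q : Subset (n G)) (Q-even : Even ∣ Q ∣) where
  private
    D = deg G ⊤

  from-trees : TreeConnected G ⊤ (k + m) →
    Σ (Subset (e G)) λ H → TreeConnected G H m ×
      (∀ v → deg G H v + ⌈ (D v ∸ m) / k ⌉ ≥ D v) × (∀ v → Odd (deg G H v) ⇔ v ∈ Q)
  from-trees (A , trees , disj) =
    let H , tc , bounds , parity = remove-parity-subgraph G Q Q-even T (λ j → proj₁ (proj₂ (trees (j ↑ˡ m))))
          (λ j → A (k ↑ʳ j)) (λ j → proj₁ (proj₂ (trees (k ↑ʳ j)))) (λ j → proj₂ (proj₂ (trees (k ↑ʳ j))))
          (λ j j' j≢j' → disj (k ↑ʳ j) (k ↑ʳ j') (λ eq → j≢j' (↑ʳ-injective k j j' eq)))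
          (λ j j' → disj (j ↑ˡ m) (k ↑ʳ j') (↑ˡ≢↑ʳ j j'))
    in H , tc , (λ v → let d , eq , d≤D , d≤r = bounds v in
         ≤-trans (≤-reflexive (sym eq)) (+-monoʳ-≤ (deg G H v) (removed v d d≤D d≤r))) , parity
    where
    open ≤-Reasoning
    T : Fin k → Subset (e G)
    T j = A (j ↑ˡ m)
    total≤ : ∀ v u → v ≢ u → ∑ (λ j → deg G (T j) v) + m ≤ D v
    total≤ v u v≢u = begin
      ∑ (λ j → deg G (T j) v) + m
        ≡⟨ cong (∑ (λ j → deg G (T j) v) +_) (trans (∑-const m 1) (*-identityʳ m)) ⟨
      ∑ (λ j → deg G (T j) v) + ∑ {m} (λ _ → 1)
        ≤⟨ +-monoʳ-≤ _ (∑-mono (λ j → Reach-deg G (proj₁ (proj₂ (trees (k ↑ʳ j))) v u) v≢u)) ⟩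
      ∑ (λ j → deg G (T j) v) + ∑ (λ j → deg G (A (k ↑ʳ j)) v)
        ≡⟨ ∑-↑ k m (λ j → deg G (A j) v) ⟨
      ∑ (λ j → deg G (A j) v)
        ≡⟨ ∑-cong (λ j → deg≡ G (A j) v) ⟩
      ∑ (λ j → ∑ (λ i → ⟦ lookup (A j) i ⟧ * inc G i v))
        ≤⟨ ∑-disjoint≤ G A disj (λ i → inc G i v) ⟩
      ∑ (λ i → inc G i v)
        ≡⟨ deg-⊤ G v ⟨
      D v ∎
    removed : ∀ v d → d ≤ D v → d ≤ ⌈ ∑ (λ j → deg G (T j) v) / k ⌉ → d ≤ ⌈ (D v ∸ m) / k ⌉
    -- A vertex that loses an edge has a neighbour, and this is why each of the `m` other trees has
    -- an edge there. With a single vertex `total≤` would fail.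
    removed v zero    _   _   = z≤n
    removed v (suc d) d≤D d≤r = let u , v≢u = deg-neighbour G ⊤ v (≤-trans (s≤s z≤n) d≤D) in
      ≤-trans d≤r (ceil-mono k (m+n≤o⇒m≤o∸n _ (total≤ v u v≢u)))

  module _ .{{_ : NonZero (2 * k)}} where

    from-root : Fin (n G) → EdgeConnected G (2 * k + 2 * m) →
      Σ (Subset (e G)) λ H → TreeConnected G H m ×
        (∀ v → deg G H v + (⌈ D v / 2 * k ⌉ + 1) ≥ D v) × (∀ v → Odd (deg G H v) ⇔ v ∈ Q)
    from-root r ec =
      let H , tc , bounds , parity = remove-parity-subgraph G Q Q-even T (λ j → connected (arb (j ↑ˡ m)))
            (λ j → A (k ↑ʳ j)) (λ j → connected (arb (k ↑ʳ j))) (λ j → acyclic (arb (k ↑ʳ j)))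
            (λ j j' j≢j' → disj (k ↑ʳ j) (k ↑ʳ j') (λ eq → j≢j' (↑ʳ-injective k j j' eq)))
            (λ j j' → disj (j ↑ˡ m) (k ↑ʳ j') (↑ˡ≢↑ʳ j j'))
      in H , tc , (λ v → let d , eq , _ , d≤r = bounds v in
           ≤-trans (≤-reflexive (sym eq)) (+-monoʳ-≤ (deg G H v) (≤-trans d≤r (ceil-≤ _ k _ (total≤ v))))) , parity
      where
      open ≤-Reasoning
      doubled : ∀ k m → 2 * k + 2 * m ≡ k + m + (k + m)
      doubled = solve-∀
      module C = Cuts G (k + m) (subst (EdgeConnected G) (doubled k m) ec) r
      open Arborescences G r C.hd C.tl C.hd-tl
      open Arborescence
      rooted : Rooted (k + m) ⊤
      rooted X v v∈X = ≤-trans (C.entering≥ X v v∈X) (≤-reflexive (∑-cong (λ i →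
        sym (trans (cong (λ b → ⟦ b ⟧ * ⟦ enters X i ⟧) (∈⇒lookup (∈⊤ {x = i}))) (*-identityˡ _)))))
      packing = arborescences (k + m) ⊤ rooted
      A = proj₁ packing
      arb : ∀ j → Arborescence (A j)
      arb j = proj₁ (proj₁ (proj₂ packing) j)
      disj = proj₂ (proj₂ packing)
      T : Fin k → Subset (e G)
      T j = A (j ↑ˡ m)
      inc-split : ∀ i v → inc G i v ≡ δ (C.hd i) v + δ (C.tl i) v
      inc-split i v with C.hd-tl i
      ... | inj₁ (h , t) = cong₂ _+_ (trans (δ-sym v (fst G i)) (cong (λ x → δ x v) (sym h))) (trans (δ-sym v (snd G i)) (cong (λ x → δ x v) (sym t)))
      ... | inj₂ (h , t) = trans (+-comm (δ v (fst G i)) _)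
        (cong₂ _+_ (trans (δ-sym v (snd G i)) (cong (λ x → δ x v) (sym h))) (trans (δ-sym v (fst G i)) (cong (λ x → δ x v) (sym t))))
      outdeg : Fin (n G) → ℕ
      outdeg v = ∑ (λ i → δ (C.tl i) v)
      D-split : ∀ v → D v ≡ C.m v + outdeg v
      D-split v = trans (deg-⊤ G v) (trans (∑-cong (λ i → inc-split i v)) (trans (∑-+ _ _) (cong (_+ outdeg v) (C.∑-hd v))))
      total : Fin (n G) → ℕ
      total v = ∑ (λ j → deg G (T j) v)
      -- Each of the `k` arborescences enters `v` at most once, and their arcs leaving `v` are
      -- disjoint.
      total≤out : ∀ v → total v ≤ k + outdeg v
      total≤out v = begin
        total v
          ≡⟨ ∑-cong (λ j → trans (deg≡ G (T j) v) (trans (∑-cong (λ i → trans (cong (⟦ lookup (T j) i ⟧ *_) (inc-split i v)) (*-distribˡ-+ ⟦ lookup (T j) i ⟧ _ _))) (∑-+ _ _))) ⟩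
        ∑ (λ j → indeg (T j) v + ∑ (λ i → ⟦ lookup (T j) i ⟧ * δ (C.tl i) v))
          ≡⟨ ∑-+ _ _ ⟩
        ∑ (λ j → indeg (T j) v) + ∑ (λ j → ∑ (λ i → ⟦ lookup (T j) i ⟧ * δ (C.tl i) v))
          ≤⟨ +-mono-≤ (∑-mono (λ j → indeg≤1 (arb (j ↑ˡ m)) v))
               (∑-disjoint≤ G T (λ j j' j≢j' → disj (j ↑ˡ m) (j' ↑ˡ m) (λ eq → j≢j' (↑ˡ-injective m j j' eq))) (λ i → δ (C.tl i) v)) ⟩
        ∑ {k} (λ _ → 1) + outdeg v
          ≡⟨ cong (_+ outdeg v) (trans (∑-const k 1) (*-identityʳ k)) ⟩
        k + outdeg v ∎
      halve : ∀ a b → a + a ≤ b + b + 1 → a ≤ b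
      halve a b h = ≮⇒≥ λ b<a → <⇒≱ (begin-strict
        b + b + 1        <⟨ n<1+n _ ⟩
        suc (b + b + 1)  ≡⟨ shift b ⟩
        suc b + suc b    ≤⟨ +-mono-≤ b<a b<a ⟩
        a + a            ∎) h
        where
        shift : ∀ b → 1 + (b + b + 1) ≡ 1 + b + (1 + b)
        shift = solve-∀
      -- Since `D v` is in-degree plus out-degree and at most twice the in-degree plus 1, twice the
      -- out-degree is at most `D v + 1`. The `k` entering arcs become the `+ 1` after the ceiling,
      -- and the remaining odd unit is lost in `halve`.
      total≤ : ∀ v → total v ≤ k * (⌈ D v / 2 * k ⌉ + 1)
      total≤ v = halve (total v) (k * (q + 1)) (begin
        total v + total v
          ≤⟨ +-mono-≤ (total≤out v) (total≤out v) ⟩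
        k + outdeg v + (k + outdeg v)
          ≤⟨ transfer-≤ (C.D≤2m+1 v) (balance k (outdeg v) (C.m v) (D v) (D-split v)) ⟩
        D v + 1 + (k + k)
          ≤⟨ +-monoˡ-≤ (k + k) (+-monoˡ-≤ 1 (ceil-≥ (D v) (2 * k))) ⟩
        2 * k * q + 1 + (k + k)
          ≡⟨ collect k q ⟩
        k * (q + 1) + k * (q + 1) + 1 ∎)
        where
        q = ⌈ D v / 2 * k ⌉
        collect : ∀ k q → 2 * k * q + 1 + (k + k) ≡ k * (q + 1) + k * (q + 1) + 1
        collect = solve-∀
        balance : ∀ k o m d → d ≡ m + o → k + o + (k + o) + (m + m + 1) ≡ d + 1 + (k + k) + d
        balance k o m _ refl = identity k o m
          where
          identity : ∀ k o m → k + o + (k + o) + (m + m + 1) ≡ m + o + 1 + (k + k) + (m + o)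
          identity = solve-∀

  -- Edmonds' theorem needs a root, so the graph without vertices is treated apart; it has no edges
  -- either.
  without-vertices : ¬ Fin (n G) → ∀ (f : Fin (n G) → ℕ) →
    Σ (Subset (e G)) λ H → TreeConnected G H m × (∀ v → deg G H v + f v ≥ D v) × (∀ v → Odd (deg G H v) ⇔ v ∈ Q)
  without-vertices none f = ⊤ , ((λ _ → ⊥) , (λ j → (λ {i} _ → no-edge i) , (λ u → ⊥-elim (none u)) , λ i → no-edge i) , λ _ _ _ i → no-edge i)
    , (λ v → ⊥-elim (none v)) , λ v → ⊥-elim (none v)
    where
    no-edge : ∀ {A : Set} → Fin (e G) → A
    no-edge i = ⊥-elim (none (fst G i))

theorem9p7 : (k m : ℕ) → .{{_ : NonZero k}} → .{{_ : NonZero m}} →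
    (G : Graph) → (Q : Subset (n G)) → Even ∣ Q ∣ →
    (TreeConnected G (allEdges G) (k + m) →
    Σ (Subset (e G)) λ H → TreeConnected G H m ×
    (∀ v → deg G H v + ⌈ (deg G (allEdges G) v ∸ m) / k ⌉ ≥ deg G (allEdges G) v) ×
    (∀ v → (Odd (deg G H v) ⇔ v ∈ Q)))
    × (EdgeConnected G (2 * k + 2 * m) →
    Σ (Subset (e G)) λ H → TreeConnected G H m ×
    (∀ v → deg G H v + (⌈ deg G (allEdges G) v / 2 * k ⌉ + 1) ≥ deg G (allEdges G) v) ×
    (∀ v → (Odd (deg G H v) ⇔ v ∈ Q)))
theorem9p7 k m G Q Q-even = from-trees k m G Q Q-even , λ ec →
  [ (λ r → from-root k m G Q Q-even {{m*n≢0 2 k}} r ec)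
  , (λ none → without-vertices k m G Q Q-even none (λ v → ⌈ deg G ⊤ v / 2 * k ⌉ + 1)) ]′ (inhabited (n G))
  where
  inhabited : ∀ n → Fin n ⊎ ¬ Fin n
  inhabited zero    = inj₂ λ ()
  inhabited (suc n) = inj₁ zero
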